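{- Assume that $4\le l\le 40$ and $l$ is even. Then there exists an algebraic modular form $f_{l,+}\in\mathcal{H}_{l,+}^{\Gamma}$ with integer coefficients (i.e. $f_{l,+}\in\mathbb{Z}[x_1,x_2,x_3]$) such that $$f_{l,+}(x)\equiv \mathrm{Nm}(x)^{l/2} \pmod 2$$ as polynomials in $\mathbb{Z}[x_1,x_2,x_3]$, where $\mathrm{Nm}(x)=3(x_1^2+x_2^2+x_3^2)-2(x_1x_2+x_2x_3+x_3x_1)$.
   Context: Let $D=\mathbb{Q}+\mathbb{Q}i+\mathbb{Q}j+\mathbb{Q}ij$ be the quaternion algebra over $\mathbb{Q}$ with $i^2=j^2=-1$, $ij=-ji$, with involution $\iota(a_0+a_1i+a_2j+a_3ij)=a_0-a_1i-a_2j-a_3ij$, $\mathrm{Tr}(x)=x+\iota(x)$, $\mathrm{Nm}(x)=x\,\iota(x)$. Let $\mathcal{O}=\mathbb{Z}+\mathbb{Z}i+\mathbb{Z}j+\mathbb{Z}w$ with $w=(1+i+j+ij)/2$ (the Hurwitz maximal order). Let $V_D=\{x\in D\mid \mathrm{Tr}(x)=0\}$, with basis $\mathbf{b}_1=-i+j+ij$, $\mathbf{b}_2=i-j+ij$, $\mathbf{b}_3=i+j-ij$; identify $x_1\mathbf{b}_1+x_2\mathbf{b}_2+x_3\mathbf{b}_3\in V_D$ with the row vector $x=(x_1,x_2,x_3)$, so that $\mathrm{Nm}(x)=3(x_1^2+x_2^2+x_3^2)-2(x_1x_2+x_2x_3+x_3x_1)$. For $g\in D^\times$ let $\mathcal{F}(g)\in\mathrm{SL}_3(\mathbb{Q})$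 be the matrix such that the map $x\mapsto g^{ -1}xg$ on $V_D$ is $x\mapsto x\,\mathcal{F}(g)$ on row vectors. Put $\Gamma=\mathcal{F}(\mathcal{O}^\times)$, a finite group of order $12$. For $l\ge 0$ let $\mathcal{A}_l$ be the $\mathbb{Q}$-space of homogeneous polynomials of degree $l$ in $\mathbb{Q}[x_1,x_2,x_3]$ (including $0$), let $\Delta_Q=\frac12\left(\frac{\partial^2}{\partial x_1^2}+\frac{\partial^2}{\partial x_2^2}+\frac{\partial^2}{\partial x_3^2}+\frac{\partial^2}{\partial x_1\partial x_2}+\frac{\partial^2}{\partial x_2\partial x_3}+\frac{\partial^2}{\partial x_3\partial x_1}\right)$, let $\mathcal{H}_l=\{f\in\mathcal{A}_l\mid\Delta_Qf=0\}$, and let $\mathcal{H}_l^\Gamma=\{f\in\mathcal{H}_l\mid f(x\gamma)=f(x)\ \forall\gamma\in\Gamma\}$; its elements are called algebraic modular forms of degree $l$. Let $\mathfrak{T}_2=\{\mathcal{F}(y)\mid y\in\mathcal{O},\ \mathrm{Nm}(y)=2\}$ and define $T_2$ on $\mathcal{H}_l^\Gamma$ by $(T_2f)(x)=\sum_{\gamma\in\Gamma\backslash\mathfrak{T}_2}f(x\gamma^{ -1})$. Set $\mathcal{H}_{l,+}^\Gamma=\{f\in\mathcal{H}_l^\Gamma\mid T_2f=(-1)^lf\}$. -}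

module Defs where

open import Algebra.Bundles using (RawRing)
open import Algebra.Core using (Op₂)
open import Algebra.Definitions using (Invertible)
import Algebra.Definitions.RawMonoid
import Algebra.Definitions.RawSemiring
open import Data.Bool.Base using (if_then_else_)
open import Data.Fin using (Fin; #_)
open import Data.Fin.Patterns using (0F; 1F; 2F)
import Data.Integer.Base
open import Data.Integer.Base as ℤ using (ℤ; +_)
import Data.Integer.DivMod
import Data.Integer.Divisibility as ℤ
import Data.Integer.Properties as ℤ
import Data.Integer.Solver
open import Data.List.Base as List using (List; []; _∷_)
open import Data.List.Relation.Unary.All using (All; []; _∷_)
open import Data.List.Relation.Unary.AllPairs using (AllPairs; []; _∷_)
open import Data.List.Relation.Unary.Any using (Any; here)
open import Data.Nat.Base as ℕ using (ℕ)
import Data.Nat.Properties as ℕ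
open import Data.Product.Base using (∃-syntax; ∃; _×_; _,_; proj₁; proj₂; map₁)
import Data.Rational.Base
open import Data.Rational.Base as ℚ using (ℚ; 0ℚ; 1ℚ; ½; _/_)
import Data.Rational.Properties as ℚ
import Data.Rational.Solver
open import Data.Rational.Unnormalised.Base as ℚᵘ using (mkℚᵘ; *≡*)
import Data.Rational.Unnormalised.Properties as ℚᵘ
open import Data.Sum.Base using (_⊎_; inj₁; inj₂)
open import Data.Vec.Base as Vec using (Vec; []; _∷_)
open import Data.Vec.Properties using (≡-dec)
open import Function.Base using (_∘_)
open import Level using (0ℓ)
open import Relation.Binary.Core using (Rel)
open import Relation.Binary.PropositionalEquality
open import Relation.Nullary using (¬_; does; contradiction)
open import Relation.Unary using (Pred; _∈_)

-- A polynomial is a formal sum of terms a · x₁^e₁ ⋯ xₙ^eₙ; the same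
-- exponent vector may occur more than once, so equality of polynomials
-- is _≈_ (equality of all coefficients), not _≡_.

module Polynomial {c ℓ} (R : RawRing c ℓ) (n : ℕ) where

  open RawRing R using (Carrier; 0#; 1#)
    renaming (_≈_ to _≈ᴿ_; _+_ to _+ᴿ_; _*_ to _*ᴿ_; -_ to -ᴿ_)
  private module R = Algebra.Definitions.RawSemiring (RawRing.rawSemiring R)

  Exponent : Set
  Exponent = Vec ℕ n

  Poly : Set c
  Poly = List (Carrier × Exponent)

  coeff : Poly → Exponent → Carrier
  coeff []            d = 0#
  coeff ((a , e) ∷ p) d =
    if does (≡-dec ℕ._≟_ e d) then a +ᴿ coeff p d else coeff p d

  infix 4 _≈_
  _≈_ : Rel Poly ℓ
  p ≈ q = ∀ e → coeff p e ≈ᴿ coeff q e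

  constant : Carrier → Poly
  constant a = (a , Vec.replicate n 0) ∷ []

  var : Fin n → Poly
  var i = (1# , Vec.replicate n 0 Vec.[ i ]≔ 1) ∷ []

  infixl 6 _+_
  _+_ : Op₂ Poly
  _+_ = List._++_

  infix 8 -_
  -_ : Poly → Poly
  -_ = List.map (map₁ -ᴿ_)

  infixl 7 _*_
  _*_ : Op₂ Poly
  _*_ = List.cartesianProductWith
    (λ (a , d) (b , e) → a *ᴿ b , Vec.zipWith ℕ._+_ d e)

  rawRing : RawRing c ℓ
  rawRing = record
    { Carrier = Poly ; _≈_ = _≈_ ; _+_ = _+_ ; _*_ = _*_ ; -_ = -_
    ; 0# = [] ; 1# = constant 1# }

  open Algebra.Definitions.RawSemiring (RawRing.rawSemiring rawRing) public
    using (_^_; sum; product)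

  infixr 7 _·_
  _·_ : Carrier → Poly → Poly
  a · p = constant a * p

  ∂ : Fin n → Poly → Poly
  ∂ i = List.map λ (a , e) → Vec.lookup e i R.× a , Vec.updateAt e i ℕ.pred

  -- f ⟨ σ ⟩ is f(σ₁, …, σₙ).
  _⟨_⟩ : Poly → (Fin n → Poly) → Poly
  f ⟨ σ ⟩ = List.foldr
    (λ (a , e) p → a · product (λ i → σ i ^ Vec.lookup e i) + p) [] f

  Homogeneous : ℕ → Pred Poly ℓ
  Homogeneous l f = ∀ e → Vec.sum e ≢ l → coeff f e ≈ᴿ 0#

module ℤ[x] = Polynomial ℤ.+-*-rawRing 3
module ℚ[x] = Polynomial ℚ.+-*-rawRing 3

fromℤ : ℤ → ℚ
fromℤ a = a / 1

toℚ[x] : ℤ[x].Poly → ℚ[x].Poly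
toℚ[x] = List.map (map₁ fromℤ)

infix 4 _≡_[mod_]
_≡_[mod_] : ℤ[x].Poly → ℤ[x].Poly → ℤ → Set
f ≡ g [mod m ] = ∀ e → m ℤ.∣ ℤ[x].coeff f e ℤ.- ℤ[x].coeff g e

NmPoly : ℤ[x].Poly
NmPoly = (+ 3) · (x₁ * x₁ + x₂ * x₂ + x₃ * x₃)
       + - ((+ 2) · (x₁ * x₂ + x₂ * x₃ + x₃ * x₁))
  where
  open ℤ[x]
  x₁ = var 0F
  x₂ = var 1F
  x₃ = var 2F

Row : Set
Row = Vec ℚ 3

Mat : Set
Mat = Vec Row 3

private module ℚΣ = Algebra.Definitions.RawMonoid ℚ.+-0-rawMonoid

_!_,_ : Mat → Fin 3 → Fin 3 → ℚ
M ! i , j = Vec.lookup (Vec.lookup M i) j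

infixl 7 _⊛_ _*ᴹ_
_⊛_ : Row → Mat → Row
x ⊛ M = Vec.tabulate λ j → ℚΣ.sum λ i → Vec.lookup x i ℚ.* (M ! i , j)

_*ᴹ_ : Op₂ Mat
M *ᴹ N = Vec.map (_⊛ N) M

1ᴹ : Mat
1ᴹ = (1ℚ ∷ 0ℚ ∷ 0ℚ ∷ []) ∷ (0ℚ ∷ 1ℚ ∷ 0ℚ ∷ []) ∷ (0ℚ ∷ 0ℚ ∷ 1ℚ ∷ []) ∷ []

GL₃ : Set
GL₃ = ∃ (Invertible _≡_ 1ᴹ _*ᴹ_)

mat : GL₃ → Mat
mat = proj₁

mat⁻¹ : GL₃ → Mat
mat⁻¹ γ = proj₁ (proj₂ γ)

-- f ⟨x M ⟩ is f(xM), with x = (x₁, x₂, x₃) a row vector.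
_⟨x_⟩ : ℚ[x].Poly → Mat → ℚ[x].Poly
f ⟨x M ⟩ = f ⟨ (λ j → sum λ i → (M ! i , j) · var i) ⟩
  where open ℚ[x]

-- quaternion a₀ a₁ a₂ a₃ is a₀ + a₁i + a₂j + a₃ij.
record D : Set where
  constructor quaternion
  field a₀ a₁ a₂ a₃ : ℚ

open D public

module _ where
  open Data.Rational.Base

  infixl 6 _+ᴰ_
  _+ᴰ_ : Op₂ D
  quaternion a b c d +ᴰ quaternion a′ b′ c′ d′ =
    quaternion (a + a′) (b + b′) (c + c′) (d + d′)

  infixl 7 _*ᴰ_
  _*ᴰ_ : Op₂ D
  quaternion a b c d *ᴰ quaternion a′ b′ c′ d′ = quaternion
    (a * a′ - b * b′ - c * c′ - d * d′)
    (a * b′ + b * a′ + c * d′ - d * c′)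
    (a * c′ - b * d′ + c * a′ + d * b′)
    (a * d′ + b * c′ - c * b′ + d * a′)

  infixr 7 _•_
  _•_ : ℚ → D → D
  q • quaternion a b c d = quaternion (q * a) (q * b) (q * c) (q * d)

  ι : D → D
  ι (quaternion a b c d) = quaternion a (- b) (- c) (- d)

fromℚ : ℚ → D
fromℚ q = quaternion q 0ℚ 0ℚ 0ℚ

0ᴰ 1ᴰ 𝐢 𝐣 𝐤 : D
0ᴰ = fromℚ 0ℚ
1ᴰ = fromℚ 1ℚ
𝐢 = quaternion 0ℚ 1ℚ 0ℚ 0ℚ
𝐣 = quaternion 0ℚ 0ℚ 1ℚ 0ℚ
𝐤 = 𝐢 *ᴰ 𝐣

Tr Nm : D → D
Tr x = x +ᴰ ι x
Nm x = x *ᴰ ι x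

Dˣ : Set
Dˣ = ∃ (Invertible _≡_ 1ᴰ _*ᴰ_)

el el⁻¹ : Dˣ → D
el   g = proj₁ g
el⁻¹ g = proj₁ (proj₂ g)

ω : D
ω = ½ • (1ᴰ +ᴰ 𝐢 +ᴰ 𝐣 +ᴰ 𝐤)

hurwitz : ℤ → ℤ → ℤ → ℤ → D
hurwitz n₀ n₁ n₂ n₃ =
  fromℤ n₀ • 1ᴰ +ᴰ fromℤ n₁ • 𝐢 +ᴰ fromℤ n₂ • 𝐣 +ᴰ fromℤ n₃ • ω

𝒪 : Pred D 0ℓ
𝒪 x = ∃[ n₀ ] ∃[ n₁ ] ∃[ n₂ ] ∃[ n₃ ] x ≡ hurwitz n₀ n₁ n₂ n₃

𝒪ˣ : Pred Dˣ 0ℓ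
𝒪ˣ u = el u ∈ 𝒪 × el⁻¹ u ∈ 𝒪

V_D : Pred D 0ℓ
V_D x = Tr x ≡ 0ᴰ

𝐛₁ 𝐛₂ 𝐛₃ : D
𝐛₁ = quaternion 0ℚ (ℚ.- 1ℚ) 1ℚ 1ℚ
𝐛₂ = quaternion 0ℚ 1ℚ (ℚ.- 1ℚ) 1ℚ
𝐛₃ = quaternion 0ℚ 1ℚ 1ℚ (ℚ.- 1ℚ)

⟦_⟧ : Row → D
⟦ x₁ ∷ x₂ ∷ x₃ ∷ [] ⟧ = x₁ • 𝐛₁ +ᴰ x₂ • 𝐛₂ +ᴰ x₃ • 𝐛₃

-- Inverse of ⟦_⟧ on V_D (see coordinates-⟦⟧ and ⟦⟧-coordinates).
coordinates : D → Row
coordinates (quaternion _ a b c) =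
  ½ ℚ.* (b ℚ.+ c) ∷ ½ ℚ.* (a ℚ.+ c) ∷ ½ ℚ.* (a ℚ.+ b) ∷ []

conjugate : Dˣ → D → D
conjugate g x = el⁻¹ g *ᴰ x *ᴰ el g

-- The matrix of conjugate g in the basis 𝐛₁, 𝐛₂, 𝐛₃; it is
-- characterised by 𝓕-spec below.
𝓕-mat : Dˣ → Mat
𝓕-mat g = Vec.map (coordinates ∘ conjugate g) (𝐛₁ ∷ 𝐛₂ ∷ 𝐛₃ ∷ [])

fromℤ≃ : ∀ a → ℚ.toℚᵘ (fromℤ a) ℚᵘ.≃ mkℚᵘ a 0
fromℤ≃ a = ℚ.toℚᵘ-fromℚᵘ (mkℚᵘ a 0)

fromℤ-injective : ∀ {a b} → fromℤ a ≡ fromℤ b → a ≡ b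
fromℤ-injective {a} {b} eq
  with *≡* a*1≡b*1 ← ℚᵘ.≃-trans (ℚᵘ.≃-sym (fromℤ≃ a))
         (ℚᵘ.≃-trans (ℚᵘ.≃-reflexive (cong ℚ.toℚᵘ eq)) (fromℤ≃ b))
  = trans (sym (ℤ.*-identityʳ a)) (trans a*1≡b*1 (ℤ.*-identityʳ b))

fromℤ-+ : ∀ a b → fromℤ (a ℤ.+ b) ≡ fromℤ a ℚ.+ fromℤ b
fromℤ-+ a b = ℚ.toℚᵘ-injective (ℚᵘ.≃-trans (fromℤ≃ (a ℤ.+ b)) (ℚᵘ.≃-sym
  (ℚᵘ.≃-trans (ℚ.toℚᵘ-homo-+ (fromℤ a) (fromℤ b))
  (ℚᵘ.≃-trans (ℚᵘ.+-cong (fromℤ≃ a) (fromℤ≃ b))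
    (*≡* (cong (ℤ._* (+ 1)) (cong₂ ℤ._+_ (ℤ.*-identityʳ a) (ℤ.*-identityʳ b))))))))

fromℤ-* : ∀ a b → fromℤ (a ℤ.* b) ≡ fromℤ a ℚ.* fromℤ b
fromℤ-* a b = ℚ.toℚᵘ-injective (ℚᵘ.≃-trans (fromℤ≃ (a ℤ.* b)) (ℚᵘ.≃-sym
  (ℚᵘ.≃-trans (ℚ.toℚᵘ-homo-* (fromℤ a) (fromℤ b))
    (ℚᵘ.*-cong (fromℤ≃ a) (fromℤ≃ b)))))

fromℤ-neg : ∀ a → fromℤ (ℤ.- a) ≡ ℚ.- fromℤ a
fromℤ-neg a = ℚ.toℚᵘ-injective (ℚᵘ.≃-trans (fromℤ≃ (ℤ.- a)) (ℚᵘ.≃-sym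
  (ℚᵘ.≃-trans (ℚ.toℚᵘ-homo‿- (fromℤ a)) (ℚᵘ.-‿cong (fromℤ≃ a)))))

module Parity where
  open Data.Integer.Solver.+-*-Solver using (solve; con; _:=_; _:+_; _:*_; _:-_; :-_)
  open Data.Integer.Base using (_+_; _*_; _-_; -_; ∣_∣)
  open Data.Integer.DivMod using (_/ℕ_; _%ℕ_; n%ℕd<d; a≡a%ℕn+[a/ℕn]*n)

  even⊎odd : ∀ n → ∃[ k ] (n ≡ + 2 * k ⊎ n ≡ + 2 * k + + 1)
  even⊎odd n with n %ℕ 2 in r | n%ℕd<d n 2 | a≡a%ℕn+[a/ℕn]*n n 2
  ... | 0 | _ | eq = n /ℕ 2 , inj₁ (trans eq
          (solve 1 (λ q → con (+ 0) :+ q :* con (+ 2) := con (+ 2) :* q) refl (n /ℕ 2)))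
  ... | 1 | _ | eq = n /ℕ 2 , inj₂ (trans eq
          (solve 1 (λ q → con (+ 1) :+ q :* con (+ 2) := con (+ 2) :* q :+ con (+ 1)) refl (n /ℕ 2)))
  ... | ℕ.suc (ℕ.suc _) | ℕ.s≤s (ℕ.s≤s ()) | _

  1-not-even : ∀ k → + 2 * k ≢ + 1
  1-not-even k eq = ℕ-case ∣ k ∣ (trans (sym (ℤ.abs-* (+ 2) k)) (cong ∣_∣ eq))
    where
    ℕ-case : ∀ m → 2 ℕ.* m ≢ 1
    ℕ-case (ℕ.suc m) eq with () ← trans (sym (ℕ.+-suc m (m ℕ.+ 0))) (ℕ.suc-injective eq)

  square : ∀ n → ∃[ t ] n * n ≡ n + + 2 * t
  square n with even⊎odd n
  ... | k , inj₁ refl = + 2 * k * k - k ,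
    solve 1 (λ k → con (+ 2) :* k :* (con (+ 2) :* k) :=
                   con (+ 2) :* k :+ con (+ 2) :* (con (+ 2) :* k :* k :- k)) refl k
  ... | k , inj₂ refl = + 2 * k * k + k ,
    solve 1 (λ k → (con (+ 2) :* k :+ con (+ 1)) :* (con (+ 2) :* k :+ con (+ 1)) :=
                   con (+ 2) :* k :+ con (+ 1) :+ con (+ 2) :* (con (+ 2) :* k :* k :+ k)) refl k

  double : ∀ k → + 2 * k ≡ k + k
  double = solve 1 (λ k → con (+ 2) :* k := k :+ k) refl

  quadratic : (n₀ n₁ n₂ n₃ : ℤ) → ℤ
  quadratic n₀ n₁ n₂ n₃ =
    n₀ * n₀ + n₁ * n₁ + n₂ * n₂ + n₃ * n₃ + n₃ * (n₀ + n₁ + n₂)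

  norm-2 : ∀ n₀ n₁ n₂ n₃ → quadratic n₀ n₁ n₂ n₃ ≡ + 2 →
           ∃[ p ] ∃[ q ] n₀ ≡ p + p + - (n₁ + n₂) × n₃ ≡ q + q
  norm-2 n₀ n₁ n₂ n₃ eq
    with even⊎odd (n₀ + n₁ + n₂) | even⊎odd n₃
       | square n₀ | square n₁ | square n₂ | square n₃
  ... | p , ps | q , qs | t₀ , e₀ | t₁ , e₁ | t₂ , e₂ | t₃ , e₃ = cases ps qs
    where
    s = n₀ + n₁ + n₂
    T = t₀ + t₁ + t₂ + t₃
    eq′ : + 2 * T + (s + n₃ + n₃ * s) ≡ + 2
    eq′ = trans (sym (trans
      (cong (_+ n₃ * s) (cong₂ _+_ (cong₂ _+_ (cong₂ _+_ e₀ e₁) e₂) e₃))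
      (solve 8 (λ n₀ n₁ n₂ n₃ t₀ t₁ t₂ t₃ →
          (n₀ :+ con (+ 2) :* t₀) :+ (n₁ :+ con (+ 2) :* t₁) :+ (n₂ :+ con (+ 2) :* t₂)
            :+ (n₃ :+ con (+ 2) :* t₃) :+ n₃ :* (n₀ :+ n₁ :+ n₂) :=
          con (+ 2) :* (t₀ :+ t₁ :+ t₂ :+ t₃)
            :+ (n₀ :+ n₁ :+ n₂ :+ n₃ :+ n₃ :* (n₀ :+ n₁ :+ n₂)))
        refl n₀ n₁ n₂ n₃ t₀ t₁ t₂ t₃))) eq

    impossible : ∀ {A : Set} a b → s ≡ a → n₃ ≡ b →
      (k : ℤ) → + 2 * T + (a + b + b * a) ≡ + 2 * k + + 1 → A
    impossible _ _ refl refl k odd = contradiction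
      (trans (solve 1 (λ k → con (+ 2) :* (con (+ 1) :- k) :=
                             con (+ 2) :+ con (+ 1) :- (con (+ 2) :* k :+ con (+ 1))) refl k)
             (cong (λ m → + 3 - m) (trans (sym odd) eq′)))
      (1-not-even (+ 1 - k))

    cases : s ≡ + 2 * p ⊎ s ≡ + 2 * p + + 1 → n₃ ≡ + 2 * q ⊎ n₃ ≡ + 2 * q + + 1 →
            ∃[ p ] ∃[ q ] n₀ ≡ p + p + - (n₁ + n₂) × n₃ ≡ q + q
    cases (inj₁ ps) (inj₁ qs) = p , q ,
      trans (solve 3 (λ a b c → a := a :+ b :+ c :+ :- (b :+ c)) refl n₀ n₁ n₂)
            (cong (_+ - (n₁ + n₂)) (trans ps (double p))) ,
      trans qs (double q)
    cases (inj₁ ps) (inj₂ qs) =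
      impossible (+ 2 * p) (+ 2 * q + + 1) ps qs (T + p + q + (+ 2 * q + + 1) * p)
        (solve 3 (λ T p q →
          con (+ 2) :* T :+ (con (+ 2) :* p :+ (con (+ 2) :* q :+ con (+ 1))
            :+ (con (+ 2) :* q :+ con (+ 1)) :* (con (+ 2) :* p)) :=
          con (+ 2) :* (T :+ p :+ q :+ (con (+ 2) :* q :+ con (+ 1)) :* p) :+ con (+ 1))
          refl T p q)
    cases (inj₂ ps) (inj₁ qs) =
      impossible (+ 2 * p + + 1) (+ 2 * q) ps qs (T + p + q + q * (+ 2 * p + + 1))
        (solve 3 (λ T p q →
          con (+ 2) :* T :+ (con (+ 2) :* p :+ con (+ 1) :+ con (+ 2) :* q
            :+ con (+ 2) :* q :* (con (+ 2) :* p :+ con (+ 1))) :=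
          con (+ 2) :* (T :+ p :+ q :+ q :* (con (+ 2) :* p :+ con (+ 1))) :+ con (+ 1))
          refl T p q)
    cases (inj₂ ps) (inj₂ qs) =
      impossible (+ 2 * p + + 1) (+ 2 * q + + 1) ps qs
        (T + + 2 * p + + 2 * q + + 2 * p * q + + 1)
        (solve 3 (λ T p q →
          con (+ 2) :* T :+ (con (+ 2) :* p :+ con (+ 1) :+ (con (+ 2) :* q :+ con (+ 1))
            :+ (con (+ 2) :* q :+ con (+ 1)) :* (con (+ 2) :* p :+ con (+ 1))) :=
          con (+ 2) :* (T :+ con (+ 2) :* p :+ con (+ 2) :* q :+ con (+ 2) :* p :* q :+ con (+ 1))
            :+ con (+ 1))
          refl T p q)

module SymbolicQuaternion where
  open Data.Rational.Solver.+-*-Solver using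
    (Polynomial; var; con; prove; _:+_; _:*_; _:-_; :-_)
    renaming (⟦_⟧ to ⟦_⟧ₚ; ⟦_⟧↓ to ⟦_⟧ₚ↓)

  -- Quaternions with solver expressions as coordinates, so that the
  -- identities below can be passed to the ring solver unexpanded.
  record S (n : ℕ) : Set where
    constructor quat
    field s₀ s₁ s₂ s₃ : Polynomial n
  open S public

  infixl 6 _⊹_
  infixl 7 _⊗_
  infixr 7 _⊙_
  _⊹_ _⊗_ : ∀ {n} → Op₂ (S n)
  quat a b c d ⊹ quat a′ b′ c′ d′ =
    quat (a :+ a′) (b :+ b′) (c :+ c′) (d :+ d′)
  quat a b c d ⊗ quat a′ b′ c′ d′ = quat
    (a :* a′ :- b :* b′ :- c :* c′ :- d :* d′)
    (a :* b′ :+ b :* a′ :+ c :* d′ :- d :* c′)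
    (a :* c′ :- b :* d′ :+ c :* a′ :+ d :* b′)
    (a :* d′ :+ b :* c′ :- c :* b′ :+ d :* a′)

  _⊙_ : ∀ {n} → Polynomial n → S n → S n
  q ⊙ quat a b c d = quat (q :* a) (q :* b) (q :* c) (q :* d)

  conj : ∀ {n} → S n → S n
  conj (quat a b c d) = quat a (:- b) (:- c) (:- d)

  constantₛ : ∀ {n} → D → S n
  constantₛ (quaternion a b c d) = quat (con a) (con b) (con c) (con d)

  eval eval↓ : ∀ {n} → Vec ℚ n → S n → D
  eval  ρ (quat a b c d) = quaternion (⟦ a ⟧ₚ ρ) (⟦ b ⟧ₚ ρ) (⟦ c ⟧ₚ ρ) (⟦ d ⟧ₚ ρ)
  eval↓ ρ (quat a b c d) = quaternion (⟦ a ⟧ₚ↓ ρ) (⟦ b ⟧ₚ↓ ρ) (⟦ c ⟧ₚ↓ ρ) (⟦ d ⟧ₚ↓ ρ)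

  quaternion-≡ : ∀ {x y} → a₀ x ≡ a₀ y → a₁ x ≡ a₁ y → a₂ x ≡ a₂ y → a₃ x ≡ a₃ y →
                 x ≡ y
  quaternion-≡ refl refl refl refl = refl

  solveᴰ : ∀ {n} (ρ : Vec ℚ n) x y → eval↓ ρ x ≡ eval↓ ρ y → eval ρ x ≡ eval ρ y
  solveᴰ ρ x y eq = quaternion-≡
    (prove ρ (s₀ x) (s₀ y) (cong a₀ eq)) (prove ρ (s₁ x) (s₁ y) (cong a₁ eq))
    (prove ρ (s₂ x) (s₂ y) (cong a₂ eq)) (prove ρ (s₃ x) (s₃ y) (cong a₃ eq))

  X Y Z : S 13
  X = quat (var (# 0)) (var (# 1)) (var (# 2)) (var (# 3))
  Y = quat (var (# 4)) (var (# 5)) (var (# 6)) (var (# 7))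
  Z = quat (var (# 8)) (var (# 9)) (var (# 10)) (var (# 11))

  q̂ : Polynomial 13
  q̂ = var (# 12)

  env : D → D → D → ℚ → Vec ℚ 13
  env (quaternion a b c d) (quaternion e f g h) (quaternion i j k l) q =
    a ∷ b ∷ c ∷ d ∷ e ∷ f ∷ g ∷ h ∷ i ∷ j ∷ k ∷ l ∷ q ∷ []

open SymbolicQuaternion
open Data.Rational.Solver.+-*-Solver using (prove; solve; con; _:=_; _:+_; _:*_; :-_)
open ≡-Reasoning

*ᴰ-assoc : ∀ x y z → x *ᴰ y *ᴰ z ≡ x *ᴰ (y *ᴰ z)
*ᴰ-assoc x y z = solveᴰ (env x y z 0ℚ) (X ⊗ Y ⊗ Z) (X ⊗ (Y ⊗ Z)) refl

*ᴰ-identityˡ : ∀ x → 1ᴰ *ᴰ x ≡ x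
*ᴰ-identityˡ x = solveᴰ (env x 0ᴰ 0ᴰ 0ℚ) (constantₛ 1ᴰ ⊗ X) X refl

*ᴰ-identityʳ : ∀ x → x *ᴰ 1ᴰ ≡ x
*ᴰ-identityʳ x = solveᴰ (env x 0ᴰ 0ᴰ 0ℚ) (X ⊗ constantₛ 1ᴰ) X refl

*ᴰ-distribˡ : ∀ x y z → x *ᴰ (y +ᴰ z) ≡ x *ᴰ y +ᴰ x *ᴰ z
*ᴰ-distribˡ x y z = solveᴰ (env x y z 0ℚ) (X ⊗ (Y ⊹ Z)) (X ⊗ Y ⊹ X ⊗ Z) refl

*ᴰ-distribʳ : ∀ x y z → (y +ᴰ z) *ᴰ x ≡ y *ᴰ x +ᴰ z *ᴰ x
*ᴰ-distribʳ x y z = solveᴰ (env x y z 0ℚ) ((Y ⊹ Z) ⊗ X) (Y ⊗ X ⊹ Z ⊗ X) refl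

*ᴰ-•ˡ : ∀ q x y → (q • x) *ᴰ y ≡ q • (x *ᴰ y)
*ᴰ-•ˡ q x y = solveᴰ (env x y 0ᴰ q) ((q̂ ⊙ X) ⊗ Y) (q̂ ⊙ (X ⊗ Y)) refl

*ᴰ-•ʳ : ∀ q x y → x *ᴰ (q • y) ≡ q • (x *ᴰ y)
*ᴰ-•ʳ q x y = solveᴰ (env x y 0ᴰ q) (X ⊗ (q̂ ⊙ Y)) (q̂ ⊙ (X ⊗ Y)) refl

a₀-comm : ∀ x y → a₀ (x *ᴰ y) ≡ a₀ (y *ᴰ x)
a₀-comm x y = prove (env x y 0ᴰ 0ℚ) (s₀ (X ⊗ Y)) (s₀ (Y ⊗ X)) refl

inverse-unique : ∀ x y z → y *ᴰ x ≡ 1ᴰ → x *ᴰ z ≡ 1ᴰ → y ≡ z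
inverse-unique x y z yx≡1 xz≡1 = begin
  y               ≡⟨ *ᴰ-identityʳ y ⟨
  y *ᴰ 1ᴰ         ≡⟨ cong (y *ᴰ_) xz≡1 ⟨
  y *ᴰ (x *ᴰ z)   ≡⟨ *ᴰ-assoc y x z ⟨
  y *ᴰ x *ᴰ z     ≡⟨ cong (_*ᴰ z) yx≡1 ⟩
  1ᴰ *ᴰ z         ≡⟨ *ᴰ-identityˡ z ⟩
  z               ∎

conjugate-+ : ∀ g x y → conjugate g (x +ᴰ y) ≡ conjugate g x +ᴰ conjugate g y
conjugate-+ (g , h , _) x y =
  trans (cong (_*ᴰ g) (*ᴰ-distribˡ h x y)) (*ᴰ-distribʳ g (h *ᴰ x) (h *ᴰ y))

conjugate-• : ∀ g q x → conjugate g (q • x) ≡ q • conjugate g x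
conjugate-• (g , h , _) q x =
  trans (cong (_*ᴰ g) (*ᴰ-•ʳ q h x)) (*ᴰ-•ˡ q (h *ᴰ x) g)

conjugate-combination : ∀ g p x q y r z →
  conjugate g (p • x +ᴰ q • y +ᴰ r • z) ≡
  p • conjugate g x +ᴰ q • conjugate g y +ᴰ r • conjugate g z
conjugate-combination g p x q y r z = begin
  conjugate g (p • x +ᴰ q • y +ᴰ r • z)
    ≡⟨ conjugate-+ g (p • x +ᴰ q • y) (r • z) ⟩
  conjugate g (p • x +ᴰ q • y) +ᴰ conjugate g (r • z)
    ≡⟨ cong (_+ᴰ conjugate g (r • z)) (conjugate-+ g (p • x) (q • y)) ⟩
  conjugate g (p • x) +ᴰ conjugate g (q • y) +ᴰ conjugate g (r • z)
    ≡⟨ cong₂ _+ᴰ_ (cong₂ _+ᴰ_ (conjugate-• g p x) (conjugate-• g q y)) (conjugate-• g r z) ⟩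
  p • conjugate g x +ᴰ q • conjugate g y +ᴰ r • conjugate g z ∎

a₀-conjugate : ∀ g x → a₀ (conjugate g x) ≡ a₀ x
a₀-conjugate (g , h , _ , gh≡1) x = begin
  a₀ (h *ᴰ x *ᴰ g)     ≡⟨ a₀-comm (h *ᴰ x) g ⟩
  a₀ (g *ᴰ (h *ᴰ x))   ≡⟨ cong a₀ (*ᴰ-assoc g h x) ⟨
  a₀ (g *ᴰ h *ᴰ x)     ≡⟨ cong (λ y → a₀ (y *ᴰ x)) gh≡1 ⟩
  a₀ (1ᴰ *ᴰ x)         ≡⟨ cong a₀ (*ᴰ-identityˡ x) ⟩
  a₀ x                 ∎

conjugate-∘ : ∀ g h w → el w ≡ el g *ᴰ el h → ∀ x →
              conjugate h (conjugate g x) ≡ conjugate w x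
conjugate-∘ (g , g⁻ , g⁻g≡1 , _) (h , h⁻ , h⁻h≡1 , _) (w , w⁻ , _ , ww⁻≡1) w≡gh x = begin
  h⁻ *ᴰ (g⁻ *ᴰ x *ᴰ g) *ᴰ h      ≡⟨ *ᴰ-assoc h⁻ _ h ⟩
  h⁻ *ᴰ (g⁻ *ᴰ x *ᴰ g *ᴰ h)      ≡⟨ cong (h⁻ *ᴰ_) (*ᴰ-assoc (g⁻ *ᴰ x) g h) ⟩
  h⁻ *ᴰ (g⁻ *ᴰ x *ᴰ (g *ᴰ h))    ≡⟨ *ᴰ-assoc h⁻ (g⁻ *ᴰ x) (g *ᴰ h) ⟨
  h⁻ *ᴰ (g⁻ *ᴰ x) *ᴰ (g *ᴰ h)    ≡⟨ cong (_*ᴰ (g *ᴰ h)) (*ᴰ-assoc h⁻ g⁻ x) ⟨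
  h⁻ *ᴰ g⁻ *ᴰ x *ᴰ (g *ᴰ h)      ≡⟨ cong₂ (λ y z → y *ᴰ x *ᴰ z) h⁻g⁻≡w⁻ (sym w≡gh) ⟩
  w⁻ *ᴰ x *ᴰ w                   ∎
  where
  h⁻g⁻≡w⁻ : h⁻ *ᴰ g⁻ ≡ w⁻
  h⁻g⁻≡w⁻ = inverse-unique w _ _ (begin
    h⁻ *ᴰ g⁻ *ᴰ w            ≡⟨ cong (h⁻ *ᴰ g⁻ *ᴰ_) w≡gh ⟩
    h⁻ *ᴰ g⁻ *ᴰ (g *ᴰ h)     ≡⟨ *ᴰ-assoc h⁻ g⁻ (g *ᴰ h) ⟩
    h⁻ *ᴰ (g⁻ *ᴰ (g *ᴰ h))   ≡⟨ cong (h⁻ *ᴰ_) (*ᴰ-assoc g⁻ g h) ⟨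
    h⁻ *ᴰ (g⁻ *ᴰ g *ᴰ h)     ≡⟨ cong (λ y → h⁻ *ᴰ (y *ᴰ h)) g⁻g≡1 ⟩
    h⁻ *ᴰ (1ᴰ *ᴰ h)          ≡⟨ cong (h⁻ *ᴰ_) (*ᴰ-identityˡ h) ⟩
    h⁻ *ᴰ h                  ≡⟨ h⁻h≡1 ⟩
    1ᴰ                       ∎) ww⁻≡1

a₀-⟦⟧ : ∀ x → a₀ ⟦ x ⟧ ≡ 0ℚ
a₀-⟦⟧ (x₁ ∷ x₂ ∷ x₃ ∷ []) =
  solve 3 (λ a b c → a :* con 0ℚ :+ b :* con 0ℚ :+ c :* con 0ℚ := con 0ℚ) refl x₁ x₂ x₃

⟦⟧-coordinates₀ : ∀ x → a₀ x ≡ 0ℚ → ⟦ coordinates x ⟧ ≡ x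
⟦⟧-coordinates₀ x a₀x≡0 = begin
  ⟦ coordinates x ⟧
    ≡⟨ solveᴰ (env x 0ᴰ 0ᴰ 0ℚ)
         ((con ½ :* (s₂ X :+ s₃ X)) ⊙ constantₛ 𝐛₁
           ⊹ (con ½ :* (s₁ X :+ s₃ X)) ⊙ constantₛ 𝐛₂
           ⊹ (con ½ :* (s₁ X :+ s₂ X)) ⊙ constantₛ 𝐛₃)
         (quat (con 0ℚ) (s₁ X) (s₂ X) (s₃ X)) refl ⟩
  quaternion 0ℚ (a₁ x) (a₂ x) (a₃ x)
    ≡⟨ cong (λ a → quaternion a (a₁ x) (a₂ x) (a₃ x)) a₀x≡0 ⟨
  x ∎

⟦⟧-⊛ : ∀ x r₁ r₂ r₃ →
  ⟦ x ⊛ (r₁ ∷ r₂ ∷ r₃ ∷ []) ⟧ ≡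
  Vec.lookup x 0F • ⟦ r₁ ⟧ +ᴰ Vec.lookup x 1F • ⟦ r₂ ⟧ +ᴰ Vec.lookup x 2F • ⟦ r₃ ⟧
⟦⟧-⊛ (x₁ ∷ x₂ ∷ x₃ ∷ []) (a ∷ b ∷ c ∷ []) (d ∷ e ∷ f ∷ []) (g ∷ h ∷ i ∷ []) =
  solveᴰ (env (quaternion x₁ x₂ x₃ a) (quaternion b c d e) (quaternion f g h i) 0ℚ)
    (combination (entry (s₃ X) (s₂ Y) (s₁ Z)) (entry (s₀ Y) (s₃ Y) (s₂ Z))
                 (entry (s₁ Y) (s₀ Z) (s₃ Z)))
    (s₀ X ⊙ combination (s₃ X) (s₀ Y) (s₁ Y)
      ⊹ s₁ X ⊙ combination (s₂ Y) (s₃ Y) (s₀ Z)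
      ⊹ s₂ X ⊙ combination (s₁ Z) (s₂ Z) (s₃ Z)) refl
  where
  entry : (p q r : _) → _
  entry p q r = s₀ X :* p :+ (s₁ X :* q :+ (s₂ X :* r :+ con 0ℚ))
  combination : (p q r : _) → S 13
  combination p q r = p ⊙ constantₛ 𝐛₁ ⊹ q ⊙ constantₛ 𝐛₂ ⊹ r ⊙ constantₛ 𝐛₃

V_D⇒a₀≡0 : ∀ x → x ∈ V_D → a₀ x ≡ 0ℚ
V_D⇒a₀≡0 x Tr≡0 = begin
  a₀ x                     ≡⟨ solve 1 (λ a → a := con ½ :* (a :+ a)) refl (a₀ x) ⟩
  ½ ℚ.* (a₀ x ℚ.+ a₀ x)    ≡⟨ cong (λ y → ½ ℚ.* a₀ y) Tr≡0 ⟩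
  0ℚ                       ∎

a₀≡0⇒V_D : ∀ x → a₀ x ≡ 0ℚ → x ∈ V_D
a₀≡0⇒V_D x a₀≡0 = quaternion-≡ (cong₂ ℚ._+_ a₀≡0 a₀≡0)
  (ℚ.+-inverseʳ (a₁ x)) (ℚ.+-inverseʳ (a₂ x)) (ℚ.+-inverseʳ (a₃ x))

⟦⟧∈V_D : ∀ x → ⟦ x ⟧ ∈ V_D
⟦⟧∈V_D x = a₀≡0⇒V_D ⟦ x ⟧ (a₀-⟦⟧ x)

⟦⟧-coordinates : ∀ x → x ∈ V_D → ⟦ coordinates x ⟧ ≡ x
⟦⟧-coordinates x x∈V = ⟦⟧-coordinates₀ x (V_D⇒a₀≡0 x x∈V)

coordinates-⟦⟧ : ∀ x → coordinates ⟦ x ⟧ ≡ x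
coordinates-⟦⟧ (x₁ ∷ x₂ ∷ x₃ ∷ []) = cong₂ _∷_ eq₁ (cong₂ _∷_ eq₂ (cong₂ _∷_ eq₃ refl))
  where
  ρ = env (quaternion x₁ x₂ x₃ 0ℚ) 0ᴰ 0ᴰ 0ℚ
  v = s₀ X ⊙ constantₛ 𝐛₁ ⊹ s₁ X ⊙ constantₛ 𝐛₂ ⊹ s₂ X ⊙ constantₛ 𝐛₃
  eq₁ = prove ρ (con ½ :* (s₂ v :+ s₃ v)) (s₀ X) refl
  eq₂ = prove ρ (con ½ :* (s₁ v :+ s₃ v)) (s₁ X) refl
  eq₃ = prove ρ (con ½ :* (s₁ v :+ s₂ v)) (s₂ X) refl

𝓕-spec : ∀ g x → conjugate g ⟦ x ⟧ ≡ ⟦ x ⊛ 𝓕-mat g ⟧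
𝓕-spec g x@(x₁ ∷ x₂ ∷ x₃ ∷ []) = begin
  conjugate g ⟦ x ⟧
    ≡⟨ conjugate-combination g x₁ 𝐛₁ x₂ 𝐛₂ x₃ 𝐛₃ ⟩
  x₁ • conjugate g 𝐛₁ +ᴰ x₂ • conjugate g 𝐛₂ +ᴰ x₃ • conjugate g 𝐛₃
    ≡⟨ cong₂ _+ᴰ_ (cong₂ _+ᴰ_ (cong (x₁ •_) (⟦row⟧ 𝐛₁ refl)) (cong (x₂ •_) (⟦row⟧ 𝐛₂ refl)))
                  (cong (x₃ •_) (⟦row⟧ 𝐛₃ refl)) ⟨
  x₁ • ⟦ row 𝐛₁ ⟧ +ᴰ x₂ • ⟦ row 𝐛₂ ⟧ +ᴰ x₃ • ⟦ row 𝐛₃ ⟧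
    ≡⟨ ⟦⟧-⊛ x (row 𝐛₁) (row 𝐛₂) (row 𝐛₃) ⟨
  ⟦ x ⊛ 𝓕-mat g ⟧ ∎
  where
  row = coordinates ∘ conjugate g
  ⟦row⟧ : ∀ b → a₀ b ≡ 0ℚ → ⟦ row b ⟧ ≡ conjugate g b
  ⟦row⟧ b a₀b≡0 =
    ⟦⟧-coordinates₀ (conjugate g b) (trans (a₀-conjugate g b) a₀b≡0)

𝓕-* : ∀ g h w → el w ≡ el g *ᴰ el h → 𝓕-mat g *ᴹ 𝓕-mat h ≡ 𝓕-mat w
𝓕-* g h w w≡gh = cong₂ _∷_ (row 𝐛₁ refl)
  (cong₂ _∷_ (row 𝐛₂ refl) (cong₂ _∷_ (row 𝐛₃ refl) refl))
  where
  row : ∀ b → a₀ b ≡ 0ℚ →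
        coordinates (conjugate g b) ⊛ 𝓕-mat h ≡ coordinates (conjugate w b)
  row b a₀b≡0 = begin
    coordinates (conjugate g b) ⊛ 𝓕-mat h
      ≡⟨ coordinates-⟦⟧ _ ⟨
    coordinates ⟦ coordinates (conjugate g b) ⊛ 𝓕-mat h ⟧
      ≡⟨ cong coordinates (𝓕-spec h (coordinates (conjugate g b))) ⟨
    coordinates (conjugate h ⟦ coordinates (conjugate g b) ⟧)
      ≡⟨ cong (coordinates ∘ conjugate h)
           (⟦⟧-coordinates₀ _ (trans (a₀-conjugate g b) a₀b≡0)) ⟩
    coordinates (conjugate h (conjugate g b))
      ≡⟨ cong coordinates (conjugate-∘ g h w w≡gh b) ⟩
    coordinates (conjugate w b) ∎

1ˣ : Dˣ
1ˣ = 1ᴰ , 1ᴰ , refl , refl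

_⁻¹ : Dˣ → Dˣ
(g , h , hg≡1 , gh≡1) ⁻¹ = h , g , gh≡1 , hg≡1

𝓕 : Dˣ → GL₃
𝓕 g@(_ , _ , g⁻g≡1 , gg⁻≡1) =
  𝓕-mat g , 𝓕-mat (g ⁻¹) ,
  𝓕-* (g ⁻¹) g 1ˣ (sym g⁻g≡1) , 𝓕-* g (g ⁻¹) 1ˣ (sym gg⁻≡1)

𝓕-homo : ∀ g h w → el w ≡ el g *ᴰ el h → mat (𝓕 w) ≡ mat (𝓕 g) *ᴹ mat (𝓕 h)
𝓕-homo g h w w≡gh = sym (𝓕-* g h w w≡gh)

Γ : Pred GL₃ 0ℓ
Γ γ = ∃[ u ] u ∈ 𝒪ˣ × mat γ ≡ mat (𝓕 u)

𝔗₂ : Pred GL₃ 0ℓ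
𝔗₂ γ = ∃[ y ] el y ∈ 𝒪 × Nm (el y) ≡ fromℚ (fromℤ (+ 2)) × mat γ ≡ mat (𝓕 y)

-- γ ~[ G ] δ says that Gγ = Gδ.
_~[_]_ : GL₃ → Pred GL₃ 0ℓ → GL₃ → Set
γ ~[ G ] δ = ∃[ α ] α ∈ G × mat γ ≡ mat α *ᴹ mat δ

-- A system of representatives of G \ S.
record Representatives (G S : Pred GL₃ 0ℓ) : Set where
  field
    list     : List GL₃
    sound    : All S list
    complete : ∀ γ → γ ∈ S → Any (γ ~[ G ]_) list
    distinct : AllPairs (λ γ δ → ¬ γ ~[ G ] δ) list

open Parity using (quadratic; norm-2)

N : D → ℚ
N x = a₀ (Nm x)

Nm≡N : ∀ x → Nm x ≡ fromℚ (N x)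
Nm≡N x = solveᴰ (env x 0ᴰ 0ᴰ 0ℚ) (X ⊗ conj X) (quat (s₀ (X ⊗ conj X)) 0ₛ 0ₛ 0ₛ) refl
  where 0ₛ = con 0ℚ

ι*≡N : ∀ x → ι x *ᴰ x ≡ fromℚ (N x)
ι*≡N x = solveᴰ (env x 0ᴰ 0ᴰ 0ℚ) (conj X ⊗ X) (quat (s₀ (X ⊗ conj X)) 0ₛ 0ₛ 0ₛ) refl
  where 0ₛ = con 0ℚ

N-* : ∀ x y → N (x *ᴰ y) ≡ N x ℚ.* N y
N-* x y = prove (env x y 0ᴰ 0ℚ) (s₀ ((X ⊗ Y) ⊗ conj (X ⊗ Y)))
                (s₀ (X ⊗ conj X) :* s₀ (Y ⊗ conj Y)) refl

hurwitzₛ : S 13 → S 13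
hurwitzₛ (quat a b c d) =
  a ⊙ constantₛ 1ᴰ ⊹ b ⊙ constantₛ 𝐢 ⊹ c ⊙ constantₛ 𝐣 ⊹ d ⊙ constantₛ ω

N-hurwitz : ∀ n₀ n₁ n₂ n₃ → N (hurwitz n₀ n₁ n₂ n₃) ≡ fromℤ (quadratic n₀ n₁ n₂ n₃)
N-hurwitz n₀ n₁ n₂ n₃
  rewrite fromℤ-+ (n₀ ℤ.* n₀ ℤ.+ n₁ ℤ.* n₁ ℤ.+ n₂ ℤ.* n₂ ℤ.+ n₃ ℤ.* n₃) (n₃ ℤ.* (n₀ ℤ.+ n₁ ℤ.+ n₂))
        | fromℤ-+ (n₀ ℤ.* n₀ ℤ.+ n₁ ℤ.* n₁ ℤ.+ n₂ ℤ.* n₂) (n₃ ℤ.* n₃)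
        | fromℤ-+ (n₀ ℤ.* n₀ ℤ.+ n₁ ℤ.* n₁) (n₂ ℤ.* n₂)
        | fromℤ-+ (n₀ ℤ.* n₀) (n₁ ℤ.* n₁)
        | fromℤ-* n₃ (n₀ ℤ.+ n₁ ℤ.+ n₂)
        | fromℤ-+ (n₀ ℤ.+ n₁) n₂ | fromℤ-+ n₀ n₁
        | fromℤ-* n₀ n₀ | fromℤ-* n₁ n₁ | fromℤ-* n₂ n₂ | fromℤ-* n₃ n₃ =
  prove (env (quaternion (fromℤ n₀) (fromℤ n₁) (fromℤ n₂) (fromℤ n₃)) 0ᴰ 0ᴰ 0ℚ)
    (s₀ (hurwitzₛ X ⊗ conj (hurwitzₛ X)))
    (s₀ X :* s₀ X :+ s₁ X :* s₁ X :+ s₂ X :* s₂ X :+ s₃ X :* s₃ X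
      :+ s₃ X :* (s₀ X :+ s₁ X :+ s₂ X)) refl

π : Dˣ
π = quaternion 1ℚ 1ℚ 0ℚ 0ℚ , quaternion ½ (ℚ.- ½) 0ℚ 0ℚ , refl , refl

ι-hurwitz : ∀ n₀ n₁ n₂ n₃ →
  ι (hurwitz n₀ n₁ n₂ n₃) ≡ hurwitz (n₀ ℤ.+ n₃) (ℤ.- n₁) (ℤ.- n₂) (ℤ.- n₃)
ι-hurwitz n₀ n₁ n₂ n₃
  rewrite fromℤ-+ n₀ n₃ | fromℤ-neg n₁ | fromℤ-neg n₂ | fromℤ-neg n₃ =
  solveᴰ (env (quaternion (fromℤ n₀) (fromℤ n₁) (fromℤ n₂) (fromℤ n₃)) 0ᴰ 0ᴰ 0ℚ)
    (conj (hurwitzₛ X))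
    (hurwitzₛ (quat (s₀ X :+ s₃ X) (:- s₁ X) (:- s₂ X) (:- s₃ X))) refl

hurwitz-*π : ∀ p q n₁ n₂ →
  hurwitz (p ℤ.+ ℤ.- n₂) (n₁ ℤ.+ ℤ.- (p ℤ.+ q)) (ℤ.- q) (n₂ ℤ.+ (q ℤ.+ q)) *ᴰ el π ≡
  hurwitz (p ℤ.+ p ℤ.+ ℤ.- (n₁ ℤ.+ n₂)) n₁ n₂ (q ℤ.+ q)
hurwitz-*π p q n₁ n₂
  rewrite fromℤ-+ p (ℤ.- n₂) | fromℤ-neg n₂ | fromℤ-+ n₁ (ℤ.- (p ℤ.+ q))
        | fromℤ-neg (p ℤ.+ q) | fromℤ-+ p q | fromℤ-neg q | fromℤ-+ n₂ (q ℤ.+ q)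
        | fromℤ-+ (p ℤ.+ p) (ℤ.- (n₁ ℤ.+ n₂)) | fromℤ-neg (n₁ ℤ.+ n₂)
        | fromℤ-+ n₁ n₂ | fromℤ-+ p p | fromℤ-+ q q =
  solveᴰ (env (quaternion (fromℤ p) (fromℤ q) (fromℤ n₁) (fromℤ n₂)) 0ᴰ 0ᴰ 0ℚ)
    (hurwitzₛ (quat (P :+ :- B) (A :+ :- (P :+ Q)) (:- Q) (B :+ (Q :+ Q))) ⊗ constantₛ (el π))
    (hurwitzₛ (quat (P :+ P :+ :- (A :+ B)) A B (Q :+ Q))) refl
  where
  P = s₀ X
  Q = s₁ X
  A = s₂ X
  B = s₃ X

N-/π : ∀ u y → y ≡ u *ᴰ el π → N y ≡ fromℤ (+ 2) → N u ≡ 1ℚ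
N-/π u y y≡uπ Ny≡2 = begin
  N u                        ≡⟨ half (N u) ⟩
  ½ ℚ.* (N u ℚ.* N (el π))   ≡⟨ cong (½ ℚ.*_) (N-* u (el π)) ⟨
  ½ ℚ.* N (u *ᴰ el π)        ≡⟨ cong (λ z → ½ ℚ.* N z) y≡uπ ⟨
  ½ ℚ.* N y                  ≡⟨ cong (½ ℚ.*_) Ny≡2 ⟩
  1ℚ                         ∎
  where
  half : ∀ a → a ≡ ½ ℚ.* (a ℚ.* fromℤ (+ 2))
  half = solve 1 (λ a → a := con ½ :* (a :* con (fromℤ (+ 2)))) refl

N≡1⇒𝒪ˣ : ∀ u → u ∈ 𝒪 → N u ≡ 1ℚ → ∃[ v ] v ∈ 𝒪ˣ × el v ≡ u
N≡1⇒𝒪ˣ u (m₀ , m₁ , m₂ , m₃ , u≡) Nu≡1 =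
  (u , ι u , trans (ι*≡N u) (cong fromℚ Nu≡1) , trans (Nm≡N u) (cong fromℚ Nu≡1)) ,
  ( (m₀ , m₁ , m₂ , m₃ , u≡)
  , (m₀ ℤ.+ m₃ , ℤ.- m₁ , ℤ.- m₂ , ℤ.- m₃ , trans (cong ι u≡) (ι-hurwitz m₀ m₁ m₂ m₃))) ,
  refl

hurwitz-/π : ∀ n₀ n₁ n₂ n₃ →
  ∃[ p ] ∃[ q ] n₀ ≡ p ℤ.+ p ℤ.+ ℤ.- (n₁ ℤ.+ n₂) × n₃ ≡ q ℤ.+ q →
  ∃[ u ] u ∈ 𝒪 × hurwitz n₀ n₁ n₂ n₃ ≡ u *ᴰ el π
hurwitz-/π n₀ n₁ n₂ n₃ (p , q , n₀≡ , n₃≡) =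
  hurwitz m₀ m₁ m₂ m₃ , (m₀ , m₁ , m₂ , m₃ , refl) ,
  trans (cong₂ (λ a d → hurwitz a n₁ n₂ d) n₀≡ n₃≡) (sym (hurwitz-*π p q n₁ n₂))
  where
  m₀ = p ℤ.+ ℤ.- n₂
  m₁ = n₁ ℤ.+ ℤ.- (p ℤ.+ q)
  m₂ = ℤ.- q
  m₃ = n₂ ℤ.+ (q ℤ.+ q)

divide-by-π : ∀ y → y ∈ 𝒪 → Nm y ≡ fromℚ (fromℤ (+ 2)) →
              ∃[ u ] u ∈ 𝒪ˣ × y ≡ el u *ᴰ el π
divide-by-π y (n₀ , n₁ , n₂ , n₃ , y≡) Nm≡2 =
  let Ny≡2 = cong a₀ Nm≡2
      u , u∈𝒪 , eq = hurwitz-/π n₀ n₁ n₂ n₃ (norm-2 n₀ n₁ n₂ n₃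
        (fromℤ-injective (trans (sym (N-hurwitz n₀ n₁ n₂ n₃)) (trans (cong N (sym y≡)) Ny≡2))))
      v , v∈𝒪ˣ , v≡u = N≡1⇒𝒪ˣ u u∈𝒪 (N-/π u y (trans y≡ eq) Ny≡2)
  in  v , v∈𝒪ˣ , trans (trans y≡ eq) (cong (_*ᴰ el π) (sym v≡u))

same-class : ∀ γ y → mat γ ≡ mat (𝓕 y) →
             ∃[ u ] u ∈ 𝒪ˣ × el y ≡ el u *ᴰ el π → γ ~[ Γ ] 𝓕 π
same-class γ y γ≡𝓕y (u , u∈𝒪ˣ , y≡uπ) =
  𝓕 u , (u , u∈𝒪ˣ , refl) , trans γ≡𝓕y (𝓕-homo u π y y≡uπ)

π∈𝒪 : el π ∈ 𝒪
π∈𝒪 = + 1 , + 1 , + 0 , + 0 , refl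

-- There is a single class, that of 𝓕 (1 + i).
Γ\𝔗₂ : Representatives Γ 𝔗₂
Γ\𝔗₂ = record
  { list     = 𝓕 π ∷ []
  ; sound    = (π , π∈𝒪 , refl , refl) ∷ []
  ; complete = λ γ (y , y∈𝒪 , Nm≡2 , γ≡𝓕y) →
      here (same-class γ y γ≡𝓕y (divide-by-π (el y) y∈𝒪 Nm≡2))
  ; distinct = [] ∷ []
  }

open ℚ[x]

𝒜 : ℕ → Pred Poly 0ℓ
𝒜 l = Homogeneous l

Δ_Q : Poly → Poly
Δ_Q f = ½ · (∂ 0F (∂ 0F f) + ∂ 1F (∂ 1F f) + ∂ 2F (∂ 2F f)
           + ∂ 0F (∂ 1F f) + ∂ 1F (∂ 2F f) + ∂ 2F (∂ 0F f))

ℋ : ℕ → Pred Poly 0ℓ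
ℋ l f = f ∈ 𝒜 l × Δ_Q f ≈ []

ℋ^Γ : ℕ → Pred Poly 0ℓ
ℋ^Γ l f = f ∈ ℋ l × (∀ γ → γ ∈ Γ → f ⟨x mat γ ⟩ ≈ f)

-- On Γ-invariant f this does not depend on the choice of representatives.
T₂ : Poly → Poly
T₂ f = List.foldr (λ γ p → f ⟨x mat⁻¹ γ ⟩ + p) [] (Representatives.list Γ\𝔗₂)

ℋ₊^Γ : ℕ → Pred Poly 0ℓ
ℋ₊^Γ l f = f ∈ ℋ^Γ l × T₂ f ≈ ((ℚ.- 1ℚ) ^ℚ l) · f
  where
  open Algebra.Definitions.RawSemiring (RawRing.rawSemiring ℚ.+-*-rawRing)
    using () renaming (_^_ to _^ℚ_)

{-# OPTIONS --safe #-}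

-- In the coordinates c, d, e of i, j, ij, the group Γ acts on V_D by even sign changes and
-- cyclic permutations, and since Γ\𝔗₂ has a single element, T₂ f = f(xγ⁻¹) for a rotation γ
-- by a right angle.  So the orbit of the isotropic form c + d + e√-2 is preserved up to signs and conjugation,
-- and the sum G_l of the real parts of the l-th powers of the forms in it is harmonic,
-- Γ-invariant and fixed by T₂.  It remains to divide G_l by the right power of 2.
--
-- Divided by √-2, each form z satisfies z⁴ = W + 4u with W = s⁴, s = x₁ + x₂ + x₃.  There are
-- six forms, so G_{4n} = 2f with f ≡ 3s^{4n} ≡ s^{4n} (mod 2).  For l = 4n + 2 with
-- n = 2^v m, m odd, iterated squaring gives, for some B depending only on W,
--   (W + 4u)^n = W^n + 2^{v+2} u (m W^{n-1} + 2Bu + 4r).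
-- Multiplied by z² and summed, the first term vanishes because Σ Re z² = 0, and since
-- Σ Re z²u ≡ 2s⁶ (mod 4) and Σ Re z²u² is even, G_l = 2^{v+3} f with f ≡ s^l (mod 2).
-- Finally Nm ≡ s² (mod 2).

module Submission where

open import Defs
open import Algebra.Bundles using (CommutativeRing; RawRing)
import Algebra.Consequences.Setoid
import Algebra.Definitions.RawSemiring
open import Algebra.Morphism.Structures using (module SemiringMorphisms)
import Algebra.Properties.AbelianGroup
import Algebra.Properties.CommutativeMonoid.Sum
import Algebra.Properties.CommutativeSemigroup
import Algebra.Properties.Group
import Algebra.Properties.Ring
import Algebra.Properties.Semiring.Exp
import Algebra.Properties.Semiring.Mult
import Algebra.Solver.Ring
open import Algebra.Solver.Ring.AlmostCommutativeRing
  using (fromCommutativeRing; _-Raw-AlmostCommutative⟶_)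
import Algebra.Solver.Ring.NaturalCoefficients.Default
open import Data.Bool.Base using (Bool; true; false; if_then_else_)
import Data.Bool.Properties as Bool
open import Data.Fin.Base using (Fin)
open import Data.Fin.Patterns using (0F; 1F; 2F)
open import Data.Integer.Base as ℤ using (ℤ; +_; -[1+_])
import Data.Integer.Divisibility as ℤ
import Data.Integer.Properties as ℤ
import Data.Integer.Solver
open import Data.List.Base as List using (List; []; _∷_)
open import Data.List.Membership.Propositional using () renaming (_∈_ to _∈ˡ_)
import Data.List.Properties as List
open import Data.List.Relation.Unary.All as All using (All; []; _∷_)
import Data.List.Relation.Unary.All.Properties as All
open import Data.List.Relation.Unary.Any using (here; there)
open import Data.Maybe.Base as Maybe using (Maybe; just; nothing; is-just)
open import Data.Nat.Base as ℕ using (ℕ; zero; suc; _≤_; s≤s)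
open import Data.Nat.Divisibility using (_∣_; divides)
open import Data.Nat.DivMod using (_/_; m*n/n≡m)
import Data.Nat.Induction as ℕ
import Data.Nat.Properties as ℕ
import Data.Nat.Solver
open import Data.Product.Base using (∃-syntax; _×_; _,_; proj₁; proj₂)
open import Data.Rational.Base as ℚ using (ℚ; 0ℚ; 1ℚ; ½)
import Data.Rational.Properties as ℚ
open import Data.Sum.Base using (_⊎_; inj₁; inj₂)
open import Data.Vec.Base as Vec using (Vec; []; _∷_)
import Data.Vec.Properties as Vec
open import Function.Base using (_∘_)
open import Level using (_⊔_)
open import Relation.Binary.Consequences using (dec⇒weaklyDec)
open import Relation.Binary.PropositionalEquality as ≡ using (_≡_; _≢_)
import Relation.Binary.Reasoning.Setoid
open import Relation.Binary.Bundles using (Setoid)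
open import Relation.Binary.Structures using (IsEquivalence)
open import Relation.Nullary using (Dec; does; yes; no; ¬?; contradiction)
open import Relation.Nullary.Decidable using (toWitness; map′; _×-dec_; _⊎-dec_; _→-dec_)
open import Relation.Unary using (_∈_)

-- Why fourth powers: division by √-2 makes the forms integral with z ≡ s (mod √-2), and squaring
-- sharpens such a congruence: z² ≡ s² (mod 2), z⁴ ≡ s⁴ (mod 4). As s is real and common to all six
-- forms, the leading terms add up.
--
-- The obstacle is l ≡ 2 (mod 4). There Σ Re z² is an invariant harmonic quadratic form; the
-- invariant quadratic forms are the multiples of Nm, which is not harmonic, so the sum is zero. The
-- leading term is lost and the first-order term n W^{n-1} u decides, whose divisibility depends on
-- the power of 2 in n. Expanding (W + 4u)^n to first order leaves a remainder known only to be
-- divisible by 16, too little when v is large. Squaring repeatedly keeps the factor 2^v on every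
-- higher-order term. The terms 2Bu are one factor of 2 short of the remainder 4r; they do no harm
-- because B is real and common to all forms, so that they sum to B times an even sum.
--
-- The conditions defining `ℋ₊^Γ` are linear over ℚ, so they are verified for G_l in ℚ[x], and f
-- need only be a rational multiple of G_l. Divisibility and congruence are argued in ℤ[x].

-- Polynomials as a commutative ring, with substitution and partial derivatives.

module PolynomialRing {c ℓ} (𝓡 : CommutativeRing c ℓ) (n : ℕ) where

  private module R = CommutativeRing 𝓡
  open R using (Carrier; 0#; 1#)
    renaming (_≈_ to _≈ᴿ_; _+_ to _+ᴿ_; _*_ to _*ᴿ_; -_ to -ᴿ_)
  open Algebra.Properties.CommutativeSemigroup R.+-commutativeSemigroup
    using () renaming (interchange to +ᴿ-medial; x∙yz≈y∙xz to x+yz≈y+xz)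
  open Algebra.Properties.CommutativeSemigroup R.*-commutativeSemigroup
    using () renaming (x∙yz≈y∙xz to x*yz≈y*xz)
  open Algebra.Properties.AbelianGroup R.+-abelianGroup using (⁻¹-∙-comm)
  open Algebra.Properties.Ring R.ring using (-‿distribˡ-*; -0#≈0#)
  open Algebra.Properties.Semiring.Mult R.semiring
    using (×-assoc-*; ×-comm-*; ×-congʳ; ×-homo-+) renaming (_×_ to _×ᴿ_)
  open Relation.Binary.Reasoning.Setoid R.setoid
  open Polynomial R.rawRing n public renaming (_≈_ to _≈ᶜ_)

  -- A record, so that both sides can be inferred from a proof.
  infix 4 _≈_
  record _≈_ (p q : Poly) : Set ℓ where
    constructor coefficientwise
    field coefficients : p ≈ᶜ q
  open _≈_ public

  private variable
    p q p′ q′ f g : Poly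

  infixl 6 _⊕_
  _⊕_ : Exponent → Exponent → Exponent
  _⊕_ = Vec.zipWith ℕ._+_

  𝟎 : Exponent
  𝟎 = Vec.replicate n 0

  _≟ᵉ_ = Vec.≡-dec {n = n} ℕ._≟_

  -- The linear functional x^d ↦ φ d.  A polynomial is determined by the
  -- values of all these functionals on it, and they behave better under
  -- the operations than single coefficients do.
  pairing : Poly → (Exponent → Carrier) → Carrier
  pairing []            φ = 0#
  pairing ((a , d) ∷ p) φ = a *ᴿ φ d +ᴿ pairing p φ

  pairing-congʳ : ∀ p {φ ψ} → (∀ d → φ d ≈ᴿ ψ d) → pairing p φ ≈ᴿ pairing p ψ
  pairing-congʳ []            φ≈ψ = R.refl
  pairing-congʳ ((a , d) ∷ p) φ≈ψ = R.+-cong (R.*-congˡ (φ≈ψ d)) (pairing-congʳ p φ≈ψ)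

  pairing-+ : ∀ p q φ → pairing (p + q) φ ≈ᴿ pairing p φ +ᴿ pairing q φ
  pairing-+ []            q φ = R.sym (R.+-identityˡ _)
  pairing-+ ((a , d) ∷ p) q φ =
    R.trans (R.+-congˡ (pairing-+ p q φ)) (R.sym (R.+-assoc _ _ _))

  pairing-neg : ∀ p φ → pairing (- p) φ ≈ᴿ -ᴿ pairing p φ
  pairing-neg []            φ = R.sym -0#≈0#
  pairing-neg ((a , d) ∷ p) φ =
    R.trans (R.+-cong (R.sym (-‿distribˡ-* a (φ d))) (pairing-neg p φ)) (⁻¹-∙-comm _ _)

  pairing-0ʳ : ∀ p → pairing p (λ _ → 0#) ≈ᴿ 0#
  pairing-0ʳ []            = R.refl
  pairing-0ʳ ((a , d) ∷ p) =
    R.trans (R.+-cong (R.zeroʳ a) (pairing-0ʳ p)) (R.+-identityˡ 0#)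

  pairing-+ʳ : ∀ p φ ψ → pairing p (λ d → φ d +ᴿ ψ d) ≈ᴿ pairing p φ +ᴿ pairing p ψ
  pairing-+ʳ []            φ ψ = R.sym (R.+-identityˡ 0#)
  pairing-+ʳ ((a , d) ∷ p) φ ψ =
    R.trans (R.+-cong (R.distribˡ a (φ d) (ψ d)) (pairing-+ʳ p φ ψ)) (+ᴿ-medial _ _ _ _)

  pairing-*ʳ : ∀ p a φ → pairing p (λ d → a *ᴿ φ d) ≈ᴿ a *ᴿ pairing p φ
  pairing-*ʳ []            a φ = R.sym (R.zeroʳ a)
  pairing-*ʳ ((b , d) ∷ p) a φ =
    R.trans (R.+-cong (x*yz≈y*xz b a (φ d)) (pairing-*ʳ p a φ)) (R.sym (R.distribˡ a _ _))

  pairing-×ʳ : ∀ p k φ → pairing p (λ d → k ×ᴿ φ d) ≈ᴿ k ×ᴿ pairing p φ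
  pairing-×ʳ p zero    φ = pairing-0ʳ p
  pairing-×ʳ p (suc k) φ =
    R.trans (pairing-+ʳ p φ (λ d → k ×ᴿ φ d)) (R.+-congˡ (pairing-×ʳ p k φ))

  pairing-swap : ∀ p q (φ : Exponent → Exponent → Carrier) →
    pairing p (λ d → pairing q (φ d)) ≈ᴿ pairing q (λ e → pairing p (λ d → φ d e))
  pairing-swap []            q φ = R.sym (pairing-0ʳ q)
  pairing-swap ((a , d) ∷ p) q φ = R.sym (R.trans
    (pairing-+ʳ q (λ e → a *ᴿ φ d e) (λ e → pairing p (λ d′ → φ d′ e)))
    (R.+-cong (pairing-*ʳ q a (φ d)) (R.sym (pairing-swap p q φ))))

  pairing-* : ∀ p q φ → pairing (p * q) φ ≈ᴿ pairing p (λ d → pairing q (λ e → φ (d ⊕ e)))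
  pairing-* []            q φ = R.refl
  pairing-* ((a , d) ∷ p) q φ = begin
    pairing (monomial q + p * q) φ
      ≈⟨ pairing-+ (monomial q) (p * q) φ ⟩
    pairing (monomial q) φ +ᴿ pairing (p * q) φ
      ≈⟨ R.+-cong (scale q) (pairing-* p q φ) ⟩
    a *ᴿ pairing q (λ e → φ (d ⊕ e)) +ᴿ pairing p (λ d → pairing q (λ e → φ (d ⊕ e))) ∎
    where
    monomial : Poly → Poly
    monomial = List.map λ (b , e) → a *ᴿ b , d ⊕ e
    scale : ∀ q → pairing (monomial q) φ ≈ᴿ a *ᴿ pairing q (λ e → φ (d ⊕ e))
    scale []            = R.sym (R.zeroʳ a)
    scale ((b , e) ∷ q) =
      R.trans (R.+-cong (R.*-assoc a b _) (scale q)) (R.sym (R.distribˡ a _ _))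

  pairing-constant : ∀ a φ → pairing (constant a) φ ≈ᴿ a *ᴿ φ 𝟎
  pairing-constant a φ = R.+-identityʳ _

  δ : Exponent → Exponent → Carrier
  δ e d = if does (d ≟ᵉ e) then 1# else 0#

  coeff-pairing : ∀ p e → coeff p e ≈ᴿ pairing p (δ e)
  coeff-pairing []            e = R.refl
  coeff-pairing ((a , d) ∷ p) e with does (d ≟ᵉ e)
  ... | true  = R.+-cong (R.sym (R.*-identityʳ a)) (coeff-pairing p e)
  ... | false = begin
    coeff p e                        ≈⟨ coeff-pairing p e ⟩
    pairing p (δ e)                  ≈⟨ R.+-identityˡ _ ⟨
    0# +ᴿ pairing p (δ e)            ≈⟨ R.+-congʳ (R.zeroʳ a) ⟨
    a *ᴿ 0# +ᴿ pairing p (δ e)       ∎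

  remove : Exponent → Poly → Poly
  remove d = List.filter (λ t → ¬? (proj₂ t ≟ᵉ d))

  pairing-remove : ∀ p d φ → pairing p φ ≈ᴿ coeff p d *ᴿ φ d +ᴿ pairing (remove d p) φ
  pairing-remove []            d φ =
    R.sym (R.trans (R.+-congʳ (R.zeroˡ (φ d))) (R.+-identityˡ 0#))
  pairing-remove ((a , e) ∷ p) d φ with e ≟ᵉ d
  ... | yes ≡.refl = begin
    a *ᴿ φ d +ᴿ pairing p φ
      ≈⟨ R.+-congˡ (pairing-remove p d φ) ⟩
    a *ᴿ φ d +ᴿ (coeff p d *ᴿ φ d +ᴿ pairing (remove d p) φ)
      ≈⟨ R.+-assoc _ _ _ ⟨
    a *ᴿ φ d +ᴿ coeff p d *ᴿ φ d +ᴿ pairing (remove d p) φ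
      ≈⟨ R.+-congʳ (R.distribʳ (φ d) a (coeff p d)) ⟨
    (a +ᴿ coeff p d) *ᴿ φ d +ᴿ pairing (remove d p) φ ∎
  ... | no _ = R.trans (R.+-congˡ (pairing-remove p d φ)) (x+yz≈y+xz _ _ _)

  length-remove : ∀ a d p → List.length (remove d ((a , d) ∷ p)) ℕ.≤ List.length p
  length-remove a d p with d ≟ᵉ d
  ... | yes _   = List.length-filter (λ t → ¬? (proj₂ t ≟ᵉ d)) p
  ... | no  d≢d = contradiction ≡.refl d≢d

  -- Vanishing coefficients do not make the list empty: terms of equal exponent cancel across it.
  -- All terms with the exponent of the head are taken out together, which leaves the pairing
  -- unchanged because their coefficients add up to zero. What remains is not the tail, hence the
  -- induction on a bound for the length.
  pairing-zero : ∀ p φ → p ≈ᶜ [] → pairing p φ ≈ᴿ 0#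
  pairing-zero p φ = go (List.length p) p ℕ.≤-refl
    where
    vanish : ∀ p d ψ → p ≈ᶜ [] → pairing p ψ ≈ᴿ pairing (remove d p) ψ
    vanish p d ψ p≈0 = begin
      pairing p ψ                                    ≈⟨ pairing-remove p d ψ ⟩
      coeff p d *ᴿ ψ d +ᴿ pairing (remove d p) ψ     ≈⟨ R.+-congʳ (R.*-congʳ (p≈0 d)) ⟩
      0# *ᴿ ψ d +ᴿ pairing (remove d p) ψ            ≈⟨ R.+-congʳ (R.zeroˡ (ψ d)) ⟩
      0# +ᴿ pairing (remove d p) ψ                   ≈⟨ R.+-identityˡ _ ⟩
      pairing (remove d p) ψ                         ∎

    go : ∀ k p → List.length p ℕ.≤ k → p ≈ᶜ [] → pairing p φ ≈ᴿ 0#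
    go k       []              _         _   = R.refl
    go (suc k) p@((a , d) ∷ p′) (s≤s p≤k) p≈0 = R.trans (vanish p d φ p≈0)
      (go k (remove d p) (ℕ.≤-trans (length-remove a d p′) p≤k) λ e → begin
        coeff (remove d p) e       ≈⟨ coeff-pairing (remove d p) e ⟩
        pairing (remove d p) (δ e) ≈⟨ vanish p d (δ e) p≈0 ⟨
        pairing p (δ e)            ≈⟨ coeff-pairing p e ⟨
        coeff p e                  ≈⟨ p≈0 e ⟩
        0#                         ∎)

  coeff-+ : ∀ p q e → coeff (p + q) e ≈ᴿ coeff p e +ᴿ coeff q e
  coeff-+ p q e = begin
    coeff (p + q) e                       ≈⟨ coeff-pairing (p + q) e ⟩
    pairing (p + q) (δ e)                 ≈⟨ pairing-+ p q (δ e) ⟩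
    pairing p (δ e) +ᴿ pairing q (δ e)    ≈⟨ R.+-cong (coeff-pairing p e) (coeff-pairing q e) ⟨
    coeff p e +ᴿ coeff q e                ∎

  coeff-neg : ∀ p e → coeff (- p) e ≈ᴿ -ᴿ coeff p e
  coeff-neg p e = begin
    coeff (- p) e         ≈⟨ coeff-pairing (- p) e ⟩
    pairing (- p) (δ e)   ≈⟨ pairing-neg p (δ e) ⟩
    -ᴿ pairing p (δ e)    ≈⟨ R.-‿cong (coeff-pairing p e) ⟨
    -ᴿ coeff p e          ∎

  pairing-cong : ∀ {p q} → p ≈ q → ∀ φ → pairing p φ ≈ᴿ pairing q φ
  pairing-cong {p} {q} p≈q φ = begin
    pairing p φ                                    ≈⟨ R.+-identityʳ _ ⟨
    pairing p φ +ᴿ 0#                              ≈⟨ R.+-congˡ (R.-‿inverseˡ _) ⟨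
    pairing p φ +ᴿ (-ᴿ pairing q φ +ᴿ pairing q φ) ≈⟨ R.+-assoc _ _ _ ⟨
    pairing p φ +ᴿ -ᴿ pairing q φ +ᴿ pairing q φ   ≈⟨ R.+-congʳ (R.+-congˡ (pairing-neg q φ)) ⟨
    pairing p φ +ᴿ pairing (- q) φ +ᴿ pairing q φ  ≈⟨ R.+-congʳ (pairing-+ p (- q) φ) ⟨
    pairing (p + - q) φ +ᴿ pairing q φ             ≈⟨ R.+-congʳ (pairing-zero (p + - q) φ p-q≈0) ⟩
    0# +ᴿ pairing q φ                              ≈⟨ R.+-identityˡ _ ⟩
    pairing q φ                                    ∎
    where
    p-q≈0 : p + - q ≈ᶜ []
    p-q≈0 e = begin
      coeff (p + - q) e           ≈⟨ coeff-+ p (- q) e ⟩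
      coeff p e +ᴿ coeff (- q) e  ≈⟨ R.+-cong (coefficients p≈q e) (coeff-neg q e) ⟩
      coeff q e +ᴿ -ᴿ coeff q e   ≈⟨ R.-‿inverseʳ _ ⟩
      0#                          ∎

  -- Coefficients are themselves pairings, with `δ e`. Together with `pairing-cong` this turns ring
  -- laws into identities between iterated pairings, where no normal form of the lists is required.
  pairing-injective : ∀ {p q} → (∀ φ → pairing p φ ≈ᴿ pairing q φ) → p ≈ q
  pairing-injective {p} {q} eq = coefficientwise λ e →
    R.trans (coeff-pairing p e) (R.trans (eq (δ e)) (R.sym (coeff-pairing q e)))

  ⊕-assoc : ∀ d e f → (d ⊕ e) ⊕ f ≡ d ⊕ (e ⊕ f)
  ⊕-assoc = Vec.zipWith-assoc ℕ.+-assoc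

  ⊕-comm : ∀ d e → d ⊕ e ≡ e ⊕ d
  ⊕-comm = Vec.zipWith-comm ℕ.+-comm

  ⊕-identityˡ : ∀ d → 𝟎 ⊕ d ≡ d
  ⊕-identityˡ = Vec.zipWith-identityˡ ℕ.+-identityˡ

  private
    ≡⇒≈ : (φ : Exponent → Carrier) → ∀ {d e} → d ≡ e → φ d ≈ᴿ φ e
    ≡⇒≈ φ d≡e = R.reflexive (≡.cong φ d≡e)

  +-cong : p ≈ p′ → q ≈ q′ → p + q ≈ p′ + q′
  +-cong {p} {p′} {q} {q′} p≈ q≈ = coefficientwise λ e → R.trans (coeff-+ p q e)
    (R.trans (R.+-cong (coefficients p≈ e) (coefficients q≈ e)) (R.sym (coeff-+ p′ q′ e)))

  -‿cong : p ≈ q → - p ≈ - q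
  -‿cong {p} {q} p≈q = coefficientwise λ e →
    R.trans (coeff-neg p e) (R.trans (R.-‿cong (coefficients p≈q e)) (R.sym (coeff-neg q e)))

  *-cong : p ≈ p′ → q ≈ q′ → p * q ≈ p′ * q′
  *-cong {p} {p′} {q} {q′} p≈ q≈ = pairing-injective λ φ → begin
    pairing (p * q) φ
      ≈⟨ pairing-* p q φ ⟩
    pairing p (λ d → pairing q (λ e → φ (d ⊕ e)))
      ≈⟨ pairing-cong p≈ _ ⟩
    pairing p′ (λ d → pairing q (λ e → φ (d ⊕ e)))
      ≈⟨ pairing-congʳ p′ (λ d → pairing-cong q≈ (λ e → φ (d ⊕ e))) ⟩
    pairing p′ (λ d → pairing q′ (λ e → φ (d ⊕ e)))
      ≈⟨ pairing-* p′ q′ φ ⟨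
    pairing (p′ * q′) φ ∎

  *-assoc : ∀ p q r → p * q * r ≈ p * (q * r)
  *-assoc p q r = pairing-injective λ φ → begin
    pairing (p * q * r) φ
      ≈⟨ pairing-* (p * q) r φ ⟩
    pairing (p * q) (λ d → pairing r (λ f → φ (d ⊕ f)))
      ≈⟨ pairing-* p q _ ⟩
    pairing p (λ d → pairing q (λ e → pairing r (λ f → φ (d ⊕ e ⊕ f))))
      ≈⟨ pairing-congʳ p (λ d → pairing-congʳ q (λ e → pairing-congʳ r (λ f →
           ≡⇒≈ φ (⊕-assoc d e f)))) ⟩
    pairing p (λ d → pairing q (λ e → pairing r (λ f → φ (d ⊕ (e ⊕ f)))))
      ≈⟨ pairing-congʳ p (λ d → pairing-* q r (λ e → φ (d ⊕ e))) ⟨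
    pairing p (λ d → pairing (q * r) (λ e → φ (d ⊕ e)))
      ≈⟨ pairing-* p (q * r) φ ⟨
    pairing (p * (q * r)) φ ∎

  *-comm : ∀ p q → p * q ≈ q * p
  *-comm p q = pairing-injective λ φ → begin
    pairing (p * q) φ                              ≈⟨ pairing-* p q φ ⟩
    pairing p (λ d → pairing q (λ e → φ (d ⊕ e)))  ≈⟨ pairing-swap p q (λ d e → φ (d ⊕ e)) ⟩
    pairing q (λ e → pairing p (λ d → φ (d ⊕ e)))
      ≈⟨ pairing-congʳ q (λ e → pairing-congʳ p (λ d → ≡⇒≈ φ (⊕-comm d e))) ⟩
    pairing q (λ e → pairing p (λ d → φ (e ⊕ d)))  ≈⟨ pairing-* q p φ ⟨
    pairing (q * p) φ                              ∎

  *-identityˡ : ∀ p → constant 1# * p ≈ p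
  *-identityˡ p = pairing-injective λ φ → begin
    pairing (constant 1# * p) φ           ≈⟨ pairing-* (constant 1#) p φ ⟩
    pairing (constant 1#) (λ d → pairing p (λ e → φ (d ⊕ e)))
      ≈⟨ pairing-constant 1# (λ d → pairing p (λ e → φ (d ⊕ e))) ⟩
    1# *ᴿ pairing p (λ e → φ (𝟎 ⊕ e))     ≈⟨ R.*-identityˡ _ ⟩
    pairing p (λ e → φ (𝟎 ⊕ e))           ≈⟨ pairing-congʳ p (λ e → ≡⇒≈ φ (⊕-identityˡ e)) ⟩
    pairing p φ                           ∎

  *-distribʳ : ∀ r p q → (p + q) * r ≈ p * r + q * r
  *-distribʳ r p q = pairing-injective λ φ → begin
    pairing ((p + q) * r) φ                    ≈⟨ pairing-* (p + q) r φ ⟩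
    pairing (p + q) _                          ≈⟨ pairing-+ p q _ ⟩
    pairing p _ +ᴿ pairing q _                 ≈⟨ R.+-cong (pairing-* p r φ) (pairing-* q r φ) ⟨
    pairing (p * r) φ +ᴿ pairing (q * r) φ     ≈⟨ pairing-+ (p * r) (q * r) φ ⟨
    pairing (p * r + q * r) φ                  ∎

  +-assoc : ∀ p q r → p + q + r ≈ p + (q + r)
  +-assoc p q r = pairing-injective λ φ → begin
    pairing (p + q + r) φ                         ≈⟨ pairing-+ (p + q) r φ ⟩
    pairing (p + q) φ +ᴿ pairing r φ              ≈⟨ R.+-congʳ (pairing-+ p q φ) ⟩
    pairing p φ +ᴿ pairing q φ +ᴿ pairing r φ     ≈⟨ R.+-assoc _ _ _ ⟩
    pairing p φ +ᴿ (pairing q φ +ᴿ pairing r φ)   ≈⟨ R.+-congˡ (pairing-+ q r φ) ⟨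
    pairing p φ +ᴿ pairing (q + r) φ              ≈⟨ pairing-+ p (q + r) φ ⟨
    pairing (p + (q + r)) φ                       ∎

  +-comm : ∀ p q → p + q ≈ q + p
  +-comm p q = coefficientwise λ e →
    R.trans (coeff-+ p q e) (R.trans (R.+-comm _ _) (R.sym (coeff-+ q p e)))

  -‿inverseˡ : ∀ p → - p + p ≈ []
  -‿inverseˡ p = coefficientwise λ e → R.trans (coeff-+ (- p) p e)
    (R.trans (R.+-congʳ (coeff-neg p e)) (R.-‿inverseˡ _))

  polynomialRing : CommutativeRing c ℓ
  polynomialRing = record
    { Carrier = Poly ; _≈_ = _≈_ ; _+_ = _+_ ; _*_ = _*_ ; -_ = -_
    ; 0# = [] ; 1# = constant 1#
    ; isCommutativeRing = record
      { isRing = record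
        { +-isAbelianGroup = record
          { isGroup = record
            { isMonoid = record
              { isSemigroup = record
                { isMagma = record
                  { isEquivalence = isEquivalence
                  ; ∙-cong = +-cong
                  }
                ; assoc = +-assoc
                }
              ; identity = comm∧idˡ⇒id +-comm (λ _ → coefficientwise λ _ → R.refl)
              }
            ; inverse = comm∧invˡ⇒inv +-comm -‿inverseˡ
            ; ⁻¹-cong = -‿cong
            }
          ; comm = +-comm
          }
        ; *-cong = *-cong
        ; *-assoc = *-assoc
        ; *-identity = comm∧idˡ⇒id *-comm *-identityˡ
        ; distrib = comm∧distrʳ⇒distr +-cong *-comm *-distribʳ
        }
      ; *-comm = *-comm
      }
    }
    where
    isEquivalence : IsEquivalence _≈_
    isEquivalence = record
      { refl  = coefficientwise λ _ → R.refl
      ; sym   = λ p≈q → coefficientwise λ e → R.sym (coefficients p≈q e)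
      ; trans = λ p≈q q≈r → coefficientwise λ e → R.trans (coefficients p≈q e) (coefficients q≈r e)
      }
    setoid : Setoid _ _
    setoid = record { isEquivalence = isEquivalence }
    open Algebra.Consequences.Setoid setoid
      using (comm∧idˡ⇒id; comm∧invˡ⇒inv; comm∧distrʳ⇒distr)

  private module P = CommutativeRing polynomialRing

  ^-homo-* : ∀ p k l → p ^ (k ℕ.+ l) ≈ p ^ k * p ^ l
  ^-homo-* p zero    l = P.sym (P.*-identityˡ (p ^ l))
  ^-homo-* p (suc k) l = P.trans (P.*-congˡ {p} (^-homo-* p k l)) (P.sym (P.*-assoc p (p ^ k) (p ^ l)))

  constant-cong : ∀ {a b} → a ≈ᴿ b → constant a ≈ constant b
  constant-cong a≈b = pairing-injective λ φ → R.+-congʳ (R.*-congʳ a≈b)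

  constant-+ : ∀ a b → constant (a +ᴿ b) ≈ constant a + constant b
  constant-+ a b = pairing-injective λ φ → begin
    pairing (constant (a +ᴿ b)) φ          ≈⟨ pairing-constant (a +ᴿ b) φ ⟩
    (a +ᴿ b) *ᴿ φ 𝟎                        ≈⟨ R.distribʳ (φ 𝟎) a b ⟩
    a *ᴿ φ 𝟎 +ᴿ b *ᴿ φ 𝟎                   ≈⟨ R.+-congˡ (pairing-constant b φ) ⟨
    pairing (constant a + constant b) φ    ∎

  constant-* : ∀ a b → constant (a *ᴿ b) ≈ constant a * constant b
  constant-* a b = pairing-injective λ φ → begin
    pairing (constant (a *ᴿ b)) φ            ≈⟨ pairing-constant (a *ᴿ b) φ ⟩
    a *ᴿ b *ᴿ φ 𝟎                            ≈⟨ R.*-congˡ (≡⇒≈ φ (⊕-identityˡ 𝟎)) ⟨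
    a *ᴿ b *ᴿ φ (𝟎 ⊕ 𝟎)                      ≈⟨ R.+-identityʳ _ ⟨
    pairing (constant a * constant b) φ      ∎

  constant-0 : constant 0# ≈ []
  constant-0 = pairing-injective λ φ → R.trans (pairing-constant 0# φ) (R.zeroˡ _)

  coeff-· : ∀ a p e → coeff (a · p) e ≈ᴿ a *ᴿ coeff p e
  coeff-· a p e = begin
    coeff (a · p) e                        ≈⟨ coeff-pairing (a · p) e ⟩
    pairing (a · p) (δ e)                  ≈⟨ pairing-* (constant a) p (δ e) ⟩
    pairing (constant a) (λ d → pairing p (λ d′ → δ e (d ⊕ d′)))
      ≈⟨ pairing-constant a (λ d → pairing p (λ d′ → δ e (d ⊕ d′))) ⟩
    a *ᴿ pairing p (λ d → δ e (𝟎 ⊕ d))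
      ≈⟨ R.*-congˡ (pairing-congʳ p (λ d → ≡⇒≈ (δ e) (⊕-identityˡ d))) ⟩
    a *ᴿ pairing p (δ e)                   ≈⟨ R.*-congˡ (coeff-pairing p e) ⟨
    a *ᴿ coeff p e                         ∎

  constant-homomorphism : R.rawRing -Raw-AlmostCommutative⟶ fromCommutativeRing polynomialRing
  constant-homomorphism = record
    { ⟦_⟧    = constant
    ; +-homo = constant-+
    ; *-homo = constant-*
    ; -‿homo = λ _ → coefficientwise λ _ → R.refl
    ; 0-homo = constant-0
    ; 1-homo = coefficientwise λ _ → R.refl
    }

  module _ (σ : Fin n → Poly) where

    private
      module ∏ = Algebra.Properties.CommutativeMonoid.Sum P.*-commutativeMonoid

    monomial : Exponent → Poly
    monomial d = product (λ i → σ i ^ Vec.lookup d i)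

    monomial-⊕ : ∀ d e → monomial (d ⊕ e) ≈ monomial d * monomial e
    monomial-⊕ d e = P.trans
      (∏.sum-cong-≋ (λ i → P.trans (P.reflexive (≡.cong (σ i ^_) (Vec.lookup-zipWith ℕ._+_ i d e)))
        (^-homo-* (σ i) (Vec.lookup d i) (Vec.lookup e i))))
      (∏.∑-distrib-+ (λ i → σ i ^ Vec.lookup d i) (λ i → σ i ^ Vec.lookup e i))

    monomial-𝟎 : monomial 𝟎 ≈ constant 1#
    monomial-𝟎 = P.trans (∏.sum-cong-≋ (λ i → P.reflexive (≡.cong (σ i ^_) (Vec.lookup-replicate i 0))))
      (∏.sum-replicate-zero n)

    -- Substitution has an adjoint on functionals, which sends φ to its values on the substituted
    -- monomials. Compatibility with ≈, sums and products is then inherited from `pairing`. The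
    -- adjoint of `∂` plays the same part further on.
    pairing-⟨⟩ : ∀ f φ → pairing (f ⟨ σ ⟩) φ ≈ᴿ pairing f (λ d → pairing (monomial d) φ)
    pairing-⟨⟩ []            φ = R.refl
    pairing-⟨⟩ ((a , d) ∷ f) φ = begin
      pairing (a · monomial d + f ⟨ σ ⟩) φ
        ≈⟨ pairing-+ (a · monomial d) (f ⟨ σ ⟩) φ ⟩
      pairing (a · monomial d) φ +ᴿ pairing (f ⟨ σ ⟩) φ
        ≈⟨ R.+-cong (R.trans (pairing-* (constant a) (monomial d) φ)
             (pairing-constant a (λ d′ → pairing (monomial d) (λ e → φ (d′ ⊕ e)))))
             (pairing-⟨⟩ f φ) ⟩
      a *ᴿ pairing (monomial d) (λ e → φ (𝟎 ⊕ e)) +ᴿ pairing f (λ d → pairing (monomial d) φ)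
        ≈⟨ R.+-congʳ (R.*-congˡ (pairing-congʳ (monomial d) (λ e → ≡⇒≈ φ (⊕-identityˡ e)))) ⟩
      a *ᴿ pairing (monomial d) φ +ᴿ pairing f (λ d → pairing (monomial d) φ) ∎

    ⟨⟩-cong : f ≈ g → f ⟨ σ ⟩ ≈ g ⟨ σ ⟩
    ⟨⟩-cong {f} {g} f≈g = pairing-injective λ φ →
      R.trans (pairing-⟨⟩ f φ) (R.trans (pairing-cong f≈g _) (R.sym (pairing-⟨⟩ g φ)))

    ⟨⟩-+ : ∀ f g → (f + g) ⟨ σ ⟩ ≈ f ⟨ σ ⟩ + g ⟨ σ ⟩
    ⟨⟩-+ f g = pairing-injective λ φ → begin
      pairing ((f + g) ⟨ σ ⟩) φ                          ≈⟨ pairing-⟨⟩ (f + g) φ ⟩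
      pairing (f + g) _                                  ≈⟨ pairing-+ f g _ ⟩
      pairing f _ +ᴿ pairing g _                         ≈⟨ R.+-cong (pairing-⟨⟩ f φ) (pairing-⟨⟩ g φ) ⟨
      pairing (f ⟨ σ ⟩) φ +ᴿ pairing (g ⟨ σ ⟩) φ         ≈⟨ pairing-+ (f ⟨ σ ⟩) (g ⟨ σ ⟩) φ ⟨
      pairing (f ⟨ σ ⟩ + g ⟨ σ ⟩) φ                      ∎

    ⟨⟩-* : ∀ f g → (f * g) ⟨ σ ⟩ ≈ f ⟨ σ ⟩ * g ⟨ σ ⟩
    ⟨⟩-* f g = pairing-injective λ φ → begin
      pairing ((f * g) ⟨ σ ⟩) φ
        ≈⟨ pairing-⟨⟩ (f * g) φ ⟩
      pairing (f * g) (λ d → pairing (monomial d) φ)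
        ≈⟨ pairing-* f g _ ⟩
      pairing f (λ d → pairing g (λ e → pairing (monomial (d ⊕ e)) φ))
        ≈⟨ pairing-congʳ f (λ d → pairing-congʳ g (λ e → R.trans
             (pairing-cong (monomial-⊕ d e) φ) (pairing-* (monomial d) (monomial e) φ))) ⟩
      pairing f (λ d → pairing g (λ e →
        pairing (monomial d) (λ d′ → pairing (monomial e) (λ e′ → φ (d′ ⊕ e′)))))
        ≈⟨ pairing-congʳ f (λ d → pairing-swap g (monomial d) _) ⟩
      pairing f (λ d → pairing (monomial d) (λ d′ →
        pairing g (λ e → pairing (monomial e) (λ e′ → φ (d′ ⊕ e′)))))
        ≈⟨ pairing-congʳ f (λ d → pairing-congʳ (monomial d) (λ d′ → pairing-⟨⟩ g _)) ⟨
      pairing f (λ d → pairing (monomial d) (λ d′ → pairing (g ⟨ σ ⟩) (λ e′ → φ (d′ ⊕ e′))))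
        ≈⟨ pairing-⟨⟩ f _ ⟨
      pairing (f ⟨ σ ⟩) (λ d′ → pairing (g ⟨ σ ⟩) (λ e′ → φ (d′ ⊕ e′)))
        ≈⟨ pairing-* (f ⟨ σ ⟩) (g ⟨ σ ⟩) φ ⟨
      pairing (f ⟨ σ ⟩ * g ⟨ σ ⟩) φ ∎

    ⟨⟩-constant : ∀ a → constant a ⟨ σ ⟩ ≈ constant a
    ⟨⟩-constant a = P.trans (P.+-identityʳ (a · monomial 𝟎))
      (P.trans (P.*-congˡ {constant a} monomial-𝟎) (P.*-identityʳ (constant a)))

  module _ (i : Fin n) where

    lower : Exponent → Exponent
    lower d = Vec.updateAt d i ℕ.pred

    pairing-∂ : ∀ f φ → pairing (∂ i f) φ ≈ᴿ pairing f (λ d → Vec.lookup d i ×ᴿ φ (lower d))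
    pairing-∂ []            φ = R.refl
    pairing-∂ ((a , d) ∷ f) φ = R.+-cong
      (R.trans (×-assoc-* k a _) (R.sym (×-comm-* k a _)))
      (pairing-∂ f φ)
      where k = Vec.lookup d i

    ∂-cong : f ≈ g → ∂ i f ≈ ∂ i g
    ∂-cong {f} {g} f≈g = pairing-injective λ φ →
      R.trans (pairing-∂ f φ) (R.trans (pairing-cong f≈g _) (R.sym (pairing-∂ g φ)))

    ∂-+ : ∀ f g → ∂ i (f + g) ≈ ∂ i f + ∂ i g
    ∂-+ f g = pairing-injective λ φ → begin
      pairing (∂ i (f + g)) φ                     ≈⟨ pairing-∂ (f + g) φ ⟩
      pairing (f + g) _                           ≈⟨ pairing-+ f g _ ⟩
      pairing f _ +ᴿ pairing g _                  ≈⟨ R.+-cong (pairing-∂ f φ) (pairing-∂ g φ) ⟨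
      pairing (∂ i f) φ +ᴿ pairing (∂ i g) φ      ≈⟨ pairing-+ (∂ i f) (∂ i g) φ ⟨
      pairing (∂ i f + ∂ i g) φ                   ∎

    ∂-constant : ∀ a → ∂ i (constant a) ≈ []
    ∂-constant a = pairing-injective λ φ → begin
      pairing (∂ i (constant a)) φ           ≈⟨ pairing-∂ (constant a) φ ⟩
      pairing (constant a) (λ d → Vec.lookup d i ×ᴿ φ (lower d))
        ≈⟨ pairing-constant a (λ d → Vec.lookup d i ×ᴿ φ (lower d)) ⟩
      a *ᴿ (Vec.lookup 𝟎 i ×ᴿ φ (lower 𝟎))
        ≡⟨ ≡.cong (λ k → a *ᴿ (k ×ᴿ φ (lower 𝟎))) (Vec.lookup-replicate i 0) ⟩
      a *ᴿ 0#                                ≈⟨ R.zeroʳ a ⟩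
      0#                                     ∎

    ∂-* : ∀ f g → ∂ i (f * g) ≈ ∂ i f * g + f * ∂ i g
    ∂-* f g = pairing-injective λ φ → begin
      pairing (∂ i (f * g)) φ
        ≈⟨ pairing-∂ (f * g) φ ⟩
      pairing (f * g) (λ d → d !! i ×ᴿ φ (lower d))
        ≈⟨ pairing-* f g _ ⟩
      pairing f (λ d → pairing g (λ e → (d ⊕ e) !! i ×ᴿ φ (lower (d ⊕ e))))
        ≈⟨ pairing-congʳ f (λ d → pairing-congʳ g (λ e → lower-⊕ φ d e)) ⟩
      pairing f (λ d → pairing g (λ e →
        d !! i ×ᴿ φ (lower d ⊕ e) +ᴿ e !! i ×ᴿ φ (d ⊕ lower e)))
        ≈⟨ pairing-congʳ f (λ d → pairing-+ʳ g _ _) ⟩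
      pairing f (λ d → pairing g (λ e → d !! i ×ᴿ φ (lower d ⊕ e))
        +ᴿ pairing g (λ e → e !! i ×ᴿ φ (d ⊕ lower e)))
        ≈⟨ pairing-+ʳ f _ _ ⟩
      pairing f (λ d → pairing g (λ e → d !! i ×ᴿ φ (lower d ⊕ e)))
        +ᴿ pairing f (λ d → pairing g (λ e → e !! i ×ᴿ φ (d ⊕ lower e)))
        ≈⟨ R.+-cong
             (R.trans (pairing-congʳ f (λ d → pairing-×ʳ g (d !! i) _)) (R.sym (pairing-∂ f _)))
             (pairing-congʳ f (λ d → R.sym (pairing-∂ g (λ e → φ (d ⊕ e))))) ⟩
      pairing (∂ i f) (λ d → pairing g (λ e → φ (d ⊕ e)))
        +ᴿ pairing f (λ d → pairing (∂ i g) (λ e → φ (d ⊕ e)))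
        ≈⟨ R.+-cong (pairing-* (∂ i f) g φ) (pairing-* f (∂ i g) φ) ⟨
      pairing (∂ i f * g) φ +ᴿ pairing (f * ∂ i g) φ
        ≈⟨ pairing-+ (∂ i f * g) (f * ∂ i g) φ ⟨
      pairing (∂ i f * g + f * ∂ i g) φ ∎
      where
      infixl 9 _!!_
      _!!_ : Exponent → Fin n → ℕ
      _!!_ = Vec.lookup

      lower-⊕ˡ : ∀ {m} (d e : Vec ℕ m) j → Vec.lookup d j ≢ 0 →
        Vec.updateAt (Vec.zipWith ℕ._+_ d e) j ℕ.pred ≡ Vec.zipWith ℕ._+_ (Vec.updateAt d j ℕ.pred) e
      lower-⊕ˡ (zero  ∷ d) (b ∷ e) Fin.zero    d≢0 = contradiction ≡.refl d≢0
      lower-⊕ˡ (suc a ∷ d) (b ∷ e) Fin.zero    d≢0 = ≡.refl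
      lower-⊕ˡ (a ∷ d)     (b ∷ e) (Fin.suc j) d≢0 = ≡.cong (a ℕ.+ b ∷_) (lower-⊕ˡ d e j d≢0)

      -- If the entry of d is 0, `pred` truncates and the two exponents may differ, but then both
      -- sides are zero multiples. Otherwise `lower-⊕ˡ` applies.
      lower-⊕ˡ′ : ∀ φ d e → d !! i ×ᴿ φ (lower (d ⊕ e)) ≈ᴿ d !! i ×ᴿ φ (lower d ⊕ e)
      lower-⊕ˡ′ φ d e with d !! i in eq
      ... | zero  = R.refl
      ... | suc k = ×-congʳ (suc k) (≡⇒≈ φ (lower-⊕ˡ d e i λ d≡0 → ℕ.1+n≢0 (≡.trans (≡.sym eq) d≡0)))

      lower-⊕ : ∀ φ d e → (d ⊕ e) !! i ×ᴿ φ (lower (d ⊕ e)) ≈ᴿ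
                          d !! i ×ᴿ φ (lower d ⊕ e) +ᴿ e !! i ×ᴿ φ (d ⊕ lower e)
      lower-⊕ φ d e = begin
        (d ⊕ e) !! i ×ᴿ φ (lower (d ⊕ e))
          ≡⟨ ≡.cong (_×ᴿ φ (lower (d ⊕ e))) (Vec.lookup-zipWith ℕ._+_ i d e) ⟩
        (d !! i ℕ.+ e !! i) ×ᴿ φ (lower (d ⊕ e))
          ≈⟨ ×-homo-+ _ (d !! i) (e !! i) ⟩
        d !! i ×ᴿ φ (lower (d ⊕ e)) +ᴿ e !! i ×ᴿ φ (lower (d ⊕ e))
          ≈⟨ R.+-cong (lower-⊕ˡ′ φ d e)
               (×-congʳ (e !! i) (≡⇒≈ (φ ∘ lower) (⊕-comm d e))) ⟩
        d !! i ×ᴿ φ (lower d ⊕ e) +ᴿ e !! i ×ᴿ φ (lower (e ⊕ d))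
          ≈⟨ R.+-congˡ (lower-⊕ˡ′ φ e d) ⟩
        d !! i ×ᴿ φ (lower d ⊕ e) +ᴿ e !! i ×ᴿ φ (lower e ⊕ d)
          ≈⟨ R.+-congˡ (×-congʳ (e !! i) (≡⇒≈ φ (⊕-comm (lower e) d))) ⟩
        d !! i ×ᴿ φ (lower d ⊕ e) +ᴿ e !! i ×ᴿ φ (d ⊕ lower e) ∎

  -- Homogeneity of the list of terms; unlike Homogeneous it needs no
  -- cancellation argument under products.
  Isobaric : ℕ → Poly → Set c
  Isobaric l = All (λ t → Vec.sum (proj₂ t) ≡ l)

  isobaric-* : ∀ {k l} → Isobaric k p → Isobaric l q → Isobaric (k ℕ.+ l) (p * q)
  isobaric-* {p} {q} p∈ q∈ = All.cartesianProductWith⁺ (≡.setoid _) (≡.setoid _) _ p q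
    λ {t} {u} t∈p u∈q → ≡.trans (sum-⊕ (proj₂ t) (proj₂ u))
      (≡.cong₂ ℕ._+_ (All.lookup p∈ t∈p) (All.lookup q∈ u∈q))
    where
    open Algebra.Properties.CommutativeSemigroup ℕ.+-commutativeSemigroup using (interchange)
    sum-⊕ : ∀ {m} (d e : Vec ℕ m) → Vec.sum (Vec.zipWith ℕ._+_ d e) ≡ Vec.sum d ℕ.+ Vec.sum e
    sum-⊕ []      []      = ≡.refl
    sum-⊕ (a ∷ d) (b ∷ e) = ≡.trans (≡.cong (a ℕ.+ b ℕ.+_) (sum-⊕ d e)) (interchange a b _ _)

  isobaric⇒homogeneous : ∀ {l} → Isobaric l p → Homogeneous l p
  isobaric⇒homogeneous {[]}          []         e e≢l = R.refl
  isobaric⇒homogeneous {(a , d) ∷ p} (d≡l ∷ p∈) e e≢l with d ≟ᵉ e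
  ... | yes ≡.refl = contradiction d≡l e≢l
  ... | no _       = isobaric⇒homogeneous p∈ e e≢l

-- Adjoining θ with θ² = δ to a commutative ring.

module QuadraticExtension {c ℓ} (𝓐 : CommutativeRing c ℓ) (δ : CommutativeRing.Carrier 𝓐) where

  private module A = CommutativeRing 𝓐
  open A using () renaming (Carrier to A; _+_ to _+ᴬ_; _*_ to _*ᴬ_; _≈_ to _≈ᴬ_)
  private module Solver = Algebra.Solver.Ring.NaturalCoefficients.Default A.commutativeSemiring
  open Solver using (solve; _:=_; _:+_; _:*_)

  infix 5 _+θ_
  record E : Set c where
    constructor _+θ_
    field re im : A
  open E public

  infix 4 _≈_
  record _≈_ (x y : E) : Set ℓ where
    constructor _,_
    field
      re-≈ : re x ≈ᴬ re y
      im-≈ : im x ≈ᴬ im y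
  open _≈_ public

  infixl 6 _+_
  infixl 7 _*_
  infix  8 -_
  _+_ _*_ : E → E → E
  (a +θ b) + (a′ +θ b′) = a +ᴬ a′ +θ b +ᴬ b′
  (a +θ b) * (a′ +θ b′) = a *ᴬ a′ +ᴬ δ *ᴬ (b *ᴬ b′) +θ a *ᴬ b′ +ᴬ b *ᴬ a′

  -_ : E → E
  - (a +θ b) = A.- a +θ A.- b

  embed : A → E
  embed a = a +θ A.0#

  ring : CommutativeRing c ℓ
  ring = record
    { Carrier = E ; _≈_ = _≈_ ; _+_ = _+_ ; _*_ = _*_ ; -_ = -_
    ; 0# = embed A.0# ; 1# = embed A.1#
    ; isCommutativeRing = record
      { isRing = record
        { +-isAbelianGroup = record
          { isGroup = record
            { isMonoid = record
              { isSemigroup = record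
                { isMagma = record
                  { isEquivalence = isEquivalence
                  ; ∙-cong = +-cong
                  }
                ; assoc = λ x y z → A.+-assoc _ _ _ , A.+-assoc _ _ _
                }
              ; identity = comm∧idˡ⇒id +-comm λ x → A.+-identityˡ _ , A.+-identityˡ _
              }
            ; inverse = comm∧invˡ⇒inv +-comm λ x → A.-‿inverseˡ _ , A.-‿inverseˡ _
            ; ⁻¹-cong = λ (p , q) → A.-‿cong p , A.-‿cong q
            }
          ; comm = +-comm
          }
        ; *-cong = λ (p , q) (p′ , q′) →
            A.+-cong (A.*-cong p p′) (A.*-congˡ (A.*-cong q q′)) ,
            A.+-cong (A.*-cong p q′) (A.*-cong q p′)
        ; *-assoc = λ (a +θ b) (a′ +θ b′) (a″ +θ b″) →
            solve 7 (λ a b a′ b′ a″ b″ δ →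
              (a :* a′ :+ δ :* (b :* b′)) :* a″ :+ δ :* ((a :* b′ :+ b :* a′) :* b″) :=
              a :* (a′ :* a″ :+ δ :* (b′ :* b″)) :+ δ :* (b :* (a′ :* b″ :+ b′ :* a″)))
              A.refl a b a′ b′ a″ b″ δ ,
            solve 7 (λ a b a′ b′ a″ b″ δ →
              (a :* a′ :+ δ :* (b :* b′)) :* b″ :+ (a :* b′ :+ b :* a′) :* a″ :=
              a :* (a′ :* b″ :+ b′ :* a″) :+ b :* (a′ :* a″ :+ δ :* (b′ :* b″)))
              A.refl a b a′ b′ a″ b″ δ
        ; *-identity = comm∧idˡ⇒id *-comm *-identityˡ
        ; distrib = comm∧distrʳ⇒distr +-cong *-comm *-distribʳ
        }
      ; *-comm = *-comm
      }
    }
    where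
    isEquivalence : IsEquivalence _≈_
    isEquivalence = record
      { refl  = A.refl , A.refl
      ; sym   = λ (p , q) → A.sym p , A.sym q
      ; trans = λ (p , q) (p′ , q′) → A.trans p p′ , A.trans q q′
      }
    setoid : Setoid _ _
    setoid = record { isEquivalence = isEquivalence }
    open Algebra.Consequences.Setoid setoid
      using (comm∧idˡ⇒id; comm∧invˡ⇒inv; comm∧distrʳ⇒distr)
    +-cong : ∀ {x y x′ y′} → x ≈ y → x′ ≈ y′ → x + x′ ≈ y + y′
    +-cong (p , q) (p′ , q′) = A.+-cong p p′ , A.+-cong q q′
    +-comm : ∀ x y → x + y ≈ y + x
    +-comm x y = A.+-comm _ _ , A.+-comm _ _
    *-comm : ∀ x y → x * y ≈ y * x
    *-comm (a +θ b) (a′ +θ b′) =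
      A.+-cong (A.*-comm a a′) (A.*-congˡ (A.*-comm b b′)) ,
      A.trans (A.+-comm _ _) (A.+-cong (A.*-comm b a′) (A.*-comm a b′))
    *-identityˡ : ∀ x → embed A.1# * x ≈ x
    *-identityˡ (a +θ b) =
      A.trans (A.+-cong (A.*-identityˡ a) (A.trans (A.*-congˡ (A.zeroˡ b)) (A.zeroʳ δ)))
        (A.+-identityʳ a) ,
      A.trans (A.+-cong (A.*-identityˡ b) (A.zeroˡ a)) (A.+-identityʳ b)
    *-distribʳ : ∀ z x y → (x + y) * z ≈ x * z + y * z
    *-distribʳ (a″ +θ b″) (a +θ b) (a′ +θ b′) =
      solve 7 (λ a b a′ b′ a″ b″ δ →
        (a :+ a′) :* a″ :+ δ :* ((b :+ b′) :* b″) :=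
        (a :* a″ :+ δ :* (b :* b″)) :+ (a′ :* a″ :+ δ :* (b′ :* b″)))
        A.refl a b a′ b′ a″ b″ δ ,
      solve 7 (λ a b a′ b′ a″ b″ δ →
        (a :+ a′) :* b″ :+ (b :+ b′) :* a″ :=
        (a :* b″ :+ b :* a″) :+ (a′ :* b″ :+ b′ :* a″))
        A.refl a b a′ b′ a″ b″ δ

  private module R = CommutativeRing ring
  open Algebra.Definitions.RawSemiring (RawRing.rawSemiring R.rawRing) public using (_^_)
  private module A^ = Algebra.Definitions.RawSemiring (RawRing.rawSemiring A.rawRing)

  embed-+ : ∀ a b → embed (a +ᴬ b) ≈ embed a + embed b
  embed-+ a b = A.refl , A.sym (A.+-identityˡ _)

  embed*≈ : ∀ a x → embed a * x ≈ (a *ᴬ re x +θ a *ᴬ im x)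
  embed*≈ a x =
    A.trans (A.+-congˡ (A.trans (A.*-congˡ (A.zeroˡ _)) (A.zeroʳ δ))) (A.+-identityʳ _) ,
    A.trans (A.+-congˡ (A.zeroˡ _)) (A.+-identityʳ _)

  embed-* : ∀ a b → embed (a *ᴬ b) ≈ embed a * embed b
  embed-* a b = R.sym (R.trans (embed*≈ a (embed b)) (A.refl , A.zeroʳ a))

  embed-^ : ∀ a k → embed (a A^.^ k) ≈ embed a ^ k
  embed-^ a zero    = R.refl
  embed-^ a (suc k) = R.trans (embed-* a (a A^.^ k)) (R.*-congˡ (embed-^ a k))

  conj : E → E
  conj (a +θ b) = a +θ A.- b

  conj-* : ∀ x y → conj (x * y) ≈ conj x * conj y
  conj-* (a +θ b) (a′ +θ b′) =
    A.+-congˡ (A.*-congˡ (A.sym (A.trans (A.sym (-‿distribˡ-* b (A.- b′)))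
      (A.trans (A.-‿cong (A.sym (-‿distribʳ-* b b′))) (-‿involutive (b *ᴬ b′)))))) ,
    A.trans (A.sym (-‿+-comm (a *ᴬ b′) (b *ᴬ a′)))
      (A.+-cong (-‿distribʳ-* a b′) (-‿distribˡ-* b a′))
    where open Algebra.Properties.Ring A.ring

  conj-^ : ∀ x k → conj (x ^ k) ≈ conj x ^ k
  conj-^ x zero    = A.refl , -0#≈0#
    where open Algebra.Properties.Ring A.ring
  conj-^ x (suc k) = R.trans (conj-* x (x ^ k)) (R.*-congˡ (conj-^ x k))

  neg-^-even : ∀ x m → (- x) ^ (2 ℕ.* m) ≈ x ^ (2 ℕ.* m)
  neg-^-even x m = R.trans (R.sym (^-assocʳ (- x) 2 m)) (R.trans (^-congˡ m square) (^-assocʳ x 2 m))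
    where
    open Algebra.Properties.Ring R.ring
    open Algebra.Properties.Semiring.Exp R.semiring using (^-assocʳ; ^-congˡ)
    square : (- x) ^ 2 ≈ x ^ 2
    square = R.trans (R.*-congˡ { - x} (R.*-identityʳ (- x))) (R.trans
      (R.trans (R.sym (-‿distribˡ-* x (- x))) (R.trans (R.-‿cong (R.sym (-‿distribʳ-* x x)))
        (-‿involutive (x * x))))
      (R.*-congˡ {x} (R.sym (R.*-identityʳ x))))

module _ {c ℓ c′ ℓ′} (𝓐 : CommutativeRing c ℓ) (𝓑 : CommutativeRing c′ ℓ′)
  (δ : CommutativeRing.Carrier 𝓐) (δ′ : CommutativeRing.Carrier 𝓑) where

  private
    module A = CommutativeRing 𝓐
    module B = CommutativeRing 𝓑
    module A[θ] = QuadraticExtension 𝓐 δ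
    module B[θ] = QuadraticExtension 𝓑 δ′
    module Eᴮ = CommutativeRing B[θ].ring
    open SemiringMorphisms (RawRing.rawSemiring A.rawRing) (RawRing.rawSemiring B.rawRing)

  open QuadraticExtension using (E; re; im; _+θ_)

  -- Multiplication in the extension uses only sums, products and δ, the sign being part of δ, so a
  -- semiring homomorphism extends. The instances are the inclusion of ℤ[x] in ℚ[x], the constants
  -- of ℚ[x], and linear substitutions.
  module ExtendHomomorphism {h : A.Carrier → B.Carrier} (isHom : IsSemiringHomomorphism h)
    (h-δ : h δ B.≈ δ′) where

    private module h = IsSemiringHomomorphism isHom

    extend : E 𝓐 δ → E 𝓑 δ′
    extend x = h (re x) +θ h (im x)

    extend-cong : ∀ {x y} → x A[θ].≈ y → extend x B[θ].≈ extend y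
    extend-cong (p A[θ]., q) = h.⟦⟧-cong p B[θ]., h.⟦⟧-cong q

    extend-* : ∀ x y → extend (x A[θ].* y) B[θ].≈ extend x B[θ].* extend y
    extend-* (a +θ b) (a′ +θ b′) =
      B.trans (h.+-homo _ _) (B.+-cong (h.*-homo a a′)
        (B.trans (h.*-homo δ _) (B.*-cong h-δ (h.*-homo b b′)))) B[θ].,
      B.trans (h.+-homo _ _) (B.+-cong (h.*-homo a b′) (h.*-homo b a′))

    extend-^ : ∀ x k → extend (x A[θ].^ k) B[θ].≈ extend x B[θ].^ k
    extend-^ x zero    = h.1#-homo B[θ]., h.0#-homo
    extend-^ x (suc k) = Eᴮ.trans (extend-* x (x A[θ].^ k)) (Eᴮ.*-congˡ (extend-^ x k))

-- Derivations and second derivatives of powers.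

record Derivation {c ℓ} (𝓐 : CommutativeRing c ℓ) : Set (c ⊔ ℓ) where
  open CommutativeRing 𝓐
  field
    𝐝      : Carrier → Carrier
    𝐝-cong : ∀ {x y} → x ≈ y → 𝐝 x ≈ 𝐝 y
    𝐝-+    : ∀ x y → 𝐝 (x + y) ≈ 𝐝 x + 𝐝 y
    𝐝-*    : ∀ x y → 𝐝 (x * y) ≈ 𝐝 x * y + x * 𝐝 y

  open Algebra.Properties.Group +-group using (identityˡ-unique)
  open Algebra.Properties.Semiring.Mult semiring using (×-congʳ; ×-comm-*) renaming (_×_ to _×ᴺ_)
  open Algebra.Definitions.RawSemiring (RawRing.rawSemiring rawRing) using (_^_)
  open Relation.Binary.Reasoning.Setoid setoid

  𝐝-0 : 𝐝 0# ≈ 0#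
  𝐝-0 = identityˡ-unique (𝐝 0#) (𝐝 0#) (trans (sym (𝐝-+ 0# 0#)) (𝐝-cong (+-identityˡ 0#)))

  𝐝-× : ∀ k x → 𝐝 (k ×ᴺ x) ≈ k ×ᴺ 𝐝 x
  𝐝-× zero    x = 𝐝-0
  𝐝-× (suc k) x = trans (𝐝-+ x (k ×ᴺ x)) (+-congˡ (𝐝-× k x))

  𝐝-^ : ∀ x k → 𝐝 (x ^ suc k) ≈ suc k ×ᴺ (x ^ k * 𝐝 x)
  𝐝-^ x zero = begin
    𝐝 (x * 1#)           ≈⟨ 𝐝-cong (*-identityʳ x) ⟩
    𝐝 x                  ≈⟨ *-identityˡ (𝐝 x) ⟨
    1# * 𝐝 x             ≈⟨ +-identityʳ _ ⟨
    1# * 𝐝 x + 0#        ∎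
  𝐝-^ x (suc k) = begin
    𝐝 (x * x ^ suc k)
      ≈⟨ 𝐝-* x (x ^ suc k) ⟩
    𝐝 x * x ^ suc k + x * 𝐝 (x ^ suc k)
      ≈⟨ +-cong (*-comm (𝐝 x) _) (*-congˡ (𝐝-^ x k)) ⟩
    x ^ suc k * 𝐝 x + x * (suc k ×ᴺ (x ^ k * 𝐝 x))
      ≈⟨ +-congˡ (×-comm-* (suc k) x _) ⟩
    x ^ suc k * 𝐝 x + suc k ×ᴺ (x * (x ^ k * 𝐝 x))
      ≈⟨ +-congˡ (×-congʳ (suc k) (*-assoc x (x ^ k) (𝐝 x))) ⟨
    x ^ suc k * 𝐝 x + suc k ×ᴺ (x ^ suc k * 𝐝 x) ∎

module _ {c ℓ} {𝓐 : CommutativeRing c ℓ} (D₁ D₂ : Derivation 𝓐) where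
  open CommutativeRing 𝓐
  open Derivation D₁ using (𝐝; 𝐝-cong; 𝐝-^)
  open Derivation D₂ using () renaming (𝐝 to 𝐝′; 𝐝-cong to 𝐝′-cong; 𝐝-* to 𝐝′-*; 𝐝-× to 𝐝′-×; 𝐝-^ to 𝐝′-^)
  open Algebra.Properties.Semiring.Mult semiring using (×-congʳ; ×-assocˡ; ×-assoc-*) renaming (_×_ to _×ᴺ_)
  open Algebra.Definitions.RawSemiring (RawRing.rawSemiring rawRing) using (_^_)
  open Relation.Binary.Reasoning.Setoid setoid

  -- The hypothesis is what linearity of a form provides. All second derivatives of a power then
  -- share one factor, a multiple of x^k, and this common factor reduces harmonicity to isotropy.
  𝐝²-^ : ∀ x → 𝐝′ (𝐝 x) ≈ 0# → ∀ k →
         𝐝′ (𝐝 (x ^ (2 ℕ.+ k))) ≈ ((2 ℕ.+ k) ℕ.* (1 ℕ.+ k)) ×ᴺ (x ^ k * (𝐝′ x * 𝐝 x))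
  𝐝²-^ x 𝐝²x≈0 k = begin
    𝐝′ (𝐝 (x ^ (2 ℕ.+ k)))
      ≈⟨ 𝐝′-cong (𝐝-^ x (suc k)) ⟩
    𝐝′ ((2 ℕ.+ k) ×ᴺ (x ^ suc k * 𝐝 x))
      ≈⟨ 𝐝′-× (2 ℕ.+ k) _ ⟩
    (2 ℕ.+ k) ×ᴺ 𝐝′ (x ^ suc k * 𝐝 x)
      ≈⟨ ×-congʳ (2 ℕ.+ k) (𝐝′-* (x ^ suc k) (𝐝 x)) ⟩
    (2 ℕ.+ k) ×ᴺ (𝐝′ (x ^ suc k) * 𝐝 x + x ^ suc k * 𝐝′ (𝐝 x))
      ≈⟨ ×-congʳ (2 ℕ.+ k) (+-cong (*-congʳ (𝐝′-^ x k)) (trans (*-congˡ 𝐝²x≈0) (zeroʳ _))) ⟩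
    (2 ℕ.+ k) ×ᴺ ((suc k ×ᴺ (x ^ k * 𝐝′ x)) * 𝐝 x + 0#)
      ≈⟨ ×-congʳ (2 ℕ.+ k) (trans (+-identityʳ _) (×-assoc-* (suc k) _ (𝐝 x))) ⟩
    (2 ℕ.+ k) ×ᴺ (suc k ×ᴺ (x ^ k * 𝐝′ x * 𝐝 x))
      ≈⟨ ×-assocˡ _ (2 ℕ.+ k) (suc k) ⟩
    ((2 ℕ.+ k) ℕ.* suc k) ×ᴺ (x ^ k * 𝐝′ x * 𝐝 x)
      ≈⟨ ×-congʳ ((2 ℕ.+ k) ℕ.* suc k) (*-assoc _ _ _) ⟩
    ((2 ℕ.+ k) ℕ.* suc k) ×ᴺ (x ^ k * (𝐝′ x * 𝐝 x)) ∎

module _ {c ℓ} {𝓐 : CommutativeRing c ℓ} (δ : CommutativeRing.Carrier 𝓐) (𝓓 : Derivation 𝓐)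
  (𝐝-δ : CommutativeRing._≈_ 𝓐 (Derivation.𝐝 𝓓 δ) (CommutativeRing.0# 𝓐)) where
  open CommutativeRing 𝓐
  open Derivation 𝓓
  open QuadraticExtension using (re; im; _+θ_)
  private module A[θ] = QuadraticExtension 𝓐 δ
  private module Solver = Algebra.Solver.Ring.NaturalCoefficients.Default commutativeSemiring
  open Solver using (solve; _:=_; _:+_; _:*_)
  open Relation.Binary.Reasoning.Setoid setoid

  -- θ is differentiated as a constant, which is consistent with θ² = δ because `𝐝-δ` makes δ one.
  extendDerivation : Derivation A[θ].ring
  extendDerivation = record
    { 𝐝      = λ x → 𝐝 (re x) +θ 𝐝 (im x)
    ; 𝐝-cong = λ (p A[θ]., q) → 𝐝-cong p A[θ]., 𝐝-cong q
    ; 𝐝-+    = λ x y → 𝐝-+ _ _ A[θ]., 𝐝-+ _ _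
    ; 𝐝-*    = λ (a +θ b) (a′ +θ b′) →
        (begin
          𝐝 (a * a′ + δ * (b * b′))
            ≈⟨ 𝐝-+ _ _ ⟩
          𝐝 (a * a′) + 𝐝 (δ * (b * b′))
            ≈⟨ +-cong (𝐝-* a a′) (𝐝-* δ (b * b′)) ⟩
          𝐝 a * a′ + a * 𝐝 a′ + (𝐝 δ * (b * b′) + δ * 𝐝 (b * b′))
            ≈⟨ +-congˡ (+-cong (trans (*-congʳ 𝐝-δ) (zeroˡ _)) (*-congˡ (𝐝-* b b′))) ⟩
          𝐝 a * a′ + a * 𝐝 a′ + (0# + δ * (𝐝 b * b′ + b * 𝐝 b′))
            ≈⟨ +-congˡ (+-identityˡ _) ⟩
          𝐝 a * a′ + a * 𝐝 a′ + δ * (𝐝 b * b′ + b * 𝐝 b′)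
            ≈⟨ solve 9 (λ a b a′ b′ da db da′ db′ δ →
                 da :* a′ :+ a :* da′ :+ δ :* (db :* b′ :+ b :* db′) :=
                 (da :* a′ :+ δ :* (db :* b′)) :+ (a :* da′ :+ δ :* (b :* db′)))
                 refl a b a′ b′ (𝐝 a) (𝐝 b) (𝐝 a′) (𝐝 b′) δ ⟩
          (𝐝 a * a′ + δ * (𝐝 b * b′)) + (a * 𝐝 a′ + δ * (b * 𝐝 b′)) ∎) A[θ].,
        (begin
          𝐝 (a * b′ + b * a′)
            ≈⟨ 𝐝-+ _ _ ⟩
          𝐝 (a * b′) + 𝐝 (b * a′)
            ≈⟨ +-cong (𝐝-* a b′) (𝐝-* b a′) ⟩
          𝐝 a * b′ + a * 𝐝 b′ + (𝐝 b * a′ + b * 𝐝 a′)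
            ≈⟨ solve 4 (λ p q r s → (p :+ q) :+ (r :+ s) := (p :+ r) :+ (q :+ s)) refl _ _ _ _ ⟩
          (𝐝 a * b′ + 𝐝 b * a′) + (a * 𝐝 b′ + b * 𝐝 a′) ∎)
    }

-- Powers of W + 4u.

-- The second case is k + suc k so that its successor is suc k + suc k definitionally: expansions
-- are indexed by n but concern the exponent suc n.
halve : ∀ n → ∃[ k ] (n ≡ k ℕ.+ k ⊎ n ≡ k ℕ.+ suc k)
halve zero    = 0 , inj₁ ≡.refl
halve (suc n) with halve n
... | k , inj₁ n≡ = k , inj₂ (≡.trans (≡.cong suc n≡) (≡.sym (ℕ.+-suc k k)))
... | k , inj₂ n≡ = suc k , inj₁ (≡.cong suc n≡)

module Doubling {c ℓ} (𝓒 : CommutativeRing c ℓ) where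
  open CommutativeRing 𝓒

  double quadruple : Carrier → Carrier
  double x    = x + x
  quadruple x = double (double x)

  double-cong : ∀ {x y} → x ≈ y → double x ≈ double y
  double-cong x≈y = +-cong x≈y x≈y

  quadruple-cong : ∀ {x y} → x ≈ y → quadruple x ≈ quadruple y
  quadruple-cong x≈y = double-cong (double-cong x≈y)

  module Solver where
    open Algebra.Solver.Ring.NaturalCoefficients.Default commutativeSemiring public

    :double :quadruple : ∀ {n} → Polynomial n → Polynomial n
    :double x    = x :+ x
    :quadruple x = :double (:double x)

  open Solver using (solve; _:=_; _:+_; _:*_; con; :double; :quadruple)

  -- With X = W^n and M = n + 1, one more factor W + 4u raises M by 1. All other new terms carry a
  -- factor 16u and go into the remainder.
  linear-step : ∀ W u X M r →
    (W + quadruple u) * (W * X + quadruple (u * (M * X + quadruple r))) ≈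
    W * (W * X) + quadruple (u * ((1# + M) * (W * X) + quadruple (W * r + u * (M * X + quadruple r))))
  linear-step = solve 5 (λ W u X M r →
    (W :+ :quadruple u) :* (W :* X :+ :quadruple (u :* (M :* X :+ :quadruple r))) :=
    W :* (W :* X) :+ :quadruple (u :* ((con 1 :+ M) :* (W :* X)
      :+ :quadruple (W :* r :+ u :* (M :* X :+ :quadruple r))))) refl

  odd-start : ∀ W X u K r →
    W * X + quadruple (u * ((1# + double K) * X + quadruple r)) ≈
    W * X + quadruple (1# * (u * ((1# + double K) * X + double (0# * u) + quadruple r)))
  odd-start = solve 5 (λ W X u K r →
    W :* X :+ :quadruple (u :* ((con 1 :+ :double K) :* X :+ :quadruple r)) :=
    W :* X :+ :quadruple (con 1 :* (u :* ((con 1 :+ :double K) :* X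
      :+ :double (con 0 :* u) :+ :quadruple r)))) refl

  -- The cross term of the square doubles T. With c = Bu + 2r, the remaining square is 16T²u²(M +
  -- 2c)² = 4·2T·u·2Tu(M² + 4(Mc + c²)): the part with M² is only even and has to enter the new B,
  -- while the part with Mc + c² is absorbed by the new remainder.
  doubling-step : ∀ W X u T K B r →
    let M = (1# + double K) * X
        Y = W * X + quadruple (T * (u * (M + double (B * u) + quadruple r)))
        c = B * u + double r
    in Y * Y ≈ W * (X * (W * X)) + quadruple ((1# + 1#) * T * (u *
         ((1# + double K) * (X * (W * X)) + double ((B * (W * X) + T * (M * M)) * u)
           + quadruple (r * (W * X) + double (T * (u * (M * c + c * c)))))))
  doubling-step = solve 7 (λ W X u T K B r →
    let M = (con 1 :+ :double K) :* X
        Y = W :* X :+ :quadruple (T :* (u :* (M :+ :double (B :* u) :+ :quadruple r)))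
        c = B :* u :+ :double r
    in Y :* Y := W :* (X :* (W :* X)) :+ :quadruple ((con 1 :+ con 1) :* T :* (u :*
         ((con 1 :+ :double K) :* (X :* (W :* X)) :+ :double ((B :* (W :* X) :+ T :* (M :* M)) :* u)
           :+ :quadruple (r :* (W :* X) :+ :double (T :* (u :* (M :* c :+ c :* c))))))))
    refl

  summand-step : ∀ z W X T u K B r → let z²u = z * z * u in
    z * (z * (W * X + quadruple (T * (u * ((1# + double K) * X + double (B * u) + quadruple r))))) ≈
    W * X * (z * z) + quadruple (T *
      (X * (1# + double K) * z²u + double (B * (z²u * u)) + quadruple (z²u * r)))
  summand-step = solve 8 (λ z W X T u K B r → let z²u = z :* z :* u in
    z :* (z :* (W :* X :+ :quadruple (T :* (u :*
      ((con 1 :+ :double K) :* X :+ :double (B :* u) :+ :quadruple r))))) :=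
    W :* X :* (z :* z) :+ :quadruple (T :* (X :* (con 1 :+ :double K) :* z²u
      :+ :double (B :* (z²u :* u)) :+ :quadruple (z²u :* r))))
    refl

  -- Each of the three terms provides the additional factor 2: the first two because the sums of Re
  -- z²u and Re z²u² are even, the third out of its factor 4. With t = 2^v the total power is
  -- 2^{v+3}, and modulo 2 only γq survives.
  sum-step : ∀ α t γ q b H R →
    α * 0# + quadruple (t * (γ * double q + double (b * double H) + quadruple R)) ≈
    (1# + 1#) * ((1# + 1#) * ((1# + 1#) * t)) * (γ * q + double (b * H + R))
  sum-step = solve 7 (λ α t γ q b H R → let 2ₛ = con 1 :+ con 1 in
    α :* con 0 :+ :quadruple (t :* (γ :* :double q :+ :double (b :* :double H) :+ :quadruple R)) :=
    2ₛ :* (2ₛ :* (2ₛ :* t)) :* (γ :* q :+ :double (b :* H :+ R))) refl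

-- Odd powers of W + 4u are expanded to first order in u; every doubling of
-- the exponent then gains a factor 2.
module PowerExpansion {c ℓ} (𝓐 : CommutativeRing c ℓ) (δ : CommutativeRing.Carrier 𝓐)
  (W : QuadraticExtension.E 𝓐 δ) where

  private module A = CommutativeRing 𝓐
  private module A[θ] = QuadraticExtension 𝓐 δ
  open A[θ] using (embed; _^_)
  open CommutativeRing A[θ].ring renaming (Carrier to E)
  open Algebra.Properties.Semiring.Exp semiring using (^-homo-*)
  open Algebra.Properties.Semiring.Mult semiring using (×-homo-+) renaming (_×_ to _×ᴱ_)
  open Relation.Binary.Reasoning.Setoid setoid

  -- Taking real parts commutes with multiplication by elements of the base ring only, so
  -- coefficients that are to be moved out of a sum of real parts must lie there.
  Real : E → Set (c ⊔ ℓ)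
  Real x = ∃[ a ] x ≈ embed a

  real-0 : Real 0#
  real-0 = A.0# , refl

  real-1 : Real 1#
  real-1 = A.1# , refl

  real-+ : ∀ {x y} → Real x → Real y → Real (x + y)
  real-+ (a , x≈a) (b , y≈b) = a A.+ b , trans (+-cong x≈a y≈b) (sym (A[θ].embed-+ a b))

  real-* : ∀ {x y} → Real x → Real y → Real (x * y)
  real-* (a , x≈a) (b , y≈b) = a A.* b , trans (*-cong x≈a y≈b) (sym (A[θ].embed-* a b))

  real-^ : ∀ {x} k → Real x → Real (x ^ k)
  real-^ zero    _  = real-1
  real-^ (suc k) xʳ = real-* xʳ (real-^ k xʳ)

  real-×1 : ∀ k → Real (k ×ᴱ 1#)
  real-×1 zero    = real-0
  real-×1 (suc k) = real-+ real-1 (real-×1 k)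

  2# : E
  2# = 1# + 1#

  open Doubling A[θ].ring
  open Doubling.Solver A[θ].ring using (solve; _:=_; _:+_; _:*_; con; :double; :quadruple)

  -- The binomial theorem to first order; every later term contains (4u)².
  linear-expansion : ∀ n u → ∃[ r ] (W + quadruple u) ^ suc n ≈
    W * W ^ n + quadruple (u * (suc n ×ᴱ 1# * W ^ n + quadruple r))
  linear-expansion zero u = 0# ,
    solve 2 (λ W u → (W :+ :quadruple u) :* con 1 :=
      W :* con 1 :+ :quadruple (u :* ((con 1 :+ con 0) :* con 1 :+ :quadruple (con 0)))) refl W u
  linear-expansion (suc n) u with linear-expansion n u
  ... | r , eq = W * r + u * (suc n ×ᴱ 1# * W ^ n + quadruple r) ,
    trans (*-congˡ eq) (linear-step W u (W ^ n) (suc n ×ᴱ 1#) r)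

  -- 2^v (1 + 2K) is suc n split into its powers of 2 and its odd part.  B does not depend
  -- on u, which allows summing over several u.
  record Expansion (n : ℕ) : Set (c ⊔ ℓ) where
    field
      v      : ℕ
      K B    : E
      K-real : Real K
      B-real : Real B
      expand : ∀ u → ∃[ r ] (W + quadruple u) ^ suc n ≈ W * W ^ n + quadruple
        (2# ^ v * (u * ((1# + double K) * W ^ n + double (B * u) + quadruple r)))

  -- The exponent is n + n + 1. For v = 0 the second-order terms of `linear-expansion` already lie
  -- in the remainder, so B starts at 0.
  expansion-odd : ∀ n → Expansion (n ℕ.+ n)
  expansion-odd n = record
    { v = 0 ; K = n ×ᴱ 1# ; B = 0# ; K-real = real-×1 n ; B-real = real-0
    ; expand = λ u → let r , eq = linear-expansion (n ℕ.+ n) u in r , (begin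
        (W + quadruple u) ^ suc (n ℕ.+ n)
          ≈⟨ eq ⟩
        W * X + quadruple (u * (suc (n ℕ.+ n) ×ᴱ 1# * X + quadruple r))
          ≈⟨ +-congˡ (quadruple-cong (*-congˡ (+-congʳ (*-congʳ (+-congˡ (×-homo-+ 1# n n)))))) ⟩
        W * X + quadruple (u * ((1# + double (n ×ᴱ 1#)) * X + quadruple r))
          ≈⟨ odd-start W X u (n ×ᴱ 1#) r ⟩
        W * X + quadruple (1# * (u * ((1# + double (n ×ᴱ 1#)) * X
          + double (0# * u) + quadruple r))) ∎)
    }
    where X = W ^ (n ℕ.+ n)

  expansion-double : Real W → ∀ n → Expansion n → Expansion (n ℕ.+ suc n)
  expansion-double W-real n ex = record
    { v = suc v ; K = K ; K-real = K-real
    ; B = B′ ; B-real = real-+ (real-* B-real (real-* W-real X-real))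
        (real-* (real-^ v (real-+ real-1 real-1)) (real-* MX-real MX-real))
    ; expand = λ u → let r , eq = expand u in r′ u r , (begin
        (W + quadruple u) ^ (suc n ℕ.+ suc n)
          ≈⟨ ^-homo-* (W + quadruple u) (suc n) (suc n) ⟩
        (W + quadruple u) ^ suc n * (W + quadruple u) ^ suc n
          ≈⟨ *-cong eq eq ⟩
        Y u r * Y u r
          ≈⟨ doubling-step W X u (2# ^ v) K B r ⟩
        W * (X * (W * X)) + quadruple (2# ^ suc v * (u * ((1# + double K) * (X * (W * X))
          + double (B′ * u) + quadruple (r′ u r))))
          ≈⟨ +-cong (*-congˡ X²) (quadruple-cong (*-congˡ (*-congˡ
               (+-congʳ (+-congʳ (*-congˡ X²)))))) ⟩
        W * W ^ (n ℕ.+ suc n) + quadruple (2# ^ suc v * (u * ((1# + double K) * W ^ (n ℕ.+ suc n)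
          + double (B′ * u) + quadruple (r′ u r)))) ∎)
    }
    where
    open Expansion ex
    X = W ^ n
    MX = (1# + double K) * X
    B′ = B * (W * X) + 2# ^ v * (MX * MX)
    X-real = real-^ n W-real
    MX-real = real-* (real-+ real-1 (real-+ K-real K-real)) X-real
    X² : X * (W * X) ≈ W ^ (n ℕ.+ suc n)
    X² = sym (^-homo-* W n (suc n))
    Y r′ : E → E → E
    Y u r = W * X + quadruple (2# ^ v * (u * (MX + double (B * u) + quadruple r)))
    r′ u r = r * (W * X) + double (2# ^ v * (u * (MX * (B * u + double r)
      + (B * u + double r) * (B * u + double r))))

  expansion : Real W → ∀ n → Expansion n
  expansion W-real = ℕ.<-rec Expansion λ n rec → case n rec (halve n)
    where
    case : ∀ n → (∀ {m} → m ℕ.< n → Expansion m) →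
           ∃[ k ] (n ≡ k ℕ.+ k ⊎ n ≡ k ℕ.+ suc k) → Expansion n
    case _ rec (k , inj₁ ≡.refl) = expansion-odd k
    case _ rec (k , inj₂ ≡.refl) = expansion-double W-real k (rec (ℕ.m<m+n k ℕ.z<s))

-- The orbit of isotropic forms and the 2-divisibility of its power sums.

Form : Set
Form = Vec ℤ 3 × Vec ℤ 3

-- (a , b) stands for the linear form s − 2a·x + (b·x)√-2, where s = x₁ + x₂ + x₃.  In the
-- coordinates of i, j, ij these are c ± d + e√-2 and its cyclic permutations, divided by √-2, up
-- to sign and conjugation; they are isotropic for the form dual to Nm.
orbit : List Form
orbit = (e₁ , e₁) ∷ (e₁ , + 0 ∷ + 1 ∷ -1ℤ ∷ [])
      ∷ (e₂ , e₂) ∷ (e₂ , -1ℤ ∷ + 0 ∷ + 1 ∷ [])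
      ∷ (e₃ , e₃) ∷ (e₃ , + 1 ∷ -1ℤ ∷ + 0 ∷ []) ∷ []
  where
  -1ℤ = -[1+ 0 ]
  e₁ e₂ e₃ : Vec ℤ 3
  e₁ = + 1 ∷ + 0 ∷ + 0 ∷ []
  e₂ = + 0 ∷ + 1 ∷ + 0 ∷ []
  e₃ = + 0 ∷ + 0 ∷ + 1 ∷ []

realPart imaginaryPart : Form → Vec ℤ 3
realPart (a , _) = Vec.map (λ a → + 1 ℤ.- + 2 ℤ.* a) a
imaginaryPart (_ , b) = b

-- The ring is a parameter because the same sum is needed twice: over ℤ[x] for divisibility, over
-- ℚ[x] for harmonicity and invariance.
module OrbitSum {c ℓ} (𝓐 : CommutativeRing c ℓ)
  (φ : ℤ.+-*-rawRing -Raw-AlmostCommutative⟶ fromCommutativeRing 𝓐)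
  (x₁ x₂ x₃ : CommutativeRing.Carrier 𝓐) where

  open CommutativeRing 𝓐 renaming (Carrier to A)
  private module φ = _-Raw-AlmostCommutative⟶_ φ
  open φ using () renaming (⟦_⟧ to ⟪_⟫)
  open Algebra.Definitions.RawSemiring (RawRing.rawSemiring rawRing) using (_^_)
  open Relation.Binary.Reasoning.Setoid setoid

  lin : Vec ℤ 3 → A
  lin v = ⟪ Vec.lookup v 0F ⟫ * x₁ + ⟪ Vec.lookup v 1F ⟫ * x₂ + ⟪ Vec.lookup v 2F ⟫ * x₃

  -2ᴬ : A
  -2ᴬ = ⟪ -[1+ 1 ] ⟫

  module A[θ] = QuadraticExtension 𝓐 -2ᴬ
  open A[θ] using (E; _+θ_; re; im; embed)
  private module Eᴿ = CommutativeRing A[θ].ring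

  form : Form → E
  form f = lin (realPart f) +θ lin (imaginaryPart f)

  Σ : (Form → A) → A
  Σ g = List.foldr (λ f y → g f + y) 0# orbit

  powerSum : ℕ → A
  powerSum k = Σ λ f → re (form f A[θ].^ k)

  s w : A
  s = x₁ + x₂ + x₃
  w = s ^ 4

  module Symbolic where
    coeff≟ : ∀ a b → Maybe (⟪ a ⟫ ≈ ⟪ b ⟫)
    coeff≟ a b = Maybe.map (λ a≡b → reflexive (≡.cong ⟪_⟫ a≡b)) (dec⇒weaklyDec ℤ._≟_ a b)

    open Algebra.Solver.Ring ℤ.+-*-rawRing (fromCommutativeRing 𝓐) φ coeff≟
      public renaming (⟦_⟧ to evaluate)

    ρ : Vec A 3
    ρ = x₁ ∷ x₂ ∷ x₃ ∷ []

    -- The Boolean test is evaluated with sharing, refl in prove is not.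
    equate : ∀ p q → is-just (normalise p ≟N normalise q) ≡ true → evaluate p ρ ≈ evaluate q ρ
    equate p q eq with just p≈q ← normalise p ≟N normalise q =
      trans (sym (correct p ρ)) (trans (⟦ p≈q ⟧N-cong ρ) (correct q ρ))

    Expr : Set
    Expr = Polynomial 3

    infix 5 _,θ_
    -- Elements of the extension with solver expressions as components. `_⊗_` copies the
    -- multiplication there, so that `eval` is multiplicative and `eval (Z f)` is `form f`
    -- definitionally.
    record Pair : Set where
      constructor _,θ_
      field reₛ imₛ : Expr
    open Pair public

    infixl 7 _⊗_
    _⊗_ : Pair → Pair → Pair
    (a ,θ b) ⊗ (a′ ,θ b′) = a :* a′ :+ con -[1+ 1 ] :* (b :* b′) ,θ a :* b′ :+ b :* a′

    eval : Pair → E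
    eval (a ,θ b) = evaluate a ρ +θ evaluate b ρ

    X₁ X₂ X₃ S E₂ E₃ : Expr
    X₁ = var 0F
    X₂ = var 1F
    X₃ = var 2F
    S  = X₁ :+ X₂ :+ X₃
    E₂ = X₁ :* X₂ :+ X₂ :* X₃ :+ X₃ :* X₁
    E₃ = X₁ :* X₂ :* X₃

    linₛ : Vec ℤ 3 → Expr
    linₛ v = con (Vec.lookup v 0F) :* X₁ :+ con (Vec.lookup v 1F) :* X₂ :+ con (Vec.lookup v 2F) :* X₃

    Z U : Form → Pair
    Z f = linₛ (realPart f) ,θ linₛ (imaginaryPart f)
    -- (s − 2a + b√-2)⁴ = s⁴ + 4U, where a and b stand for a·x and b·x.
    U f@(a , b) =
      (con -[1+ 1 ] :* S :^ 3 :* X :+ con (+ 6) :* S :^ 2 :* X :^ 2 :+ con -[1+ 7 ] :* S :* X :^ 3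
        :+ con (+ 4) :* X :^ 4 :+ con -[1+ 2 ] :* P :^ 2 :* Q :^ 2 :+ Q :^ 4)
      ,θ P :* Q :* (P :^ 2 :+ con -[1+ 1 ] :* Q :^ 2)
      where
      X = linₛ a
      P = linₛ (realPart f)
      Q = linₛ b

    double quadruple : Expr → Expr
    double x    = x :+ x
    quadruple x = double (double x)

    FourthPower : Form → Set ℓ
    FourthPower f = (form f Eᴿ.* form f) Eᴿ.* (form f Eᴿ.* form f) A[θ].≈
                    embed w Eᴿ.+ eval (quadruple (reₛ (U f)) ,θ quadruple (imₛ (U f)))

    -- Two squarings of z ≡ s (mod √-2), with `U` as the explicit quotient. The coefficients of the
    -- forms being numerals, each component is a polynomial identity that the normaliser decides.
    fourthPower : All FourthPower orbit
    fourthPower = All.map (λ {f} → prf f) checked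
      where
      lhs rhs : Form → Pair
      lhs f = (Z f ⊗ Z f) ⊗ (Z f ⊗ Z f)
      rhs f = S :^ 4 :+ quadruple (reₛ (U f)) ,θ quadruple (imₛ (U f))
      Checked : Form → Set
      Checked f = is-just (normalise (reₛ (lhs f)) ≟N normalise (reₛ (rhs f))) ≡ true
                × is-just (normalise (imₛ (lhs f)) ≟N normalise (imₛ (rhs f))) ≡ true
      checked : All Checked orbit
      checked = (≡.refl , ≡.refl) ∷ (≡.refl , ≡.refl) ∷ (≡.refl , ≡.refl)
        ∷ (≡.refl , ≡.refl) ∷ (≡.refl , ≡.refl) ∷ (≡.refl , ≡.refl) ∷ []
      prf : ∀ f → Checked f → FourthPower f
      prf f (p , q) = equate (reₛ (lhs f)) (reₛ (rhs f)) p A[θ].,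
        trans (equate (imₛ (lhs f)) (imₛ (rhs f)) q) (sym (+-identityˡ _))

    Σₛ : (Form → Expr) → Expr
    Σₛ g = List.foldr (λ f y → g f :+ y) (con (+ 0)) orbit

    Σₛ≈Σ : ∀ g → evaluate (Σₛ g) ρ ≈ Σ (λ f → evaluate (g f) ρ)
    Σₛ≈Σ g = go orbit
      where
      go : ∀ fs → evaluate (List.foldr (λ f y → g f :+ y) (con (+ 0)) fs) ρ ≈
                  List.foldr (λ f y → evaluate (g f) ρ + y) 0# fs
      go []       = φ.0-homo
      go (f ∷ fs) = +-congˡ (go fs)

    -- (H₁ − 2s⁶)/4 and H₂/2 for H₁ = Σ Re z²u and H₂ = Σ Re z²u², in terms of the
    -- elementary symmetric polynomials.
    h₁ h₂ : Expr
    h₁ = con (+ 4) :* S :^ 6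
      :+ con -[1+ 35 ] :* S :^ 4 :* E₂
      :+ con (+ 54) :* S :^ 2 :* E₂ :^ 2
      :+ con (+ 126) :* S :^ 3 :* E₃
      :+ con (+ 78) :* E₂ :^ 3
      :+ con -[1+ 566 ] :* S :* E₂ :* E₃
      :+ con (+ 693) :* E₃ :^ 2
    h₂ = con -[1+ 26 ] :* S :^ 10
      :+ con (+ 336) :* S :^ 8 :* E₂
      :+ con -[1+ 1103 ] :* S :^ 6 :* E₂ :^ 2
      :+ con -[1+ 1775 ] :* S :^ 7 :* E₃
      :+ con -[1+ 467 ] :* S :^ 4 :* E₂ :^ 3
      :+ con (+ 14922) :* S :^ 5 :* E₂ :* E₃
      :+ con (+ 4920) :* S :^ 2 :* E₂ :^ 4
      :+ con -[1+ 26399 ] :* S :^ 3 :* E₂ :^ 2 :* E₃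
      :+ con -[1+ 26597 ] :* S :^ 4 :* E₃ :^ 2
      :+ con (+ 60) :* E₂ :^ 5
      :+ con -[1+ 20129 ] :* S :* E₂ :^ 3 :* E₃
      :+ con (+ 113850) :* S :^ 2 :* E₂ :* E₃ :^ 2
      :+ con (+ 10890) :* E₂ :^ 2 :* E₃ :^ 2
      :+ con -[1+ 106589 ] :* S :* E₃ :^ 3

    u : Form → E
    u f = eval (U f)

    sum-equate : ∀ g p → is-just (normalise (Σₛ g) ≟N normalise p) ≡ true →
                 Σ (λ f → evaluate (g f) ρ) ≈ evaluate p ρ
    sum-equate g p eq = trans (sym (Σₛ≈Σ g)) (equate (Σₛ g) p eq)

    -- This is the invariant harmonic form of degree 2 that has to vanish; here it is simply
    -- computed.
    sum-z² : Σ (λ f → re (form f Eᴿ.* form f)) ≈ 0#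
    sum-z² = trans (sum-equate (λ f → reₛ (Z f ⊗ Z f)) (con (+ 0)) ≡.refl) φ.0-homo

    -- Exchanging two variables permutes the six forms up to conjugation, which real parts do not
    -- see. Hence this sum and the next are symmetric polynomials, and `h₁`, `h₂` can be written in
    -- the elementary ones.
    sum-z²u : Σ (λ f → re (form f Eᴿ.* form f Eᴿ.* u f)) ≈ evaluate (double (S :^ 6 :+ double h₁)) ρ
    sum-z²u = sum-equate (λ f → reₛ (Z f ⊗ Z f ⊗ U f)) (double (S :^ 6 :+ double h₁)) ≡.refl

    sum-z²u² : Σ (λ f → re (form f Eᴿ.* form f Eᴿ.* u f Eᴿ.* u f)) ≈ evaluate (double h₂) ρ
    sum-z²u² = sum-equate (λ f → reₛ (Z f ⊗ Z f ⊗ U f ⊗ U f)) (double h₂) ≡.refl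

  open Symbolic using (u; fourthPower; sum-z²; sum-z²u; sum-z²u²; h₁; h₂; ρ; evaluate)
  private
    module Expand = PowerExpansion 𝓐 -2ᴬ (embed w)
    module A^ = Algebra.Properties.Semiring.Exp semiring
    module E^ = Algebra.Properties.Semiring.Exp Eᴿ.semiring
    module E× = Algebra.Properties.Semiring.Mult Eᴿ.semiring
    module AS = Doubling.Solver 𝓐
    module ES = Doubling.Solver A[θ].ring
    module E-Doubling = Doubling A[θ].ring

  open Doubling 𝓐

  2ᴬ : A
  2ᴬ = 1# + 1#

  Σ-cong : ∀ {g h} → All (λ f → g f ≈ h f) orbit → Σ g ≈ Σ h
  Σ-cong {g} {h} = go
    where
    go : ∀ {fs} → All (λ f → g f ≈ h f) fs →
         List.foldr (λ f y → g f + y) 0# fs ≈ List.foldr (λ f y → h f + y) 0# fs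
    go []         = refl
    go (eq ∷ eqs) = +-cong eq (go eqs)

  Σ-+ : ∀ g h → Σ (λ f → g f + h f) ≈ Σ g + Σ h
  Σ-+ g h = go orbit
    where
    go : ∀ fs → List.foldr (λ f y → g f + h f + y) 0# fs ≈
                List.foldr (λ f y → g f + y) 0# fs + List.foldr (λ f y → h f + y) 0# fs
    go []       = sym (+-identityˡ 0#)
    go (f ∷ fs) = trans (+-congˡ (go fs))
      (AS.solve 4 (λ a b c d → (a AS.:+ b) AS.:+ (c AS.:+ d) AS.:= (a AS.:+ c) AS.:+ (b AS.:+ d))
        refl _ _ _ _)

  Σ-* : ∀ a g → Σ (λ f → a * g f) ≈ a * Σ g
  Σ-* a g = go orbit
    where
    go : ∀ fs → List.foldr (λ f y → a * g f + y) 0# fs ≈ a * List.foldr (λ f y → g f + y) 0# fs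
    go []       = sym (zeroʳ a)
    go (f ∷ fs) = trans (+-congˡ (go fs)) (sym (distribˡ a _ _))

  form^4n : All (λ f → ∀ n → form f A[θ].^ (n ℕ.* 4) A[θ].≈
                       (embed w Eᴿ.+ E-Doubling.quadruple (u f)) A[θ].^ n) orbit
  form^4n = All.map (λ {f} → prf f) fourthPower
    where
    prf : ∀ f → Symbolic.FourthPower f → ∀ n → form f A[θ].^ (n ℕ.* 4) A[θ].≈
          (embed w Eᴿ.+ E-Doubling.quadruple (u f)) A[θ].^ n
    prf f z⁴ n = Eᴿ.trans (E^.^-congʳ z (ℕ.*-comm n 4)) (Eᴿ.trans (Eᴿ.sym (E^.^-assocʳ z 4 n))
      (E^.^-congˡ n (Eᴿ.trans
        (ES.solve 1 (λ z → z ES.:* (z ES.:* (z ES.:* (z ES.:* ES.con 1))) ES.:=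
                           (z ES.:* z) ES.:* (z ES.:* z)) Eᴿ.refl z)
        z⁴)))
      where z = form f

  re-real-* : ∀ {x a} → x A[θ].≈ embed a → ∀ y → re (x Eᴿ.* y) ≈ a * re y
  re-real-* {x} {a} x≈a y = trans (A[θ].re-≈ (Eᴿ.*-congʳ x≈a)) (A[θ].re-≈ (A[θ].embed*≈ a y))

  -- Divisibility and congruence are recorded by witnesses. The quotient is thus available as an
  -- integral polynomial, and no cancellation of 2 in the ring is involved.
  record Divisible (k : ℕ) : Set (c ⊔ ℓ) where
    constructor divisibility
    field
      exponent          : ℕ
      quotient half     : A
      powerSum≈2^*      : powerSum k ≈ 2ᴬ ^ exponent * quotient
      quotient≈s^+2half : quotient ≈ s ^ k + double half

  s^4n : ∀ n → w ^ n ≈ s ^ (n ℕ.* 4)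
  s^4n n = trans (A^.^-assocʳ s 4 n) (A^.^-congʳ s (ℕ.*-comm 4 n))

  Σ-double : ∀ g → Σ (λ f → double (g f)) ≈ double (Σ g)
  Σ-double g = Σ-+ g g

  Σ-quadruple : ∀ g → Σ (λ f → quadruple (g f)) ≈ quadruple (Σ g)
  Σ-quadruple g = trans (Σ-double (λ f → double (g f))) (+-cong (Σ-double g) (Σ-double g))

  divisible-4n : ∀ n → Divisible (suc n ℕ.* 4)
  -- The six leading terms give 6w^{n+1} + 4Σy = 2(w^{n+1} + 2(w^{n+1} + Σy)).
  divisible-4n n = divisibility 1 (w ^ suc n + double (w ^ suc n + Σ y)) (w ^ suc n + Σ y)
    (begin
      powerSum (suc n ℕ.* 4)
        ≈⟨ Σ-cong (All.map (λ {f} z⁴ → expanded f (z⁴ (suc n))) form^4n) ⟩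
      Σ (λ f → w ^ suc n + quadruple (y f))
        ≈⟨ Σ-+ (λ _ → w ^ suc n) (λ f → quadruple (y f)) ⟩
      Σ (λ _ → w ^ suc n) + Σ (λ f → quadruple (y f))
        ≈⟨ +-congˡ (Σ-quadruple y) ⟩
      Σ (λ _ → w ^ suc n) + quadruple (Σ y)
        ≈⟨ AS.solve 2 (λ p q → let open AS; 1ₛ = con 1 in
             (p :+ (p :+ (p :+ (p :+ (p :+ (p :+ con 0)))))) :+ :quadruple q :=
             :double 1ₛ :* 1ₛ :* (p :+ :double (p :+ q))) refl (w ^ suc n) (Σ y) ⟩
      2ᴬ ^ 1 * (w ^ suc n + double (w ^ suc n + Σ y)) ∎)
    (+-congʳ (s^4n (suc n)))
    where
    y : Form → A
    y f = re (u f Eᴿ.* (suc n E×.× Eᴿ.1# Eᴿ.* embed w A[θ].^ n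
      Eᴿ.+ E-Doubling.quadruple (proj₁ (Expand.linear-expansion n (u f)))))
    expanded : ∀ f → form f A[θ].^ (suc n ℕ.* 4) A[θ].≈
                     (embed w Eᴿ.+ E-Doubling.quadruple (u f)) A[θ].^ suc n →
               re (form f A[θ].^ (suc n ℕ.* 4)) ≈ w ^ suc n + quadruple (y f)
    expanded f z⁴ = trans (A[θ].re-≈ (Eᴿ.trans z⁴ (proj₂ (Expand.linear-expansion n (u f)))))
      (+-congʳ (A[θ].re-≈ (Eᴿ.sym (A[θ].embed-^ w (suc n)))))

  divisible-4n+2 : ∀ n → Divisible (2 ℕ.+ suc n ℕ.* 4)
  divisible-4n+2 n = divisibility (3 ℕ.+ v) f h sum (begin
      x * (1# + double κ) * (s⁶ + double H₁) + double (b * H₂ + Σ y₃)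
        ≈⟨ AS.solve 5 (λ x κ s⁶ H₁ r → let open AS in
             x :* (con 1 :+ :double κ) :* (s⁶ :+ :double H₁) :+ :double r :=
             s⁶ :* x :+ :double (x :* κ :* (s⁶ :+ :double H₁) :+ x :* H₁ :+ r))
             refl x κ s⁶ H₁ (b * H₂ + Σ y₃) ⟩
      s⁶ * x + double h
        ≈⟨ +-congʳ (*-congˡ (s^4n n)) ⟩
      s⁶ * s ^ (n ℕ.* 4) + double h
        -- 6 + 4n and 2 + 4(n + 1), the exponent required, agree definitionally.
        ≈⟨ +-congʳ (A^.^-homo-* s 6 (n ℕ.* 4)) ⟨
      s ^ (6 ℕ.+ n ℕ.* 4) + double h ∎)
    where
    open Expand.Expansion (Expand.expansion (w , Eᴿ.refl) n)
    X = embed w A[θ].^ n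
    T = Expand.2# A[θ].^ v
    x = w ^ n
    t = 2ᴬ ^ v
    κ = proj₁ K-real
    b = proj₁ B-real
    α = w * x
    γ = x * (1# + double κ)
    s⁶ = s ^ 6
    H₁ = evaluate h₁ ρ
    H₂ = evaluate h₂ ρ

    r Y₁ Y₂ Y₃ : Form → E
    r f  = proj₁ (expand (u f))
    Y₁ f = form f Eᴿ.* form f Eᴿ.* u f
    Y₂ f = Y₁ f Eᴿ.* u f
    Y₃ f = Y₁ f Eᴿ.* r f
    y₀ y₁ y₂ y₃ q : Form → A
    y₀ f = re (form f Eᴿ.* form f)
    y₁ f = re (Y₁ f)
    y₂ f = re (Y₂ f)
    y₃ f = re (Y₃ f)
    q f  = γ * y₁ f + double (b * y₂ f) + quadruple (y₃ f)
    f h : A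
    f = x * (1# + double κ) * (s⁶ + double H₁) + double (b * H₂ + Σ y₃)
    h = x * κ * (s⁶ + double H₁) + x * H₁ + (b * H₂ + Σ y₃)

    X-real : X A[θ].≈ embed x
    X-real = Eᴿ.sym (A[θ].embed-^ w n)
    T-real : T A[θ].≈ embed t
    T-real = Eᴿ.trans (E^.^-congˡ v (Eᴿ.sym (A[θ].embed-+ 1# 1#))) (Eᴿ.sym (A[θ].embed-^ 2ᴬ v))
    γ-real : X Eᴿ.* (Eᴿ.1# Eᴿ.+ E-Doubling.double K) A[θ].≈ embed (x * (1# + double κ))
    γ-real = proj₂ (Expand.real-* (x , X-real)
      (Expand.real-+ Expand.real-1 (Expand.real-+ K-real K-real)))
    WX-real : embed w Eᴿ.* X A[θ].≈ embed (w * x)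
    WX-real = proj₂ (Expand.real-* (w , Eᴿ.refl) (x , X-real))

    -- The part with `α` is the only one without a visible factor 4t; it is the one that `sum-z²`
    -- removes. The coefficients `α`, `t`, `γ`, `b` are the base-ring values of WX, T, X(1 + 2K) and
    -- B, and so may leave the real part.
    summand : ∀ f → form f A[θ].^ (suc n ℕ.* 4) A[θ].≈
                     (embed w Eᴿ.+ E-Doubling.quadruple (u f)) A[θ].^ suc n →
              re (form f A[θ].^ (2 ℕ.+ suc n ℕ.* 4)) ≈ α * y₀ f + quadruple (t * q f)
    summand f z⁴ = begin
      re (z A[θ].^ (2 ℕ.+ suc n ℕ.* 4))
        ≈⟨ A[θ].re-≈ (Eᴿ.trans
             (Eᴿ.*-congˡ (Eᴿ.*-congˡ (Eᴿ.trans z⁴ (proj₂ (expand (u f))))))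
             (E-Doubling.summand-step z (embed w) X T (u f) K B (r f))) ⟩
      re (embed w Eᴿ.* X Eᴿ.* (z Eᴿ.* z)) + quadruple (re (T Eᴿ.*
        (X Eᴿ.* (Eᴿ.1# Eᴿ.+ E-Doubling.double K) Eᴿ.* Y₁ f
          Eᴿ.+ E-Doubling.double (B Eᴿ.* Y₂ f) Eᴿ.+ E-Doubling.quadruple (Y₃ f))))
        ≈⟨ +-cong (re-real-* WX-real (z Eᴿ.* z)) (quadruple-cong (trans (re-real-* T-real
             (X Eᴿ.* (Eᴿ.1# Eᴿ.+ E-Doubling.double K) Eᴿ.* Y₁ f
               Eᴿ.+ E-Doubling.double (B Eᴿ.* Y₂ f) Eᴿ.+ E-Doubling.quadruple (Y₃ f)))
             (*-congˡ (+-congʳ (+-cong (re-real-* γ-real (Y₁ f))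
               (double-cong (re-real-* (proj₂ B-real) (Y₂ f)))))))) ⟩
      α * y₀ f + quadruple (t * q f) ∎
      where
      z = form f

    sum : powerSum (2 ℕ.+ suc n ℕ.* 4) ≈ 2ᴬ ^ (3 ℕ.+ v) * f
    sum = begin
      powerSum (2 ℕ.+ suc n ℕ.* 4)
        ≈⟨ Σ-cong (All.map (λ {f} z⁴ → summand f (z⁴ (suc n))) form^4n) ⟩
      Σ (λ f → α * y₀ f + quadruple (t * q f))
        ≈⟨ trans (Σ-+ (λ f → α * y₀ f) (λ f → quadruple (t * q f)))
             (+-cong (Σ-* α y₀) (trans (Σ-quadruple (λ f → t * q f)) (quadruple-cong (trans (Σ-* t q)
               (*-congˡ (trans (Σ-+ (λ f → γ * y₁ f + double (b * y₂ f)) (λ f → quadruple (y₃ f)))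
                 (+-cong (trans (Σ-+ (λ f → γ * y₁ f) (λ f → double (b * y₂ f)))
                           (+-cong (Σ-* γ y₁) (trans (Σ-double (λ f → b * y₂ f)) (double-cong (Σ-* b y₂)))))
                   (Σ-quadruple y₃)))))))) ⟩
      α * Σ y₀ + quadruple (t * (γ * Σ y₁ + double (b * Σ y₂) + quadruple (Σ y₃)))
        ≈⟨ +-cong (*-congˡ sum-z²) (quadruple-cong (*-congˡ (+-congʳ (+-cong
             (*-congˡ sum-z²u) (double-cong (*-congˡ sum-z²u²)))))) ⟩
      α * 0# + quadruple (t * (γ * double (s⁶ + double H₁) + double (b * double H₂) + quadruple (Σ y₃)))
        ≈⟨ sum-step α t γ (s⁶ + double H₁) b H₂ (Σ y₃) ⟩
      2ᴬ ^ (3 ℕ.+ v) * f ∎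

-- Passage from ℤ[x] to ℚ[x], homogeneity, and substitution as a homomorphism.

module _ {c ℓ c′ ℓ′} (𝓐 : CommutativeRing c ℓ) (𝓑 : CommutativeRing c′ ℓ′) where
  private
    module A = CommutativeRing 𝓐
    module B = CommutativeRing 𝓑
  open SemiringMorphisms (RawRing.rawSemiring A.rawRing) (RawRing.rawSemiring B.rawRing)

  semiringHomomorphism : ∀ {h} →
    (∀ {x y} → x A.≈ y → h x B.≈ h y) →
    (∀ x y → h (x A.+ y) B.≈ h x B.+ h y) → h A.0# B.≈ B.0# →
    (∀ x y → h (x A.* y) B.≈ h x B.* h y) → h A.1# B.≈ B.1# →
    IsSemiringHomomorphism h
  semiringHomomorphism h-cong h-+ h-0 h-* h-1 = record
    { isNearSemiringHomomorphism = record
      { +-isMonoidHomomorphism = record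
        { isMagmaHomomorphism = record
          { isRelHomomorphism = record { cong = h-cong }
          ; homo = h-+
          }
        ; ε-homo = h-0
        }
      ; *-homo = h-*
      }
    ; 1#-homo = h-1
    }

module ℤ[x]ᴿ = PolynomialRing ℤ.+-*-commutativeRing 3
module ℚ[x]ᴿ = PolynomialRing ℚ.+-*-commutativeRing 3

ℤ[x]-ring = ℤ[x]ᴿ.polynomialRing
ℚ[x]-ring = ℚ[x]ᴿ.polynomialRing

module Zx = CommutativeRing ℤ[x]-ring
module Qx = CommutativeRing ℚ[x]-ring

coeff-toℚ[x] : ∀ p e → ℚ[x].coeff (toℚ[x] p) e ≡ fromℤ (ℤ[x].coeff p e)
coeff-toℚ[x] []            e = ≡.refl
coeff-toℚ[x] ((a , d) ∷ p) e with does (Vec.≡-dec ℕ._≟_ d e)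
... | true  = ≡.trans (≡.cong (fromℤ a ℚ.+_) (coeff-toℚ[x] p e)) (≡.sym (fromℤ-+ a _))
... | false = coeff-toℚ[x] p e

toℚ[x]-* : ∀ p q → toℚ[x] (p ℤ[x].* q) ≡ toℚ[x] p ℚ[x].* toℚ[x] q
toℚ[x]-* []            q = ≡.refl
toℚ[x]-* ((a , d) ∷ p) q = ≡.trans (List.map-++ _ _ (p ℤ[x].* q))
  (≡.cong₂ List._++_
    (≡.trans (≡.sym (List.map-∘ q)) (≡.trans
      (List.map-cong (λ (b , e) → ≡.cong (_, _) (fromℤ-* a b)) q) (List.map-∘ q)))
    (toℚ[x]-* p q))

toℚ[x]-homomorphism = semiringHomomorphism ℤ[x]-ring ℚ[x]-ring {toℚ[x]}
  (λ {p} {q} p≈q → ℚ[x]ᴿ.coefficientwise λ e →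
    ≡.trans (coeff-toℚ[x] p e) (≡.trans (≡.cong fromℤ (ℤ[x]ᴿ.coefficients p≈q e))
      (≡.sym (coeff-toℚ[x] q e))))
  (λ p q → Qx.reflexive (List.map-++ _ p q)) Qx.refl
  (λ p q → Qx.reflexive (toℚ[x]-* p q)) Qx.refl

fromℤ-homomorphism : ℤ.+-*-rawRing -Raw-AlmostCommutative⟶ fromCommutativeRing ℚ[x]-ring
fromℤ-homomorphism = record
  { ⟦_⟧    = λ a → ℚ[x].constant (fromℤ a)
  ; +-homo = λ a b → Qx.trans (ℚ[x]ᴿ.constant-cong (fromℤ-+ a b)) (ℚ[x]ᴿ.constant-+ _ _)
  ; *-homo = λ a b → Qx.trans (ℚ[x]ᴿ.constant-cong (fromℤ-* a b))
                              (ℚ[x]ᴿ.constant-* (fromℤ a) (fromℤ b))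
  ; -‿homo = λ a → ℚ[x]ᴿ.constant-cong (fromℤ-neg a)
  ; 0-homo = ℚ[x]ᴿ.constant-0
  ; 1-homo = Qx.refl
  }

module Gᶻ = OrbitSum ℤ[x]-ring ℤ[x]ᴿ.constant-homomorphism
  (ℤ[x].var 0F) (ℤ[x].var 1F) (ℤ[x].var 2F)
module Gᑫ = OrbitSum ℚ[x]-ring fromℤ-homomorphism
  (ℚ[x].var 0F) (ℚ[x].var 1F) (ℚ[x].var 2F)

module Q[θ] = CommutativeRing Gᑫ.A[θ].ring
module Q[θ]^ = Algebra.Properties.Semiring.Exp Q[θ].semiring

open QuadraticExtension using (E; re; im; _+θ_)

toℚ[x]-powerSum : ∀ k → toℚ[x] (Gᶻ.powerSum k) Qx.≈ Gᑫ.powerSum k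
toℚ[x]-powerSum k = go orbit
  where
  module toℚ = SemiringMorphisms.IsSemiringHomomorphism toℚ[x]-homomorphism
  open ExtendHomomorphism ℤ[x]-ring ℚ[x]-ring Gᶻ.-2ᴬ Gᑫ.-2ᴬ toℚ[x]-homomorphism Qx.refl
  toℚ-lin : ∀ v → toℚ[x] (Gᶻ.lin v) Qx.≈ Gᑫ.lin v
  toℚ-lin v = Qx.trans (toℚ.+-homo (term 0F ℤ[x].+ term 1F) (term 2F)) (Qx.+-cong
    (Qx.trans (toℚ.+-homo (term 0F) (term 1F)) (Qx.+-cong (toℚ-term 0F) (toℚ-term 1F)))
    (toℚ-term 2F))
    where
    term : Fin 3 → ℤ[x].Poly
    term i = ℤ[x].constant (Vec.lookup v i) ℤ[x].* ℤ[x].var i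
    toℚ-term : ∀ i → toℚ[x] (term i) Qx.≈ ℚ[x].constant (fromℤ (Vec.lookup v i)) ℚ[x].* ℚ[x].var i
    toℚ-term i = toℚ.*-homo (ℤ[x].constant (Vec.lookup v i)) (ℤ[x].var i)
  go : ∀ fs → toℚ[x] (List.foldr (λ f y → re (Gᶻ.form f Gᶻ.A[θ].^ k) ℤ[x].+ y) [] fs) Qx.≈
              List.foldr (λ f y → re (Gᑫ.form f Gᑫ.A[θ].^ k) ℚ[x].+ y) [] fs
  go []       = Qx.refl
  go (f ∷ fs) = Qx.trans
    (toℚ.+-homo (re (Gᶻ.form f Gᶻ.A[θ].^ k))
      (List.foldr (λ f y → re (Gᶻ.form f Gᶻ.A[θ].^ k) ℤ[x].+ y) [] fs))
    (Qx.+-cong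
      (Gᑫ.A[θ].re-≈ (Q[θ].trans (extend-^ (Gᶻ.form f) k)
        (Q[θ]^.^-congˡ k (toℚ-lin (realPart f) Gᑫ.A[θ]., toℚ-lin (imaginaryPart f)))))
      (go fs))

isobaric-powerSum : ∀ k → ℚ[x]ᴿ.Isobaric k (Gᑫ.powerSum k)
isobaric-powerSum k = go orbit
  where
  Isobaricᴱ : ℕ → E ℚ[x]-ring Gᑫ.-2ᴬ → Set
  Isobaricᴱ l x = ℚ[x]ᴿ.Isobaric l (re x) × ℚ[x]ᴿ.Isobaric l (im x)
  lin : ∀ v → ℚ[x]ᴿ.Isobaric 1 (Gᑫ.lin v)
  lin v = ≡.refl ∷ ≡.refl ∷ ≡.refl ∷ []
  -2-isobaric : ℚ[x]ᴿ.Isobaric 0 Gᑫ.-2ᴬ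
  -2-isobaric = ≡.refl ∷ []
  power : ∀ f k → Isobaricᴱ k (Gᑫ.form f Gᑫ.A[θ].^ k)
  power f zero    = (≡.refl ∷ []) , []
  power f (suc k) = let a , b = power f k; p = lin (realPart f); q = lin (imaginaryPart f) in
    All.++⁺ (ℚ[x]ᴿ.isobaric-* p a) (ℚ[x]ᴿ.isobaric-* -2-isobaric (ℚ[x]ᴿ.isobaric-* q b)) ,
    All.++⁺ (ℚ[x]ᴿ.isobaric-* p b) (ℚ[x]ᴿ.isobaric-* q a)
  go : ∀ fs → ℚ[x]ᴿ.Isobaric k (List.foldr (λ f y → re (Gᑫ.form f Gᑫ.A[θ].^ k) ℚ[x].+ y) [] fs)
  go []       = []
  go (f ∷ fs) = All.++⁺ (proj₁ (power f k)) (go fs)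

module _ (σ : Fin 3 → ℚ[x].Poly) where
  open ℚ[x]ᴿ

  ⟨⟩-homomorphism = semiringHomomorphism ℚ[x]-ring ℚ[x]-ring {ℚ[x]._⟨ σ ⟩}
    (⟨⟩-cong σ) (⟨⟩-+ σ) Qx.refl (⟨⟩-* σ) (⟨⟩-constant σ 1ℚ)

  var-⟨⟩ : ∀ i → ℚ[x].var i ℚ[x].⟨ σ ⟩ Qx.≈ σ i
  var-⟨⟩ = λ where
      0F → Qx.trans (Qx.+-identityʳ _) (solve 3 (λ x y z →
        con 1 :* (x :* con 1 :* (con 1 :* (con 1 :* con 1))) := x) Qx.refl (σ 0F) (σ 1F) (σ 2F))
      1F → Qx.trans (Qx.+-identityʳ _) (solve 3 (λ x y z →
        con 1 :* (con 1 :* (y :* con 1 :* (con 1 :* con 1))) := y) Qx.refl (σ 0F) (σ 1F) (σ 2F))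
      2F → Qx.trans (Qx.+-identityʳ _) (solve 3 (λ x y z →
        con 1 :* (con 1 :* (con 1 :* (z :* con 1 :* con 1))) := z) Qx.refl (σ 0F) (σ 1F) (σ 2F))
    where open Doubling.Solver ℚ[x]-ring

open ℚ[x]ᴿ using (constant-cong; constant-+; constant-*; constant-0;
  ∂-cong; ∂-+; ∂-*; ∂-constant; ⟨⟩-+; ⟨⟩-*; ⟨⟩-constant)

-- Harmonicity of the power sums.

-- Rational coefficients, because the forms are going to be transformed by matrices over ℚ.
Formᑫ : Set
Formᑫ = Vec ℚ 3 × Vec ℚ 3

linᑫ : Vec ℚ 3 → ℚ[x].Poly
linᑫ v = Vec.lookup v 0F · var 0F + Vec.lookup v 1F · var 1F + Vec.lookup v 2F · var 2F
  where open ℚ[x]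

formᑫ : Formᑫ → E ℚ[x]-ring Gᑫ.-2ᴬ
formᑫ (p , q) = linᑫ p +θ linᑫ q

orbitᑫ : List Formᑫ
orbitᑫ = List.map (λ f → Vec.map fromℤ (realPart f) , Vec.map fromℤ (imaginaryPart f)) orbit

sumᑫ : (Formᑫ → ℚ[x].Poly) → List Formᑫ → ℚ[x].Poly
sumᑫ g = List.foldr (λ f y → g f ℚ[x].+ y) []

powerᑫ : ℕ → Formᑫ → ℚ[x].Poly
powerᑫ k f = re (formᑫ f Gᑫ.A[θ].^ k)

powerSum≡sumᑫ : ∀ k → Gᑫ.powerSum k ≡ sumᑫ (powerᑫ k) orbitᑫ
powerSum≡sumᑫ k = ≡.refl

derivation : Fin 3 → Derivation ℚ[x]-ring
derivation i = record { 𝐝 = ℚ[x].∂ i ; 𝐝-cong = ∂-cong i ; 𝐝-+ = ∂-+ i ; 𝐝-* = ∂-* i }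

∂-lin : ∀ i v → ℚ[x].∂ i (linᑫ v) Qx.≈ ℚ[x].constant (Vec.lookup v i)
∂-lin i v = ℚ[x]ᴿ.pairing-injective (eq i)
  where
  open Doubling.Solver ℚ.+-*-commutativeRing
  𝟎 = 0 ∷ 0 ∷ 0 ∷ []
  a = Vec.lookup v 0F
  b = Vec.lookup v 1F
  c = Vec.lookup v 2F
  eq : ∀ i φ → ℚ[x]ᴿ.pairing (ℚ[x].∂ i (linᑫ v)) φ ≡ ℚ[x]ᴿ.pairing (ℚ[x].constant (Vec.lookup v i)) φ
  eq 0F φ = solve 6 (λ a b c x y z → (a :* con 1 :+ con 0) :* x :+ (con 0 :* y :+ (con 0 :* z :+ con 0)) :=
    a :* x :+ con 0) ≡.refl a b c (φ 𝟎) (φ (0 ∷ 1 ∷ 0 ∷ [])) (φ (0 ∷ 0 ∷ 1 ∷ []))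
  eq 1F φ = solve 6 (λ a b c x y z → con 0 :* x :+ ((b :* con 1 :+ con 0) :* y :+ (con 0 :* z :+ con 0)) :=
    b :* y :+ con 0) ≡.refl a b c (φ (1 ∷ 0 ∷ 0 ∷ [])) (φ 𝟎) (φ (0 ∷ 0 ∷ 1 ∷ []))
  eq 2F φ = solve 6 (λ a b c x y z → con 0 :* x :+ (con 0 :* y :+ ((c :* con 1 :+ con 0) :* z :+ con 0)) :=
    c :* z :+ con 0) ≡.refl a b c (φ (1 ∷ 0 ∷ 0 ∷ [])) (φ (0 ∷ 1 ∷ 0 ∷ [])) (φ 𝟎)

module _ {c ℓ} (𝓒 : CommutativeRing c ℓ) where
  open CommutativeRing 𝓒

  -- The symbol of 2Δ_Q; up to a scalar, the quadratic form dual to Nm.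
  dualForm : (Fin 3 → Fin 3 → Carrier) → Carrier
  dualForm y = y 0F 0F + y 1F 1F + y 2F 2F + y 0F 1F + y 1F 2F + y 2F 0F

  dualForm-cong : ∀ x y → (∀ i j → x i j ≈ y i j) → dualForm x ≈ dualForm y
  dualForm-cong x y eq = +-cong (+-cong (+-cong (+-cong (+-cong
    (eq 0F 0F) (eq 1F 1F)) (eq 2F 2F)) (eq 0F 1F)) (eq 1F 2F)) (eq 2F 0F)

  dualForm-* : ∀ a y → dualForm (λ i j → a * y i j) ≈ a * dualForm y
  dualForm-* a y = solve 7 (λ a u v w x y z →
    a :* u :+ a :* v :+ a :* w :+ a :* x :+ a :* y :+ a :* z :=
    a :* (u :+ v :+ w :+ x :+ y :+ z)) refl a _ _ _ _ _ _
    where open Doubling.Solver 𝓒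

  dualForm-+ : ∀ x y → dualForm (λ i j → x i j + y i j) ≈ dualForm x + dualForm y
  dualForm-+ x y = solve 12 (λ a b c d e f g h i j k l →
    (a :+ g) :+ (b :+ h) :+ (c :+ i) :+ (d :+ j) :+ (e :+ k) :+ (f :+ l) :=
    (a :+ b :+ c :+ d :+ e :+ f) :+ (g :+ h :+ i :+ j :+ k :+ l)) refl _ _ _ _ _ _ _ _ _ _ _ _
    where open Doubling.Solver 𝓒

laplacian : ℚ[x].Poly → ℚ[x].Poly
laplacian f = dualForm ℚ[x]-ring λ i j → ℚ[x].∂ i (ℚ[x].∂ j f)

laplacian-cong : ∀ {f g} → f Qx.≈ g → laplacian f Qx.≈ laplacian g
laplacian-cong {f} {g} f≈g = dualForm-cong ℚ[x]-ring
  (λ i j → ℚ[x].∂ i (ℚ[x].∂ j f)) (λ i j → ℚ[x].∂ i (ℚ[x].∂ j g))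
  λ i j → ∂-cong i (∂-cong j f≈g)

laplacian-+ : ∀ f g → laplacian (f ℚ[x].+ g) Qx.≈ laplacian f ℚ[x].+ laplacian g
laplacian-+ f g = Qx.trans
  (dualForm-cong ℚ[x]-ring (λ i j → ℚ[x].∂ i (ℚ[x].∂ j (f ℚ[x].+ g)))
    (λ i j → ℚ[x].∂ i (ℚ[x].∂ j f) ℚ[x].+ ℚ[x].∂ i (ℚ[x].∂ j g))
    λ i j → Qx.trans (∂-cong i (∂-+ j f g)) (∂-+ i (ℚ[x].∂ j f) (ℚ[x].∂ j g)))
  (dualForm-+ ℚ[x]-ring (λ i j → ℚ[x].∂ i (ℚ[x].∂ j f)) (λ i j → ℚ[x].∂ i (ℚ[x].∂ j g)))

laplacian-· : ∀ a f → laplacian (a ℚ[x].· f) Qx.≈ a ℚ[x].· laplacian f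
laplacian-· a f = Qx.trans
  (dualForm-cong ℚ[x]-ring (λ i j → ℚ[x].∂ i (ℚ[x].∂ j (a ℚ[x].· f)))
    (λ i j → a ℚ[x].· ℚ[x].∂ i (ℚ[x].∂ j f))
    λ i j → Qx.trans (∂-cong i (∂-· j f)) (∂-· i (ℚ[x].∂ j f)))
  (dualForm-* ℚ[x]-ring (ℚ[x].constant a) (λ i j → ℚ[x].∂ i (ℚ[x].∂ j f)))
  where
  ∂-· : ∀ i f → ℚ[x].∂ i (a ℚ[x].· f) Qx.≈ a ℚ[x].· ℚ[x].∂ i f
  ∂-· i f = Qx.trans (∂-* i (ℚ[x].constant a) f)
    (Qx.trans (Qx.+-congʳ (Qx.trans (Qx.*-congʳ {f} (∂-constant i a)) (Qx.zeroˡ f)))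
      (Qx.+-identityˡ (a ℚ[x].· ℚ[x].∂ i f)))

module _ where
  private
    module ℚ[θ] = QuadraticExtension ℚ.+-*-commutativeRing (fromℤ -[1+ 1 ])
    constant-isHom = semiringHomomorphism ℚ.+-*-commutativeRing ℚ[x]-ring {ℚ[x].constant}
      (constant-cong) constant-+ constant-0 constant-* Qx.refl
    module C = ExtendHomomorphism ℚ.+-*-commutativeRing ℚ[x]-ring (fromℤ -[1+ 1 ]) Gᑫ.-2ᴬ
      constant-isHom Qx.refl

    ∂ᴱ : Fin 3 → Derivation Gᑫ.A[θ].ring
    ∂ᴱ i = extendDerivation {𝓐 = ℚ[x]-ring} Gᑫ.-2ᴬ (derivation i) (∂-constant i (fromℤ -[1+ 1 ]))

    open Algebra.Properties.Semiring.Mult Q[θ].semiring using (×-assoc-*; ×-congʳ) renaming (_×_ to _×ᴱ_)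

  coordinate : Formᑫ → Fin 3 → ℚ[θ].E
  coordinate (p , q) i = Vec.lookup p i +θ Vec.lookup q i

  Isotropic : Formᑫ → Set
  Isotropic f = dualForm ℚ[θ].ring (λ i j → coordinate f i ℚ[θ].* coordinate f j) ℚ[θ].≈ ℚ[θ].embed 0ℚ

  -- With ξ the coefficient vector of z, each ∂ᵢ∂ⱼ z^{k+2} is m z^k ξᵢξⱼ for the same m, so the
  -- operator yields m z^k times the dual form at ξ. Isotropy is stated over ℚ extended by θ, where
  -- it is decidable, and carried over to polynomials by `C.extend`.
  laplacian-power : ∀ f → Isotropic f → ∀ k → laplacian (powerᑫ (2 ℕ.+ k) f) Qx.≈ []
  -- The extended derivations act componentwise, so the real part of the operator on z^{k+2} is the
  -- operator on the real part.
  laplacian-power f isotropic k = Gᑫ.A[θ].re-≈ {x = dualForm Gᑫ.A[θ].ring D²} (begin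
    dualForm Gᑫ.A[θ].ring D²
      ≈⟨ dualForm-cong Gᑫ.A[θ].ring D² (λ i j → (m ×ᴱ zᵏ) Q[θ].* ξξ i j) (λ i j → Q[θ].trans
           (𝐝²-^ (∂ᴱ j) (∂ᴱ i) z (D²z≈0 i j) k)
           (Q[θ].trans (×-congʳ m (Q[θ].*-congˡ {zᵏ} (Q[θ].*-cong (Dz i) (Dz j))))
             (Q[θ].sym (Q[θ].trans (×-assoc-* m zᵏ (ξξ i j)) Q[θ].refl)))) ⟩
    dualForm Gᑫ.A[θ].ring (λ i j → (m ×ᴱ zᵏ) Q[θ].* ξξ i j)
      ≈⟨ dualForm-* Gᑫ.A[θ].ring (m ×ᴱ zᵏ) ξξ ⟩
    (m ×ᴱ zᵏ) Q[θ].* dualForm Gᑫ.A[θ].ring ξξ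
      ≈⟨ Q[θ].*-congˡ {m ×ᴱ zᵏ} (dualForm-cong Gᑫ.A[θ].ring
           (λ i j → C.extend (coordinate f i ℚ[θ].* coordinate f j)) ξξ (λ i j →
           C.extend-* (coordinate f i) (coordinate f j))) ⟨
    (m ×ᴱ zᵏ) Q[θ].* dualForm Gᑫ.A[θ].ring (λ i j → C.extend (coordinate f i ℚ[θ].* coordinate f j))
      ≈⟨ Q[θ].*-congˡ {m ×ᴱ zᵏ} (extend-dualForm (λ i j → coordinate f i ℚ[θ].* coordinate f j)) ⟨
    (m ×ᴱ zᵏ) Q[θ].* C.extend (dualForm ℚ[θ].ring (λ i j → coordinate f i ℚ[θ].* coordinate f j))
      ≈⟨ Q[θ].*-congˡ {m ×ᴱ zᵏ} (Q[θ].trans (C.extend-cong isotropic) (constant-0 Gᑫ.A[θ]., constant-0)) ⟩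
    (m ×ᴱ zᵏ) Q[θ].* Q[θ].0#
      ≈⟨ Q[θ].zeroʳ (m ×ᴱ zᵏ) ⟩
    Q[θ].0# ∎)
    where
    open Relation.Binary.Reasoning.Setoid Q[θ].setoid
    z = formᑫ f
    zᵏ = z Gᑫ.A[θ].^ k
    m = (2 ℕ.+ k) ℕ.* (1 ℕ.+ k)
    ξξ D² : Fin 3 → Fin 3 → Gᑫ.A[θ].E
    ξξ i j = C.extend (coordinate f i) Q[θ].* C.extend (coordinate f j)
    D² i j = Derivation.𝐝 (∂ᴱ i) (Derivation.𝐝 (∂ᴱ j) (z Gᑫ.A[θ].^ (2 ℕ.+ k)))
    Dz : ∀ i → Derivation.𝐝 (∂ᴱ i) z Q[θ].≈ C.extend (coordinate f i)
    Dz i = ∂-lin i (proj₁ f) Gᑫ.A[θ]., ∂-lin i (proj₂ f)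
    D²z≈0 : ∀ i j → Derivation.𝐝 (∂ᴱ i) (Derivation.𝐝 (∂ᴱ j) z) Q[θ].≈ Q[θ].0#
    D²z≈0 i j = Q[θ].trans (Derivation.𝐝-cong (∂ᴱ i) (Dz j))
      (∂-constant i (Vec.lookup (proj₁ f) j) Gᑫ.A[θ]., ∂-constant i (Vec.lookup (proj₂ f) j))
    extend-dualForm : ∀ y → C.extend (dualForm ℚ[θ].ring y) Q[θ].≈
                      dualForm Gᑫ.A[θ].ring (λ i j → C.extend (y i j))
    extend-dualForm y = const-6 _ _ _ _ _ _ Gᑫ.A[θ]., const-6 _ _ _ _ _ _
      where
      const-6 : ∀ a b c d e f → ℚ[x].constant (a ℚ.+ b ℚ.+ c ℚ.+ d ℚ.+ e ℚ.+ f) Qx.≈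
        ℚ[x].constant a ℚ[x].+ ℚ[x].constant b ℚ[x].+ ℚ[x].constant c
          ℚ[x].+ ℚ[x].constant d ℚ[x].+ ℚ[x].constant e ℚ[x].+ ℚ[x].constant f
      const-6 a b c d e f = Qx.trans (constant-+ _ f) (Qx.+-congʳ (Qx.trans (constant-+ _ e)
        (Qx.+-congʳ (Qx.trans (constant-+ _ d) (Qx.+-congʳ (Qx.trans (constant-+ _ c)
          (Qx.+-congʳ (constant-+ a b))))))))

  isotropic-orbit : All Isotropic orbitᑫ
  isotropic-orbit = toWitness {a? = All.all? isotropic? orbitᑫ} _
    where
    isotropic? : ∀ f → Dec (Isotropic f)
    isotropic? f = map′ (λ (p , q) → p ℚ[θ]., q) (λ (p ℚ[θ]., q) → p , q)
      ((re value ℚ.≟ 0ℚ) ×-dec (im value ℚ.≟ 0ℚ))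
      where value = dualForm ℚ[θ].ring λ i j → coordinate f i ℚ[θ].* coordinate f j

laplacian-sumᑫ : ∀ k → laplacian (sumᑫ (powerᑫ (2 ℕ.+ k)) orbitᑫ) Qx.≈ []
laplacian-sumᑫ k = go isotropic-orbit
  where
  go : ∀ {fs} → All Isotropic fs → laplacian (sumᑫ (powerᑫ (2 ℕ.+ k)) fs) Qx.≈ []
  go []                  = Qx.refl
  go {f ∷ fs} (iso ∷ is) = Qx.trans (laplacian-+ (powerᑫ (2 ℕ.+ k) f) (sumᑫ (powerᑫ (2 ℕ.+ k)) fs))
    (Qx.+-cong (laplacian-power f iso k) (go is))

-- Linear substitutions acting on the orbit.

module _ {c ℓ} (𝓒 : CommutativeRing c ℓ) where
  open CommutativeRing 𝓒

  transpose-sum : ∀ r₀ r₁ r₂ m₀₀ m₀₁ m₀₂ m₁₀ m₁₁ m₁₂ m₂₀ m₂₁ m₂₂ x y z →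
    r₀ * (m₀₀ * x + (m₁₀ * y + (m₂₀ * z + 0#))) + r₁ * (m₀₁ * x + (m₁₁ * y + (m₂₁ * z + 0#)))
      + r₂ * (m₀₂ * x + (m₁₂ * y + (m₂₂ * z + 0#))) ≈
    (m₀₀ * r₀ + m₀₁ * r₁ + m₀₂ * r₂) * x + (m₁₀ * r₀ + m₁₁ * r₁ + m₁₂ * r₂) * y
      + (m₂₀ * r₀ + m₂₁ * r₁ + m₂₂ * r₂) * z
  transpose-sum = solve 15 (λ r₀ r₁ r₂ m₀₀ m₀₁ m₀₂ m₁₀ m₁₁ m₁₂ m₂₀ m₂₁ m₂₂ x y z →
    r₀ :* (m₀₀ :* x :+ (m₁₀ :* y :+ (m₂₀ :* z :+ con 0)))
      :+ r₁ :* (m₀₁ :* x :+ (m₁₁ :* y :+ (m₂₁ :* z :+ con 0)))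
      :+ r₂ :* (m₀₂ :* x :+ (m₁₂ :* y :+ (m₂₂ :* z :+ con 0))) :=
    (m₀₀ :* r₀ :+ m₀₁ :* r₁ :+ m₀₂ :* r₂) :* x :+ (m₁₀ :* r₀ :+ m₁₁ :* r₁ :+ m₁₂ :* r₂) :* y
      :+ (m₂₀ :* r₀ :+ m₂₁ :* r₁ :+ m₂₂ :* r₂) :* z) refl
    where open Doubling.Solver 𝓒

infixr 7 _·ᶜ_
-- Coefficient vectors of linear forms are columns: substituting xM for x in the form with
-- coefficients r gives the form with coefficients Mr.
_·ᶜ_ : Mat → Vec ℚ 3 → Vec ℚ 3
M ·ᶜ r = Vec.tabulate λ i → (M ! i , 0F) ℚ.* Vec.lookup r 0F ℚ.+ (M ! i , 1F) ℚ.* Vec.lookup r 1F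
                      ℚ.+ (M ! i , 2F) ℚ.* Vec.lookup r 2F

lin-⟨x⟩ : ∀ M r → linᑫ r ⟨x M ⟩ Qx.≈ linᑫ (M ·ᶜ r)
lin-⟨x⟩ M r = begin
  (term 0F + term 1F + term 2F) ⟨ σ ⟩
    ≈⟨ ⟨⟩-+ σ (term 0F + term 1F) (term 2F) ⟩
  (term 0F + term 1F) ⟨ σ ⟩ + term 2F ⟨ σ ⟩
    ≈⟨ Qx.+-cong (⟨⟩-+ σ (term 0F) (term 1F)) (term-⟨⟩ 2F) ⟩
  term 0F ⟨ σ ⟩ + term 1F ⟨ σ ⟩ + constant (r !! 2F) * σ 2F
    ≈⟨ Qx.+-congʳ (Qx.+-cong (term-⟨⟩ 0F) (term-⟨⟩ 1F)) ⟩
  constant (r !! 0F) * σ 0F + constant (r !! 1F) * σ 1F + constant (r !! 2F) * σ 2F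
    ≈⟨ transpose-sum ℚ[x]-ring (constant (r !! 0F)) (constant (r !! 1F)) (constant (r !! 2F))
         (m 0F 0F) (m 0F 1F) (m 0F 2F) (m 1F 0F) (m 1F 1F) (m 1F 2F) (m 2F 0F) (m 2F 1F) (m 2F 2F)
         (var 0F) (var 1F) (var 2F) ⟩
  column 0F * var 0F + column 1F * var 1F + column 2F * var 2F
    ≈⟨ Qx.+-cong (Qx.+-cong (Qx.*-congʳ {var 0F} (column≈ 0F)) (Qx.*-congʳ {var 1F} (column≈ 1F)))
         (Qx.*-congʳ {var 2F} (column≈ 2F)) ⟨
  linᑫ (M ·ᶜ r) ∎
  where
  open ℚ[x]
  open Relation.Binary.Reasoning.Setoid Qx.setoid
  infixl 9 _!!_
  _!!_ : Vec ℚ 3 → Fin 3 → ℚ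
  _!!_ = Vec.lookup
  σ term column : Fin 3 → Poly
  σ j = sum λ i → (M ! i , j) · var i
  term j = (r !! j) · var j
  m : Fin 3 → Fin 3 → Poly
  m i j = constant (M ! i , j)
  column i = m i 0F * constant (r !! 0F) + m i 1F * constant (r !! 1F) + m i 2F * constant (r !! 2F)
  term-⟨⟩ : ∀ j → term j ⟨ σ ⟩ Qx.≈ constant (r !! j) * σ j
  term-⟨⟩ j = Qx.trans (⟨⟩-* σ (constant (r !! j)) (var j))
    (Qx.*-cong (⟨⟩-constant σ (r !! j)) (var-⟨⟩ σ j))
  column≈ : ∀ i → constant ((M ! i , 0F) ℚ.* r !! 0F ℚ.+ (M ! i , 1F) ℚ.* r !! 1F
                    ℚ.+ (M ! i , 2F) ℚ.* r !! 2F) Qx.≈ column i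
  column≈ i = Qx.trans (constant-+ (a ℚ.+ b) c) (Qx.+-cong
    (Qx.trans (constant-+ a b) (Qx.+-cong (constant-* (M ! i , 0F) (r !! 0F))
      (constant-* (M ! i , 1F) (r !! 1F))))
    (constant-* (M ! i , 2F) (r !! 2F)))
    where
    a = (M ! i , 0F) ℚ.* r !! 0F
    b = (M ! i , 1F) ℚ.* r !! 1F
    c = (M ! i , 2F) ℚ.* r !! 2F

transform : Mat → Formᑫ → Formᑫ
transform M (p , q) = M ·ᶜ p , M ·ᶜ q

power-⟨x⟩ : ∀ M k f → powerᑫ k f ⟨x M ⟩ Qx.≈ powerᑫ k (transform M f)
power-⟨x⟩ M k f = Gᑫ.A[θ].re-≈ (Q[θ].trans (extend-^ (formᑫ f) k)
  (E^.^-congˡ k (lin-⟨x⟩ M (proj₁ f) Gᑫ.A[θ]., lin-⟨x⟩ M (proj₂ f))))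
  where
  σ : Fin 3 → ℚ[x].Poly
  σ j = ℚ[x].sum λ i → (M ! i , j) ℚ[x].· ℚ[x].var i
  open ExtendHomomorphism ℚ[x]-ring ℚ[x]-ring Gᑫ.-2ᴬ Gᑫ.-2ᴬ (⟨⟩-homomorphism σ)
    (⟨⟩-constant σ (fromℤ -[1+ 1 ]))
  module E^ = Algebra.Properties.Semiring.Exp Q[θ].semiring

sum-⟨x⟩ : ∀ M k fs → sumᑫ (powerᑫ k) fs ⟨x M ⟩ Qx.≈ sumᑫ (powerᑫ k) (List.map (transform M) fs)
sum-⟨x⟩ M k []       = Qx.refl
sum-⟨x⟩ M k (f ∷ fs) = Qx.trans (⟨⟩-+ σ (powerᑫ k f) (sumᑫ (powerᑫ k) fs))
  (Qx.+-cong (power-⟨x⟩ M k f) (sum-⟨x⟩ M k fs))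
  where
  σ : Fin 3 → ℚ[x].Poly
  σ j = ℚ[x].sum λ i → (M ! i , j) ℚ[x].· ℚ[x].var i

negate : Vec ℚ 3 → Vec ℚ 3
negate = Vec.map (λ a → ℚ.- a)

lin-negate : ∀ v → linᑫ (negate v) Qx.≈ ℚ[x].- linᑫ v
lin-negate v = Qx.reflexive (≡.cong₂ _∷_ (≡.cong (_, _) (neg-*1 0F)) (≡.cong₂ _∷_
    (≡.cong (_, _) (neg-*1 1F)) (≡.cong (λ a → (a , _) ∷ []) (neg-*1 2F))))
  where
  neg-*1 : ∀ i → Vec.lookup (negate v) i ℚ.* 1ℚ ≡ ℚ.- (Vec.lookup v i ℚ.* 1ℚ)
  neg-*1 i = ≡.trans (≡.cong (ℚ._* 1ℚ) (Vec.lookup-map i (λ a → ℚ.- a) v))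
    (≡.sym (ℚ.neg-distribˡ-* (Vec.lookup v i) 1ℚ))

infix 4 _±_ _±ᶠ_
_±_ : Vec ℚ 3 → Vec ℚ 3 → Set
p ± q = p ≡ q ⊎ p ≡ negate q

_±ᶠ_ : Formᑫ → Formᑫ → Set
(p , q) ±ᶠ (p′ , q′) = p ± p′ × q ± q′

_±ᶠ?_ : ∀ f g → Dec (f ±ᶠ g)
(p , q) ±ᶠ? (p′ , q′) = (p ±? p′) ×-dec (q ±? q′)
  where
  _≟_ = Vec.≡-dec {n = 3} ℚ._≟_
  _±?_ : ∀ p q → Dec (p ± q)
  p ±? q = (p ≟ q) ⊎-dec (p ≟ negate q)

-- Independent signs on the two components amount to a common sign, harmless for an even exponent,
-- and a conjugation, harmless for the real part.
power-± : ∀ m f g → f ±ᶠ g → powerᑫ (2 ℕ.* m) f Qx.≈ powerᑫ (2 ℕ.* m) g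
power-± m (p , q) (p′ , q′) (p± , q±) = cases p± q±
  where
  open Gᑫ.A[θ] using (conj; conj-^; neg-^-even; re-≈; _^_)
  module E^ = Algebra.Properties.Semiring.Exp Q[θ].semiring
  k = 2 ℕ.* m
  z = formᑫ (p′ , q′)
  conj-case : ∀ {z′} → z′ Q[θ].≈ conj z → re (z′ ^ k) Qx.≈ re (z ^ k)
  conj-case eq = re-≈ (Q[θ].trans (E^.^-congˡ k eq) (Q[θ].sym (conj-^ z k)))
  neg-case : ∀ z′ z″ → z′ Q[θ].≈ Q[θ].- z″ → re (z′ ^ k) Qx.≈ re (z″ ^ k)
  neg-case z′ z″ eq = re-≈ (Q[θ].trans (E^.^-congˡ k eq) (neg-^-even z″ m))
  cases : p ± p′ → q ± q′ → re (formᑫ (p , q) ^ k) Qx.≈ re (z ^ k)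
  cases (inj₁ ≡.refl) (inj₁ ≡.refl) = Qx.refl
  cases (inj₁ ≡.refl) (inj₂ ≡.refl) = conj-case (Qx.refl Gᑫ.A[θ]., lin-negate q′)
  cases (inj₂ ≡.refl) (inj₂ ≡.refl) =
    neg-case (formᑫ (p , q)) z (lin-negate p′ Gᑫ.A[θ]., lin-negate q′)
  cases (inj₂ ≡.refl) (inj₁ ≡.refl) = Qx.trans
    (neg-case (formᑫ (p , q)) (conj z) (lin-negate p′ Gᑫ.A[θ].,
      Qx.sym (-‿involutive (linᑫ q′))))
    (conj-case Q[θ].refl)
    where open Algebra.Properties.Ring Qx.ring using (-‿involutive)

remove : Formᑫ → List Formᑫ → Maybe (List Formᑫ)
remove f []       = nothing
remove f (g ∷ gs) with f ±ᶠ? g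
... | yes _ = just gs
... | no  _ = Maybe.map (g ∷_) (remove f gs)

-- Greedy comparison of two lists as multisets modulo `_±ᶠ_`. It is Boolean, so that invariance
-- under a concrete matrix becomes an evaluation.
matches : List Formᑫ → List Formᑫ → Bool
matches []       []      = true
matches []       (_ ∷ _) = false
matches (f ∷ fs) gs      = Maybe.maybe′ (matches fs) false (remove f gs)

module _ (P : Formᑫ → ℚ[x].Poly) (P-± : ∀ f g → f ±ᶠ g → P f Qx.≈ P g) where

  remove-sound : ∀ f gs {gs′} → remove f gs ≡ just gs′ → sumᑫ P gs Qx.≈ P f ℚ[x].+ sumᑫ P gs′
  remove-sound f (g ∷ gs) eq with f ±ᶠ? g
  remove-sound f (g ∷ gs) ≡.refl | yes f±g = Qx.+-congʳ (Qx.sym (P-± f g f±g))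
  remove-sound f (g ∷ gs) eq     | no _ with remove f gs in eq′
  remove-sound f (g ∷ gs) ≡.refl | no _ | just gs′ =
    Qx.trans (Qx.+-congˡ {P g} (remove-sound f gs eq′)) (x+yz≈y+xz (P g) (P f) (sumᑫ P gs′))
    where open Algebra.Properties.CommutativeSemigroup Qx.+-commutativeSemigroup
            using () renaming (x∙yz≈y∙xz to x+yz≈y+xz)

  matches-sound : ∀ fs gs → matches fs gs ≡ true → sumᑫ P fs Qx.≈ sumᑫ P gs
  matches-sound []       []  _  = Qx.refl
  matches-sound (f ∷ fs) gs  eq with just gs′ ← remove f gs in eq′ =
    Qx.trans (Qx.+-congˡ {P f} (matches-sound fs gs′ eq)) (Qx.sym (remove-sound f gs eq′))

Preserved : Mat → Set
Preserved M = matches (List.map (transform M) orbitᑫ) orbitᑫ ≡ true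

preserved⇒invariant : ∀ M → Preserved M → ∀ m →
  sumᑫ (powerᑫ (2 ℕ.* m)) orbitᑫ ⟨x M ⟩ Qx.≈ sumᑫ (powerᑫ (2 ℕ.* m)) orbitᑫ
preserved⇒invariant M preserved m = Qx.trans (sum-⟨x⟩ M (2 ℕ.* m) orbitᑫ)
  (matches-sound (powerᑫ (2 ℕ.* m)) (power-± m) (List.map (transform M) orbitᑫ) orbitᑫ preserved)

-- Reduction of the unit group to a finite check.

-- `𝓕-mat` freed from the invertibility proofs: it can be evaluated on candidate units and
-- transported along an equation for the inverse.
conjugationMatrix : D → D → Mat
conjugationMatrix h g = Vec.map (λ b → coordinates (h *ᴰ b *ᴰ g)) (𝐛₁ ∷ 𝐛₂ ∷ 𝐛₃ ∷ [])

π-preserved : Preserved (mat⁻¹ (𝓕 π))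
π-preserved = ≡.refl

range : List ℤ
range = -[1+ 1 ] ∷ -[1+ 0 ] ∷ + 0 ∷ + 1 ∷ + 2 ∷ []

UnitPreserved : ℤ → ℤ → ℤ → ℤ → Set
UnitPreserved n₀ n₁ n₂ n₃ = Parity.quadratic n₀ n₁ n₂ n₃ ≡ + 1 →
  let u = hurwitz n₀ n₁ n₂ n₃ in Preserved (conjugationMatrix (ι u) u)

-- A search through 5⁴ coordinate vectors; the candidates of norm different from 1 pass by the
-- failing premise.
units-preserved :
  All (λ n₀ → All (λ n₁ → All (λ n₂ → All (UnitPreserved n₀ n₁ n₂) range) range) range) range
units-preserved = toWitness {a? = All.all? (λ n₀ → All.all? (λ n₁ → All.all? (λ n₂ → All.all? (λ n₃ →
    (Parity.quadratic n₀ n₁ n₂ n₃ ℤ.≟ + 1) →-dec (_ Bool.≟ true))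
  range) range) range) range} _

module _ {c ℓ} (𝓒 : CommutativeRing c ℓ) where
  open CommutativeRing 𝓒
  open Doubling 𝓒
  open Algebra.Definitions.RawSemiring (RawRing.rawSemiring rawRing) using (_^_)

  ^-mod-2 : ∀ x y k → ∃[ z ] (x + double y) ^ k ≈ x ^ k + double z
  ^-mod-2 x y zero    = 0# , solve 0 (con 1 := con 1 :+ :double (con 0)) refl
    where open Solver
  ^-mod-2 x y (suc k) with ^-mod-2 x y k
  ... | z , eq = x * z + y * (x ^ k + double z) , trans (*-congˡ eq)
    (solve 4 (λ x y X z → (x :+ :double y) :* (X :+ :double z) :=
      x :* X :+ :double (x :* z :+ y :* (X :+ :double z))) refl x y (x ^ k) z)
    where open Solver

∈-range : ∀ i → ℤ.∣ i ∣ ℕ.≤ 2 → i ∈ˡ range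
∈-range -[1+ 1 ]             _ = here ≡.refl
∈-range -[1+ 0 ]             _ = there (here ≡.refl)
∈-range (+ 0)                _ = there (there (here ≡.refl))
∈-range (+ 1)                _ = there (there (there (here ≡.refl)))
∈-range (+ 2)                _ = there (there (there (there (here ≡.refl))))
∈-range (+ suc (suc (suc _))) (s≤s (s≤s ()))
∈-range -[1+ suc (suc _) ]    (s≤s (s≤s ()))

open Parity using (quadratic)

square-abs : ∀ i → i ℤ.* i ≡ + (ℤ.∣ i ∣ ℕ.* ℤ.∣ i ∣)
square-abs (+ n)    = ≡.sym (ℤ.pos-* n n)
square-abs -[1+ n ] = ≡.refl

-- Completion of the squares in n₀, n₁, n₂. Written with natural numbers, the result serves both for
-- the sign of the norm and for bounding the coordinates.
4*quadratic : ∀ n₀ n₁ n₂ n₃ → + 4 ℤ.* quadratic n₀ n₁ n₂ n₃ ≡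
  + (ℤ.∣ + 2 ℤ.* n₀ ℤ.+ n₃ ∣ ℕ.* ℤ.∣ + 2 ℤ.* n₀ ℤ.+ n₃ ∣
    ℕ.+ ℤ.∣ + 2 ℤ.* n₁ ℤ.+ n₃ ∣ ℕ.* ℤ.∣ + 2 ℤ.* n₁ ℤ.+ n₃ ∣
    ℕ.+ ℤ.∣ + 2 ℤ.* n₂ ℤ.+ n₃ ∣ ℕ.* ℤ.∣ + 2 ℤ.* n₂ ℤ.+ n₃ ∣ ℕ.+ ℤ.∣ n₃ ∣ ℕ.* ℤ.∣ n₃ ∣)
4*quadratic n₀ n₁ n₂ n₃ = ≡.trans
  (solve 4 (λ n₀ n₁ n₂ n₃ → let sq = λ n → (con (+ 2) :* n :+ n₃) :* (con (+ 2) :* n :+ n₃) in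
    con (+ 4) :* (n₀ :* n₀ :+ n₁ :* n₁ :+ n₂ :* n₂ :+ n₃ :* n₃ :+ n₃ :* (n₀ :+ n₁ :+ n₂)) :=
    sq n₀ :+ sq n₁ :+ sq n₂ :+ n₃ :* n₃) ≡.refl n₀ n₁ n₂ n₃)
  (≡.cong₂ ℤ._+_ (≡.cong₂ ℤ._+_ (≡.cong₂ ℤ._+_ (square-abs (+ 2 ℤ.* n₀ ℤ.+ n₃))
    (square-abs (+ 2 ℤ.* n₁ ℤ.+ n₃))) (square-abs (+ 2 ℤ.* n₂ ℤ.+ n₃))) (square-abs n₃))
  where open Data.Integer.Solver.+-*-Solver

-- A divisor of 1 in ℤ is 1 or -1, and the first hypothesis excludes the negative one.
nonNegative-unit : ∀ q k s → + 4 ℤ.* q ≡ + s → q ℤ.* k ≡ + 1 → q ≡ + 1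
nonNegative-unit (+ n) k s _ nk≡1 =
  ≡.cong +_ (ℕ.m*n≡1⇒m≡1 n ℤ.∣ k ∣ (≡.trans (≡.sym (ℤ.abs-* (+ n) k)) (≡.cong ℤ.∣_∣ nk≡1)))
nonNegative-unit -[1+ n ] k s ()

square≤4⇒≤2 : ∀ n → n ℕ.* n ℕ.≤ 4 → n ℕ.≤ 2
square≤4⇒≤2 n n²≤4 = ℕ.≮⇒≥ λ 3≤n →
  contradiction (ℕ.≤-trans (ℕ.*-mono-≤ 3≤n 3≤n) n²≤4) λ where (s≤s (s≤s (s≤s (s≤s ()))))

-- Each of the four squares with sum 4 is at most 4, so that 2|nᵢ| ≤ |2nᵢ + n₃| + |n₃| ≤ 4 for i =
-- 0, 1, 2.
quadratic≡1⇒bounded : ∀ n₀ n₁ n₂ n₃ → quadratic n₀ n₁ n₂ n₃ ≡ + 1 →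
  ℤ.∣ n₀ ∣ ℕ.≤ 2 × ℤ.∣ n₁ ∣ ℕ.≤ 2 × ℤ.∣ n₂ ∣ ℕ.≤ 2 × ℤ.∣ n₃ ∣ ℕ.≤ 2
quadratic≡1⇒bounded n₀ n₁ n₂ n₃ q≡1 = bound n₀ a≤4 , bound n₁ b≤4 , bound n₂ c≤4 , n₃≤2
  where
  sq : ℤ → ℕ
  sq n = ℤ.∣ + 2 ℤ.* n ℤ.+ n₃ ∣ ℕ.* ℤ.∣ + 2 ℤ.* n ℤ.+ n₃ ∣
  n₃² = ℤ.∣ n₃ ∣ ℕ.* ℤ.∣ n₃ ∣
  sum≡4 : 4 ≡ sq n₀ ℕ.+ sq n₁ ℕ.+ sq n₂ ℕ.+ n₃²
  sum≡4 = ℤ.+-injective (≡.trans (≡.cong (+ 4 ℤ.*_) (≡.sym q≡1)) (4*quadratic n₀ n₁ n₂ n₃))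
  abc≤4 : sq n₀ ℕ.+ sq n₁ ℕ.+ sq n₂ ℕ.≤ 4
  abc≤4 = ℕ.≤-trans (ℕ.m≤m+n _ n₃²) (ℕ.≤-reflexive (≡.sym sum≡4))
  ab≤4 = ℕ.≤-trans (ℕ.m≤m+n (sq n₀ ℕ.+ sq n₁) (sq n₂)) abc≤4
  a≤4 = ℕ.≤-trans (ℕ.m≤m+n (sq n₀) (sq n₁)) ab≤4
  b≤4 = ℕ.≤-trans (ℕ.m≤n+m (sq n₁) (sq n₀)) ab≤4
  c≤4 = ℕ.≤-trans (ℕ.m≤n+m (sq n₂) (sq n₀ ℕ.+ sq n₁)) abc≤4
  n₃≤2 = square≤4⇒≤2 ℤ.∣ n₃ ∣ (ℕ.≤-trans (ℕ.m≤n+m n₃² (sq n₀ ℕ.+ sq n₁ ℕ.+ sq n₂))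
    (ℕ.≤-reflexive (≡.sym sum≡4)))
  bound : ∀ n → sq n ℕ.≤ 4 → ℤ.∣ n ∣ ℕ.≤ 2
  bound n sq≤4 = ℕ.*-cancelˡ-≤ 2 (begin
    2 ℕ.* ℤ.∣ n ∣                               ≡⟨ ℤ.abs-* (+ 2) n ⟨
    ℤ.∣ + 2 ℤ.* n ∣                             ≡⟨ ≡.cong ℤ.∣_∣ (solve 2 (λ n n₃ →
      con (+ 2) :* n := con (+ 2) :* n :+ n₃ :- n₃) ≡.refl n n₃) ⟩
    ℤ.∣ + 2 ℤ.* n ℤ.+ n₃ ℤ.- n₃ ∣               ≤⟨ ℤ.∣i-j∣≤∣i∣+∣j∣ (+ 2 ℤ.* n ℤ.+ n₃) n₃ ⟩
    ℤ.∣ + 2 ℤ.* n ℤ.+ n₃ ∣ ℕ.+ ℤ.∣ n₃ ∣         ≤⟨ ℕ.+-mono-≤ (square≤4⇒≤2 _ sq≤4) n₃≤2 ⟩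
    4                                           ∎)
    where
    open ℕ.≤-Reasoning
    open Data.Integer.Solver.+-*-Solver

-- The norms of a unit and of its inverse are integers with product 1, and norms are non-negative.
-- So the norm is 1, the inverse is the conjugate, and the coordinates lie in the searched range.
unit-preserved : ∀ u → u ∈ 𝒪ˣ → Preserved (mat (𝓕 u))
unit-preserved (g , h , hg≡1 , gh≡1) ((n₀ , n₁ , n₂ , n₃ , ≡.refl) , (m₀ , m₁ , m₂ , m₃ , h≡)) =
  ≡.subst (λ h → Preserved (conjugationMatrix h g)) (≡.sym h≡ιg)
    (All.lookup (All.lookup (All.lookup (All.lookup units-preserved
      (∈-range n₀ n₀≤2)) (∈-range n₁ n₁≤2)) (∈-range n₂ n₂≤2)) (∈-range n₃ n₃≤2) q≡1)
  where
  q = quadratic n₀ n₁ n₂ n₃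
  q′ = quadratic m₀ m₁ m₂ m₃
  open ≡.≡-Reasoning
  q≡1 : q ≡ + 1
  q≡1 = nonNegative-unit q q′ _ (4*quadratic n₀ n₁ n₂ n₃) (fromℤ-injective (begin
    fromℤ (q ℤ.* q′)        ≡⟨ fromℤ-* q q′ ⟩
    fromℤ q ℚ.* fromℤ q′    ≡⟨ ≡.cong₂ ℚ._*_ (N-hurwitz n₀ n₁ n₂ n₃)
                                 (≡.trans (≡.cong N h≡) (N-hurwitz m₀ m₁ m₂ m₃)) ⟨
    N g ℚ.* N h             ≡⟨ N-* g h ⟨
    N (g *ᴰ h)              ≡⟨ ≡.cong N gh≡1 ⟩
    N 1ᴰ                    ∎))
  Ng≡1 : N g ≡ 1ℚ
  Ng≡1 = ≡.trans (N-hurwitz n₀ n₁ n₂ n₃) (≡.cong fromℤ q≡1)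
  h≡ιg : h ≡ ι g
  h≡ιg = inverse-unique g h (ι g) hg≡1 (≡.trans (Nm≡N g) (≡.cong fromℚ Ng≡1))
  bounds = quadratic≡1⇒bounded n₀ n₁ n₂ n₃ q≡1
  n₀≤2 = proj₁ bounds
  n₁≤2 = proj₁ (proj₂ bounds)
  n₂≤2 = proj₁ (proj₂ (proj₂ bounds))
  n₃≤2 = proj₂ (proj₂ (proj₂ bounds))

-- Membership in `ℋ₊^Γ`, the congruence, and the theorem.

private
  module toℚ = SemiringMorphisms.IsSemiringHomomorphism toℚ[x]-homomorphism
  open Algebra.Definitions.RawSemiring (RawRing.rawSemiring Zx.rawRing) using () renaming (_^_ to _^ᶻ_)
  open Algebra.Definitions.RawSemiring (RawRing.rawSemiring ℚ.+-*-rawRing) using () renaming (_^_ to _^ᑫ_)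

orbitSum : ℕ → ℚ[x].Poly
orbitSum k = sumᑫ (powerᑫ k) orbitᑫ

divide-by-2^ : ∀ e → ∃[ c ] ∀ g → c ℚ[x].· toℚ[x] (Gᶻ.2ᴬ ^ᶻ e ℤ[x].* g) Qx.≈ toℚ[x] g
divide-by-2^ zero = 1ℚ , λ g → Qx.trans (Qx.*-identityˡ (toℚ[x] (Zx.1# ℤ[x].* g)))
  (toℚ.⟦⟧-cong (Zx.*-identityˡ g))
divide-by-2^ (suc e) = ½ ℚ.* proj₁ ih , λ g → begin
  constant (½ ℚ.* c) * toℚ[x] (2ᴬ Zx.* 2^e Zx.* g)
    ≈⟨ Qx.*-cong (constant-* ½ c) (Qx.trans (toℚ.⟦⟧-cong (Zx.*-assoc 2ᴬ 2^e g))
         (toℚ.*-homo 2ᴬ (2^e Zx.* g))) ⟩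
  constant ½ * constant c * (toℚ[x] 2ᴬ * toℚ[x] (2^e Zx.* g))
    ≈⟨ interchange (constant ½) (constant c) (toℚ[x] 2ᴬ) (toℚ[x] (2^e Zx.* g)) ⟩
  constant ½ * toℚ[x] 2ᴬ * (constant c * toℚ[x] (2^e Zx.* g))
    ≈⟨ Qx.*-cong ½*2≈1 (proj₂ ih g) ⟩
  constant 1ℚ * toℚ[x] g
    ≈⟨ Qx.*-identityˡ (toℚ[x] g) ⟩
  toℚ[x] g ∎
  where
  open ℚ[x]
  open Gᶻ using (2ᴬ)
  open Relation.Binary.Reasoning.Setoid Qx.setoid
  open Algebra.Properties.CommutativeSemigroup Qx.*-commutativeSemigroup using (interchange)
  ih = divide-by-2^ e
  c = proj₁ ih
  2^e = 2ᴬ ^ᶻ e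
  ½*2≈1 : constant ½ * toℚ[x] 2ᴬ Qx.≈ constant 1ℚ
  ½*2≈1 = Qx.trans (Qx.*-congˡ {constant ½} (Qx.sym (constant-+ 1ℚ 1ℚ)))
    (Qx.sym (constant-* ½ (1ℚ ℚ.+ 1ℚ)))

-1^-even : ∀ m → (ℚ.- 1ℚ) ^ᑫ (2 ℕ.* m) ≡ 1ℚ
-1^-even m = ≡.trans (≡.sym (^-assocʳ (ℚ.- 1ℚ) 2 m)) (1^ m)
  where
  open Algebra.Properties.Semiring.Exp (CommutativeRing.semiring ℚ.+-*-commutativeRing) using (^-assocʳ)
  1^ : ∀ m → 1ℚ ^ᑫ m ≡ 1ℚ
  1^ zero    = ≡.refl
  1^ (suc m) = ≡.trans (ℚ.*-identityˡ _) (1^ m)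

module _ (m k : ℕ) (l≡ : 2 ℕ.* m ≡ 2 ℕ.+ k) (c : ℚ) {f : ℚ[x].Poly}
  (f≈cG : f Qx.≈ c ℚ[x].· orbitSum (2 ℕ.* m)) where

  open ℚ[x]ᴿ using (coefficients; coeff-·; isobaric⇒homogeneous; ⟨⟩-cong)
  private
    l = 2 ℕ.* m
    G = orbitSum l

    laplacian-G : laplacian G Qx.≈ []
    laplacian-G = ≡.subst (λ l → laplacian (orbitSum l) Qx.≈ []) (≡.sym l≡) (laplacian-sumᑫ k)

    harmonic : Δ_Q f Qx.≈ []
    harmonic = begin
      ½ · laplacian f          ≈⟨ Qx.*-congˡ {constant ½} (laplacian-cong f≈cG) ⟩
      ½ · laplacian (c · G)    ≈⟨ Qx.*-congˡ {constant ½} (laplacian-· c G) ⟩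
      ½ · (c · laplacian G)    ≈⟨ Qx.*-congˡ {constant ½} (Qx.*-congˡ {constant c} laplacian-G) ⟩
      ½ · (c · [])             ∎
      where
      open ℚ[x]
      open Relation.Binary.Reasoning.Setoid Qx.setoid

    invariant : ∀ M → Preserved M → f ⟨x M ⟩ Qx.≈ f
    invariant M preserved = begin
      f ⟨ σ ⟩                         ≈⟨ ⟨⟩-cong σ f≈cG ⟩
      (c · G) ⟨ σ ⟩                   ≈⟨ ⟨⟩-* σ (constant c) G ⟩
      constant c ⟨ σ ⟩ * G ⟨ σ ⟩      ≈⟨ Qx.*-cong (⟨⟩-constant σ c) (preserved⇒invariant M preserved m) ⟩
      c · G                           ≈⟨ f≈cG ⟨
      f                               ∎
      where
      open ℚ[x]
      open Relation.Binary.Reasoning.Setoid Qx.setoid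
      σ : Fin 3 → Poly
      σ j = sum λ i → (M ! i , j) · var i

  orbitSum∈ℋ₊^Γ : f ∈ ℋ₊^Γ l
  orbitSum∈ℋ₊^Γ =
    ( ( (λ e e≢l → ≡.trans (coefficients f≈cG e) (≡.trans (coeff-· c G e) (≡.trans
          (≡.cong (c ℚ.*_) (isobaric⇒homogeneous (isobaric-powerSum l) e e≢l)) (ℚ.*-zeroʳ c))))
      , coefficients harmonic)
    , λ γ (u , u∈ , γ≡) → coefficients (≡.subst (λ M → f ⟨x M ⟩ Qx.≈ f) (≡.sym γ≡)
        (invariant (mat (𝓕 u)) (unit-preserved u u∈)))) ,
    coefficients (begin
      f ⟨x mat⁻¹ (𝓕 π) ⟩ + []            ≈⟨ Qx.+-identityʳ _ ⟩
      f ⟨x mat⁻¹ (𝓕 π) ⟩                 ≈⟨ invariant (mat⁻¹ (𝓕 π)) π-preserved ⟩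
      f                                  ≈⟨ Qx.*-identityˡ f ⟨
      1ℚ · f                             ≈⟨ Qx.*-congʳ {f} (constant-cong (-1^-even m)) ⟨
      ((ℚ.- 1ℚ) ^ᑫ l) · f                ∎)
    where
    open ℚ[x]
    open Relation.Binary.Reasoning.Setoid Qx.setoid

-- The parity of m separates l = 4n from l = 4n + 2. The bound on m discards l = 0 and also l = 2,
-- where the power sum is zero by `sum-z²`.
divisible : ∀ m → 2 ℕ.≤ m → Gᶻ.Divisible (2 ℕ.* m)
divisible m 2≤m with halve m
divisible _ ()       | zero  , inj₁ ≡.refl
divisible _ (s≤s ()) | zero  , inj₂ ≡.refl
divisible _ _        | suc k , inj₁ ≡.refl = ≡.subst Gᶻ.Divisible l≡ (Gᶻ.divisible-4n k)
  where
  open Data.Nat.Solver.+-*-Solver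
  l≡ : suc k ℕ.* 4 ≡ 2 ℕ.* (suc k ℕ.+ suc k)
  l≡ = solve 1 (λ k → k :* con 4 := con 2 :* (k :+ k)) ≡.refl (suc k)
divisible _ _        | suc k , inj₂ ≡.refl = ≡.subst Gᶻ.Divisible l≡ (Gᶻ.divisible-4n+2 k)
  where
  open Data.Nat.Solver.+-*-Solver
  l≡ : 2 ℕ.+ suc k ℕ.* 4 ≡ 2 ℕ.* (suc k ℕ.+ suc (suc k))
  l≡ = solve 1 (λ k → con 2 :+ k :* con 4 := con 2 :* (k :+ (con 1 :+ k))) ≡.refl (suc k)

-- The two exponentiations belong to raw rings with the same operations but different equality
-- relations, so for a variable exponent they are not definitionally equal.
^≡^ᶻ : ∀ p k → p ℤ[x].^ k ≡ p ^ᶻ k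
^≡^ᶻ p zero    = ≡.refl
^≡^ᶻ p (suc k) = ≡.cong (p ℤ[x].*_) (^≡^ᶻ p k)

Nm-mod-2 : ∃[ g ] NmPoly Zx.≈ Gᶻ.s ^ᶻ 2 ℤ[x].+ (g ℤ[x].+ g)
Nm-mod-2 = evaluate g ρ , equate
  (con (+ 3) :* (X₁ :* X₁ :+ X₂ :* X₂ :+ X₃ :* X₃) :+ :- (con (+ 2) :* (X₁ :* X₂ :+ X₂ :* X₃ :+ X₃ :* X₁)))
  (S :^ 2 :+ (g :+ g)) ≡.refl
  where
  open Gᶻ.Symbolic
  -- Since S² = Σxᵢ² + 2E₂, half of Nm - S² = 2Σxᵢ² - 4E₂ is Σxᵢ² - 2E₂.
  g = X₁ :* X₁ :+ X₂ :* X₂ :+ X₃ :* X₃ :+ con -[1+ 1 ] :* E₂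

≈⇒≡[mod2] : ∀ {f g} p c d → f Zx.≈ p ℤ[x].+ (c ℤ[x].+ c) → g Zx.≈ p ℤ[x].+ (d ℤ[x].+ d) →
             f ≡ g [mod + 2 ]
≈⇒≡[mod2] {f} {g} p c d f≈ g≈ e =
  divides ℤ.∣ cₑ ℤ.- dₑ ∣ (≡.trans (≡.cong ℤ.∣_∣ difference) (ℤ.abs-* (cₑ ℤ.- dₑ) (+ 2)))
  where
  open ℤ[x]ᴿ using (coefficients; coeff-+)
  pₑ = ℤ[x].coeff p e
  cₑ = ℤ[x].coeff c e
  dₑ = ℤ[x].coeff d e
  expand : ∀ {f} c → f Zx.≈ p ℤ[x].+ (c ℤ[x].+ c) →
           ℤ[x].coeff f e ≡ pₑ ℤ.+ (ℤ[x].coeff c e ℤ.+ ℤ[x].coeff c e)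
  expand c f≈ = ≡.trans (coefficients f≈ e) (≡.trans (coeff-+ p (c ℤ[x].+ c) e)
    (≡.cong (λ a → pₑ ℤ.+ a) (coeff-+ c c e)))
  difference : ℤ[x].coeff f e ℤ.- ℤ[x].coeff g e ≡ (cₑ ℤ.- dₑ) ℤ.* + 2
  difference = ≡.trans (≡.cong₂ ℤ._-_ (expand c f≈) (expand d g≈))
    (solve 3 (λ p c d → p :+ (c :+ c) :- (p :+ (d :+ d)) := (c :- d) :* con (+ 2)) ≡.refl pₑ cₑ dₑ)
    where open Data.Integer.Solver.+-*-Solver

power-of-Nm : ∀ m → ∃[ d ] NmPoly ℤ[x].^ m Zx.≈ Gᶻ.s ^ᶻ (2 ℕ.* m) ℤ[x].+ (d ℤ[x].+ d)
power-of-Nm m with ^-mod-2 ℤ[x]-ring (Gᶻ.s ^ᶻ 2) (proj₁ Nm-mod-2) m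
... | d , eq = d , (begin
  NmPoly ^ m                          ≡⟨ ^≡^ᶻ NmPoly m ⟩
  NmPoly ^ᶻ m                         ≈⟨ ^-congˡ m (proj₂ Nm-mod-2) ⟩
  (s ^ᶻ 2 + (g + g)) ^ᶻ m             ≈⟨ eq ⟩
  (s ^ᶻ 2) ^ᶻ m + (d + d)             ≈⟨ Zx.+-congʳ {d + d} (^-assocʳ s 2 m) ⟩
  s ^ᶻ (2 ℕ.* m) + (d + d)            ∎)
  where
  open ℤ[x]
  open Gᶻ using (s)
  open Relation.Binary.Reasoning.Setoid Zx.setoid
  open Algebra.Properties.Semiring.Exp Zx.semiring using (^-assocʳ; ^-congˡ)
  g = proj₁ Nm-mod-2

modularForm : ∀ m → 2 ℕ.≤ m → ∃[ f ] toℚ[x] f ∈ ℋ₊^Γ (2 ℕ.* m) × f ≡ NmPoly ℤ[x].^ m [mod + 2 ]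
modularForm m 2≤m = f ,
  orbitSum∈ℋ₊^Γ m (2 ℕ.* m ℕ.∸ 2) (≡.sym (ℕ.m+[n∸m]≡n (ℕ.≤-trans 2≤m (ℕ.m≤m+n m _)))) c f≈cG ,
  ≈⇒≡[mod2] (Gᶻ.s ^ᶻ (2 ℕ.* m)) half (proj₁ (power-of-Nm m)) quotient≈s^+2half (proj₂ (power-of-Nm m))
  where
  open Gᶻ.Divisible (divisible m 2≤m) renaming (quotient to f)
  c = proj₁ (divide-by-2^ exponent)
  f≈cG : toℚ[x] f Qx.≈ c ℚ[x].· orbitSum (2 ℕ.* m)
  f≈cG = Qx.trans (Qx.sym (proj₂ (divide-by-2^ exponent) f)) (Qx.*-congˡ {ℚ[x].constant c}
    (Qx.trans (toℚ.⟦⟧-cong (Zx.sym powerSum≈2^*)) (Qx.trans (toℚ[x]-powerSum (2 ℕ.* m))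
      (Qx.reflexive (powerSum≡sumᑫ (2 ℕ.* m))))))

open ℤ[x] using (_^_)

theorem3 : ∀ l → 4 ≤ l → l ≤ 40 → 2 ∣ l →
    ∃[ f ] toℚ[x] f ∈ ℋ₊^Γ l × f ≡ NmPoly ^ (l / 2) [mod + 2 ]
theorem3 l 4≤l _ (divides m ≡.refl) =
  ≡.subst₂ (λ l k → ∃[ f ] toℚ[x] f ∈ ℋ₊^Γ l × f ≡ NmPoly ^ k [mod + 2 ])
    (ℕ.*-comm 2 m) (≡.sym (m*n/n≡m m 2)) (modularForm m (ℕ.*-cancelʳ-≤ 2 m 2 4≤l))
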